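{- Suppose $V_0\subseteq V_1$ are models of set theory, $\kappa$ is an infinite ordinal, $X,\mathscr{L}\in V_0$ with $X$ infinite and $\mathscr{L}$ a relational language, and let $\mu\in V_0$ be an invariant measure on $[\mathrm{Str}^\kappa_{\mathscr{L}}(X)]^{V_0}$. Then $\mu$ is dissociated in $V_0$ if and only if $\mu^{V_1}$ is dissociated in $V_1$.
   Context: A model of set theory is a transitive model of ZFC (contained in a fixed background model); $\kappa\in V_0$ need not be a cardinal in any given model. Structures and measures: $\mathrm{Str}_{\mathscr{L}}(X)$ is the set of $\mathscr{L}$-structures with underlying set $X$. An $\mathscr{L}$-literal is an atomic formula or a (possibly iterated) negation of one. $\sigma_\kappa(\mathrm{Str}_{\mathscr{L}}(X))$ is the smallest family of subsets of $\mathrm{Str}_{\mathscr{L}}(X)$ closed under complements and under unions of size $\le\kappa$ and containing all sets $\{\mathcal{M}:\mathcal{M}\models\varphi(\bar a)\}$ for $\varphi$ a literal and $\bar a$ a tuple from $X$. $\mathrm{Str}^\kappa_{\mathscr{L}}(X)$ is $\mathrm{Str}_{\mathscr{L}}(X)$ with this family of measurable sets. A probability $\kappa$-measure on it is a probability measure $\mu$ with $\mu(\bigcup_{i\in\kappa}A_i)=\sum_{i\in\kappa}\mu(A_i)$ for pairwise disjoint measurable $A_i$. $\mathrm{Sym}(X)$ acts by $g\mathcal{M}\models R(g(a_0),\dots)$ iff $\mathcal{M}\models R(a_0,\dots)$; $\mu$ is invariant if $\mu(g[A])=\mu(A)$ for all $g\in\mathrm{Sym}(X)$ and measurable $A$.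 "Invariant measure" means invariant probability $\kappa$-measure. Codes: for a set $Z$, $\mathbb{B}^\kappa_{\mathscr{L}:Z}$ is the smallest set containing the basic codes $\langle 0,\varphi,\bar a\rangle$ ($\varphi$ a finite conjunction of $\mathscr{L}$-literals, $\bar a$ a tuple from $Z$) and closed under formal negation $\neg\gamma$ and formal $\bigvee\Gamma$, $\bigwedge\Gamma$ for $\Gamma=\{\gamma_i\}_{i\in\kappa}$. If $Z\subseteq X$ then a code over $Z$ is also a code over $X$, interpreted (in a given model) as a subset of $\mathrm{Str}_{\mathscr{L}}(X)$: basic codes as $\{\mathcal{M}:\mathcal{M}\models\varphi(\bar a)\}$, and $\neg,\bigvee,\bigwedge$ as complement, union, intersection. $\mu(\gamma)$ is the $\mu$-measure of the interpretation of $\gamma$. $\mu$ is dissociated if for all disjoint finite $X_0,X_1\subseteq X$, all $\gamma_0\in\mathbb{B}^\kappa_{\mathscr{L}:X_0}$ and $\gamma_1\in\mathbb{B}^\kappa_{\mathscr{L}:X_1}$, $\mu(\gamma_0\wedge\gamma_1)=\mu(\gamma_0)\cdot\mu(\gamma_1)$. Relativization: $\mu^{V_1}$ denotes the relativization of $\mu$ to $V_1$, i.e. the unique probability $\kappa$-measure in $V_1$ on $[\mathrm{Str}^\kappa_{\mathscr{L}}(X)]^{V_1}$ with $\mu(\gamma)=\mu^{V_1}(\gamma)$ for all basic codes $\gamma\in V_0$. -}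

module Defs where

open import Level using (Level) renaming (suc to lsuc)
open import Data.Nat.Base using (ℕ) renaming (suc to 1+_)
open import Data.Fin.Base using (Fin)
open import Data.Vec.Base using (Vec; _∷_; lookup)
open import Data.Product.Base using (∃; ∃₂; _×_; _,_; proj₁; proj₂)
open import Data.Sum.Base using (_⊎_)
open import Data.Refinement.Base using (Refinement; value; refine)
open import Function.Bundles using (_⇔_)
open import Relation.Binary.Core using (Rel)
open import Relation.Binary.Structures using (IsTotalOrder)
open import Relation.Binary.PropositionalEquality.Core using (_≡_; _≢_)
open import Relation.Nullary.Negation.Core using (¬_)
open import Relation.Unary using (Pred; _⊆_)
open import Algebra.Bundles.Raw using (RawRing)
open import Algebra.Structures using (IsCommutativeRing)
open import Algebra.Morphism.Structures using (IsRingMonomorphism)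

------------------------------------------------------------------------
-- ZFC and transitive models

record SetStructure (ℓ : Level) : Set (lsuc ℓ) where
  infix 4 _∈_
  field
    Carrier : Set ℓ
    _∈_     : Rel Carrier ℓ

-- First-order formulas of set theory with de Bruijn variables.
data Formula : ℕ → Set where
  _∈̇_ _≡̇_       : ∀ {n} → Fin n → Fin n → Formula n
  ¬̇_            : ∀ {n} → Formula n → Formula n
  _∧̇_ _∨̇_ _⇒̇_   : ∀ {n} → Formula n → Formula n → Formula n
  ∀̇_ ∃̇_         : ∀ {n} → Formula (1+ n) → Formula n

module _ {ℓ : Level} (𝕊 : SetStructure ℓ) where
  open SetStructure 𝕊

  Satisfies : ∀ {n} → Vec Carrier n → Formula n → Set ℓ
  Satisfies ρ (i ∈̇ j) = lookup ρ i ∈ lookup ρ j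
  Satisfies ρ (i ≡̇ j) = lookup ρ i ≡ lookup ρ j
  Satisfies ρ (¬̇ φ)   = ¬ Satisfies ρ φ
  Satisfies ρ (φ ∧̇ ψ) = Satisfies ρ φ × Satisfies ρ ψ
  Satisfies ρ (φ ∨̇ ψ) = Satisfies ρ φ ⊎ Satisfies ρ ψ
  Satisfies ρ (φ ⇒̇ ψ) = Satisfies ρ φ → Satisfies ρ ψ
  Satisfies ρ (∀̇ φ)   = ∀ x → Satisfies (x ∷ ρ) φ
  Satisfies ρ (∃̇ φ)   = ∃ λ x → Satisfies (x ∷ ρ) φ

  -- `a isSetOf P` says that a = { x | P x }.
  infix 3 _isSetOf_
  _isSetOf_ : Carrier → Pred Carrier ℓ → Set ℓ
  a isSetOf P = ∀ x → x ∈ a ⇔ P x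

  record IsZFC : Set ℓ where
    field
      extensionality : ∀ x y → (∀ z → z ∈ x ⇔ z ∈ y) → x ≡ y
      foundation     : ∀ x → (∃ λ y → y ∈ x) →
                       ∃ λ y → y ∈ x × (∀ z → z ∈ x → ¬ z ∈ y)
      pairing        : ∀ x y → ∃ λ p → p isSetOf λ z → z ≡ x ⊎ z ≡ y
      union          : ∀ x → ∃ λ u → u isSetOf λ z → ∃ λ y → y ∈ x × z ∈ y
      powerset       : ∀ x → ∃ λ p → p isSetOf λ y → ∀ z → z ∈ y → z ∈ x
      infinity       : ∃ λ w → (∃ λ e → e ∈ w × (∀ z → ¬ z ∈ e)) ×
                       (∀ x → x ∈ w → ∃ λ s → s ∈ w × (s isSetOf λ z → z ∈ x ⊎ z ≡ x))
      separation     : ∀ {n} (φ : Formula (1+ n)) (ρ : Vec Carrier n) a →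
                       ∃ λ b → b isSetOf λ x → x ∈ a × Satisfies (x ∷ ρ) φ
      replacement    : ∀ {n} (φ : Formula (1+ 1+ n)) (ρ : Vec Carrier n) a →
                       (∀ x y y′ → x ∈ a → Satisfies (x ∷ y ∷ ρ) φ →
                                           Satisfies (x ∷ y′ ∷ ρ) φ → y ≡ y′) →
                       ∃ λ b → b isSetOf λ y → ∃ λ x → x ∈ a × Satisfies (x ∷ y ∷ ρ) φ
      choice         : ∀ a → (∀ x → x ∈ a → ∃ λ z → z ∈ x) →
                       (∀ x y z → x ∈ a → y ∈ a → z ∈ x → z ∈ y → x ≡ y) →
                       ∃ λ c → ∀ x → x ∈ a →
                       ∃ λ z → (z ∈ x × z ∈ c) × (∀ w → w ∈ x → w ∈ c → w ≡ z)

record ZFCModel (ℓ : Level) : Set (lsuc ℓ) where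
  field
    structure : SetStructure ℓ
    isZFC     : IsZFC structure
  open SetStructure structure public
  open IsZFC isZFC public

_↾_ : ∀ {ℓ} (𝕊 : SetStructure ℓ) → Pred (SetStructure.Carrier 𝕊) ℓ → SetStructure ℓ
𝕊 ↾ C = record
  { Carrier = Refinement (SetStructure.Carrier 𝕊) C
  ; _∈_     = λ x y → SetStructure._∈_ 𝕊 (value x) (value y)
  }

record TransitiveModel {ℓ} (𝒱 : ZFCModel ℓ) : Set (lsuc ℓ) where
  open ZFCModel 𝒱 using (Carrier; _∈_; structure)
  field
    Class      : Pred Carrier ℓ
    transitive : ∀ {x y} → Class y → x ∈ y → Class x
    isZFC      : IsZFC (structure ↾ Class)

  model : ZFCModel ℓ
  model = record { structure = structure ↾ Class ; isZFC = isZFC }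

------------------------------------------------------------------------
-- Mathematics inside a model.  All quantifiers over sets range over the
-- carrier of the model M, so each notion is automatically relativized.

module InModel {ℓ : Level} (M : ZFCModel ℓ) where
  open ZFCModel M

  infix 3 _≐_
  _≐_ : Carrier → Pred Carrier ℓ → Set ℓ
  _≐_ = _isSetOf_ structure

  ∅ : Carrier
  ∅ = proj₁ (proj₁ (proj₂ infinity))

  ｛_,_｝ : Carrier → Carrier → Carrier
  ｛ x , y ｝ = proj₁ (pairing x y)

  ⟪_,_⟫ : Carrier → Carrier → Carrier
  ⟪ x , y ⟫ = ｛ ｛ x , x ｝ , ｛ x , y ｝ ｝

  -- x ∪ {x}
  S : Carrier → Carrier
  S x = proj₁ (union ｛ x , ｛ x , x ｝ ｝)

  IsNat : Pred Carrier ℓ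
  IsNat n = ∀ w → ∅ ∈ w → (∀ x → x ∈ w → S x ∈ w) → n ∈ w

  IsEven : Pred Carrier ℓ
  IsEven n = ∀ w → ∅ ∈ w → (∀ x → x ∈ w → S (S x) ∈ w) → n ∈ w

  -- The set f is (the graph of) a function with domain {x | P x} and all
  -- values satisfying Q.
  infix 3 _∶_⟶_
  _∶_⟶_ : Carrier → Pred Carrier ℓ → Pred Carrier ℓ → Set ℓ
  f ∶ P ⟶ Q =
    (∀ p → p ∈ f → ∃₂ λ x y → (P x × Q y) × p ≡ ⟪ x , y ⟫) ×
    (∀ x → P x → ∃ λ y → ⟪ x , y ⟫ ∈ f × (∀ y′ → ⟪ x , y′ ⟫ ∈ f → y′ ≡ y))

  IsInjective : Pred Carrier ℓ
  IsInjective f = ∀ x x′ y → ⟪ x , y ⟫ ∈ f → ⟪ x′ , y ⟫ ∈ f → x ≡ x′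

  IsBijection : Carrier → Carrier → Carrier → Set ℓ
  IsBijection f a b =
    (f ∶ (_∈ a) ⟶ (_∈ b)) × IsInjective f × (∀ y → y ∈ b → ∃ λ x → ⟪ x , y ⟫ ∈ f)

  -- h = g ∘ f
  IsComposite : (h g f : Carrier) → Set ℓ
  IsComposite h g f =
    h ≐ λ p → ∃ λ x → ∃₂ λ y z → ⟪ x , y ⟫ ∈ f × ⟪ y , z ⟫ ∈ g × p ≡ ⟪ x , z ⟫

  IsFinite : Pred Carrier ℓ
  IsFinite a = ∃₂ λ n f → IsNat n × IsBijection f n a

  IsInfinite : Pred Carrier ℓ
  IsInfinite a = ¬ IsFinite a

  _Embeds_ : Carrier → Carrier → Set ℓ
  a Embeds b = ∃ λ f → (f ∶ (_∈ a) ⟶ (_∈ b)) × IsInjective f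

  IsTransitive : Pred Carrier ℓ
  IsTransitive a = ∀ x y → x ∈ y → y ∈ a → x ∈ a

  -- By foundation, a transitive set of transitive sets is an ordinal.
  IsOrdinal : Pred Carrier ℓ
  IsOrdinal a = IsTransitive a × (∀ x → x ∈ a → IsTransitive x)

  ----------------------------------------------------------------------
  -- The real numbers of M: a complete ordered field that is an element
  -- of M, complete with respect to the subsets in M.

  record Reals : Set (lsuc ℓ) where
    field
      ℝ : Carrier

    El : Set ℓ
    El = Refinement Carrier (_∈ ℝ)

    ⌜_⌝ : El → Carrier
    ⌜_⌝ = value

    infix  4 _≤_
    infixl 6 _+_
    infixl 7 _*_
    field
      _+_ _*_ : El → El → El
      -_      : El → El
      0# 1#   : El
      _≤_     : Rel El ℓ

      -- The operations and the order are themselves sets of M.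
      +-internal : ∃ λ f → f ≐ λ p → ∃₂ λ x y → p ≡ ⟪ ⟪ ⌜ x ⌝ , ⌜ y ⌝ ⟫ , ⌜ x + y ⌝ ⟫
      *-internal : ∃ λ f → f ≐ λ p → ∃₂ λ x y → p ≡ ⟪ ⟪ ⌜ x ⌝ , ⌜ y ⌝ ⟫ , ⌜ x * y ⌝ ⟫
      ≤-internal : ∃ λ f → f ≐ λ p → ∃₂ λ x y → x ≤ y × p ≡ ⟪ ⌜ x ⌝ , ⌜ y ⌝ ⟫

      isCommutativeRing : IsCommutativeRing _≡_ _+_ _*_ -_ 0# 1#
      0≢1               : 0# ≢ 1#
      inverse           : ∀ x → x ≢ 0# → ∃ λ y → x * y ≡ 1#
      isTotalOrder      : IsTotalOrder _≡_ _≤_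
      +-monoˡ-≤         : ∀ x y z → x ≤ y → x + z ≤ y + z
      *-nonneg          : ∀ x y → 0# ≤ x → 0# ≤ y → 0# ≤ x * y

    rawRing : RawRing ℓ ℓ
    rawRing = record
      { Carrier = El ; _≈_ = _≡_ ; _+_ = _+_ ; _*_ = _*_ ; -_ = -_ ; 0# = 0# ; 1# = 1# }

    IsUpperBound : Pred El ℓ → Pred El ℓ
    IsUpperBound P u = ∀ x → P x → x ≤ u

    IsSupremum : Pred El ℓ → Pred El ℓ
    IsSupremum P s = IsUpperBound P s × (∀ u → IsUpperBound P u → s ≤ u)

    field
      complete : ∀ a → (∃ λ x → ⌜ x ⌝ ∈ a) →
                 ∃ (IsUpperBound λ x → ⌜ x ⌝ ∈ a) →
                 ∃ (IsSupremum λ x → ⌜ x ⌝ ∈ a)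

  ----------------------------------------------------------------------
  -- Relational languages and structures

  -- A relational language is a set of symbols with arities, given as the
  -- arity function: ⟪ R , n ⟫ ∈ 𝓛 says that R is an n-ary symbol of 𝓛.
  IsRelationalLanguage : Pred Carrier ℓ
  IsRelationalLanguage 𝓛 = ∃ λ D → 𝓛 ∶ (_∈ D) ⟶ IsNat

  module Structures (κ X 𝓛 : Carrier) where

    -- A structure with underlying set X is the set of its true facts
    -- ⟪ R , t ⟫, with t ∈ Xⁿ (a function n → X) for n the arity of R.
    IsStructure : Pred Carrier ℓ
    IsStructure N = ∀ p → p ∈ N → ∃₂ λ R n → ∃ λ t →
      ⟪ R , n ⟫ ∈ 𝓛 × (t ∶ (_∈ n) ⟶ (_∈ X)) × p ≡ ⟪ R , t ⟫

    IsSetOfStructures : Pred Carrier ℓ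
    IsSetOfStructures A = ∀ N → N ∈ A → IsStructure N

    -- Atomic formulas in the variables x₀, …, xₘ₋₁:
    -- ⟪ 0 , ⟪ i , j ⟫ ⟫ is xᵢ = xⱼ, and ⟪ 1 , ⟪ R , s ⟫ ⟫ is R(x_{s(0)}, x_{s(1)}, …).
    IsAtomic : Carrier → Pred Carrier ℓ
    IsAtomic m α =
      (∃₂ λ i j → i ∈ m × j ∈ m × α ≡ ⟪ ∅ , ⟪ i , j ⟫ ⟫) ⊎
      (∃₂ λ R n → ∃ λ s → ⟪ R , n ⟫ ∈ 𝓛 × (s ∶ (_∈ n) ⟶ (_∈ m)) × α ≡ ⟪ S ∅ , ⟪ R , s ⟫ ⟫)

    -- ⟪ k , α ⟫ is the k-fold negation of the atomic formula α.
    IsLiteral : Carrier → Pred Carrier ℓ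
    IsLiteral m l = ∃₂ λ k α → IsNat k × IsAtomic m α × l ≡ ⟪ k , α ⟫

    IsConjunction : Carrier → Pred Carrier ℓ
    IsConjunction m φ = ∃ λ n → IsNat n × (φ ∶ (_∈ n) ⟶ IsLiteral m)

    -- Below, a is the tuple assigned to the variables.
    AtomicHolds : (N a α : Carrier) → Set ℓ
    AtomicHolds N a α =
      (∃₂ λ i j → ∃ λ x → ⟪ i , x ⟫ ∈ a × ⟪ j , x ⟫ ∈ a × α ≡ ⟪ ∅ , ⟪ i , j ⟫ ⟫) ⊎
      (∃₂ λ R s → ∃ λ t → IsComposite t a s × ⟪ R , t ⟫ ∈ N × α ≡ ⟪ S ∅ , ⟪ R , s ⟫ ⟫)

    LiteralHolds : (N a l : Carrier) → Set ℓ
    LiteralHolds N a l = ∃₂ λ k α → l ≡ ⟪ k , α ⟫ ×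
      ((IsEven k × AtomicHolds N a α) ⊎ (¬ IsEven k × ¬ AtomicHolds N a α))

    ConjunctionHolds : (N a φ : Carrier) → Set ℓ
    ConjunctionHolds N a φ = ∀ i l → ⟪ i , l ⟫ ∈ φ → LiteralHolds N a l

    --------------------------------------------------------------------
    -- Measurable sets: the family σ_κ(Str)

    record IsκAlgebra (𝓢 : Carrier) : Set ℓ where
      field
        subsets    : ∀ A → A ∈ 𝓢 → IsSetOfStructures A
        literals   : ∀ m l a A → IsNat m → IsLiteral m l → (a ∶ (_∈ m) ⟶ (_∈ X)) →
                     (A ≐ λ N → IsStructure N × LiteralHolds N a l) → A ∈ 𝓢
        complement : ∀ A B → A ∈ 𝓢 → (B ≐ λ N → IsStructure N × ¬ N ∈ A) → B ∈ 𝓢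
        unions     : ∀ 𝒜 U → (∀ A → A ∈ 𝒜 → A ∈ 𝓢) → 𝒜 Embeds κ →
                     (U ≐ λ N → ∃ λ A → A ∈ 𝒜 × N ∈ A) → U ∈ 𝓢

    IsMeasurable : Pred Carrier ℓ
    IsMeasurable A = ∀ 𝓢 → IsκAlgebra 𝓢 → A ∈ 𝓢

    --------------------------------------------------------------------
    -- Codes and their interpretation

    basic : Carrier → Carrier → Carrier
    basic φ a = ⟪ ∅ , ⟪ φ , a ⟫ ⟫

    neg ⋁ ⋀ : Carrier → Carrier
    neg γ = ⟪ S ∅ , γ ⟫
    ⋁ Γ   = ⟪ S (S ∅) , Γ ⟫
    ⋀ Γ   = ⟪ S (S (S ∅)) , Γ ⟫

    IsBasicCode : Carrier → Pred Carrier ℓ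
    IsBasicCode Z γ = ∃ λ m → ∃₂ λ φ a →
      IsNat m × IsConjunction m φ × (a ∶ (_∈ m) ⟶ (_∈ Z)) × γ ≡ basic φ a

    record IsClosedUnderCodes (Z B : Carrier) : Set ℓ where
      field
        basics     : ∀ γ → IsBasicCode Z γ → γ ∈ B
        negations  : ∀ γ → γ ∈ B → neg γ ∈ B
        joins      : ∀ Γ → (Γ ∶ (_∈ κ) ⟶ (_∈ B)) → ⋁ Γ ∈ B
        meets      : ∀ Γ → (Γ ∶ (_∈ κ) ⟶ (_∈ B)) → ⋀ Γ ∈ B

    -- Membership in 𝔹 over Z.
    IsCode : Carrier → Pred Carrier ℓ
    IsCode Z γ = ∀ B → IsClosedUnderCodes Z B → γ ∈ B

    -- The interpretation of codes over X is defined by recursion on codes;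
    -- its graph is the least relation E with the following closure properties.
    record IsClosedUnderInterpretation (E : Carrier) : Set ℓ where
      field
        basics     : ∀ m φ a A → IsNat m → IsConjunction m φ → (a ∶ (_∈ m) ⟶ (_∈ X)) →
                     (A ≐ λ N → IsStructure N × ConjunctionHolds N a φ) →
                     ⟪ basic φ a , A ⟫ ∈ E
        negations  : ∀ γ A B → ⟪ γ , A ⟫ ∈ E →
                     (B ≐ λ N → IsStructure N × ¬ N ∈ A) → ⟪ neg γ , B ⟫ ∈ E
        joins      : ∀ Γ 𝒜 U → (Γ ∶ (_∈ κ) ⟶ IsCode X) → (𝒜 ∶ (_∈ κ) ⟶ IsSetOfStructures) →
                     (∀ i γ A → ⟪ i , γ ⟫ ∈ Γ → ⟪ i , A ⟫ ∈ 𝒜 → ⟪ γ , A ⟫ ∈ E) →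
                     (U ≐ λ N → ∃₂ λ i A → ⟪ i , A ⟫ ∈ 𝒜 × N ∈ A) → ⟪ ⋁ Γ , U ⟫ ∈ E
        meets      : ∀ Γ 𝒜 U → (Γ ∶ (_∈ κ) ⟶ IsCode X) → (𝒜 ∶ (_∈ κ) ⟶ IsSetOfStructures) →
                     (∀ i γ A → ⟪ i , γ ⟫ ∈ Γ → ⟪ i , A ⟫ ∈ 𝒜 → ⟪ γ , A ⟫ ∈ E) →
                     (U ≐ λ N → IsStructure N × (∀ i A → ⟪ i , A ⟫ ∈ 𝒜 → N ∈ A)) →
                     ⟪ ⋀ Γ , U ⟫ ∈ E

    _InterpretedAs_ : Carrier → Carrier → Set ℓ
    γ InterpretedAs A = ∀ E → IsClosedUnderInterpretation E → ⟪ γ , A ⟫ ∈ E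

    --------------------------------------------------------------------
    -- Measures

    module Measures (𝓡 : Reals) where
      open Reals 𝓡

      -- s = f(e₀) + … + f(eₙ₋₁) for some distinct e₀, …, eₙ₋₁ ∈ I;
      -- the function p on n+1 lists the partial sums.
      IsFinitePartialSum : (I f : Carrier) → Pred El ℓ
      IsFinitePartialSum I f s = ∃ λ n → ∃₂ λ e p →
        IsNat n × (e ∶ (_∈ n) ⟶ (_∈ I)) × IsInjective e ×
        (p ∶ (_∈ S n) ⟶ (_∈ ℝ)) × ⟪ ∅ , ⌜ 0# ⌝ ⟫ ∈ p ×
        (∀ k i x y → k ∈ n → ⟪ k , i ⟫ ∈ e → ⟪ i , ⌜ x ⌝ ⟫ ∈ f →
                     ⟪ k , ⌜ y ⌝ ⟫ ∈ p → ⟪ S k , ⌜ y + x ⌝ ⟫ ∈ p) ×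
        ⟪ n , ⌜ s ⌝ ⟫ ∈ p

      -- r = Σ_{i ∈ I} f(i), for non-negative f
      IsSum : (I f : Carrier) → Pred El ℓ
      IsSum I f = IsSupremum (IsFinitePartialSum I f)

      IsAdditive : (I μ : Carrier) → Set ℓ
      IsAdditive I μ = ∀ 𝒜 f U r →
        (𝒜 ∶ (_∈ I) ⟶ IsMeasurable) →
        (∀ i j A B N → ⟪ i , A ⟫ ∈ 𝒜 → ⟪ j , B ⟫ ∈ 𝒜 → i ≢ j → N ∈ A → ¬ N ∈ B) →
        IsComposite f μ 𝒜 →
        (U ≐ λ N → ∃₂ λ i A → ⟪ i , A ⟫ ∈ 𝒜 × N ∈ A) →
        ⟪ U , ⌜ r ⌝ ⟫ ∈ μ → IsSum I f r

      record IsProbabilityκMeasure (μ : Carrier) : Set ℓ where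
        field
          isFunction        : μ ∶ IsMeasurable ⟶ (_∈ ℝ)
          nonneg            : ∀ A r → ⟪ A , ⌜ r ⌝ ⟫ ∈ μ → 0# ≤ r
          empty             : ⟪ ∅ , ⌜ 0# ⌝ ⟫ ∈ μ
          total             : ∀ A → A ≐ IsStructure → ⟪ A , ⌜ 1# ⌝ ⟫ ∈ μ
          countablyAdditive : ∀ ω → ω ≐ IsNat → IsAdditive ω μ
          κ-additive        : IsAdditive κ μ

      -- N′ = gN
      Acts : (g N N′ : Carrier) → Set ℓ
      Acts g N N′ = IsStructure N′ × (∀ R n t t′ →
        ⟪ R , n ⟫ ∈ 𝓛 → (t ∶ (_∈ n) ⟶ (_∈ X)) → IsComposite t′ g t →
        ⟪ R , t′ ⟫ ∈ N′ ⇔ ⟪ R , t ⟫ ∈ N)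

      IsInvariant : Pred Carrier ℓ
      IsInvariant μ = ∀ g A B r → IsBijection g X X → IsMeasurable A →
        (B ≐ λ N′ → ∃ λ N → N ∈ A × Acts g N N′) →
        ⟪ A , ⌜ r ⌝ ⟫ ∈ μ → ⟪ B , ⌜ r ⌝ ⟫ ∈ μ

      IsInvariantMeasure : Pred Carrier ℓ
      IsInvariantMeasure μ = IsProbabilityκMeasure μ × IsInvariant μ

      -- μ(γ) = r
      HasMeasure : (μ γ : Carrier) → Pred El ℓ
      HasMeasure μ γ r = ∃ λ A → γ InterpretedAs A × ⟪ A , ⌜ r ⌝ ⟫ ∈ μ

      -- B is the interpretation A₀ ∩ A₁ of γ₀ ∧ γ₁.
      IsDissociated : Pred Carrier ℓ
      IsDissociated μ = ∀ X₀ X₁ →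
        IsFinite X₀ → IsFinite X₁ →
        (∀ x → x ∈ X₀ → x ∈ X) → (∀ x → x ∈ X₁ → x ∈ X) → (∀ x → x ∈ X₀ → ¬ x ∈ X₁) →
        ∀ γ₀ γ₁ → IsCode X₀ γ₀ → IsCode X₁ γ₁ →
        ∀ A₀ A₁ B r₀ r₁ → γ₀ InterpretedAs A₀ → γ₁ InterpretedAs A₁ →
        (B ≐ λ N → N ∈ A₀ × N ∈ A₁) →
        ⟪ A₀ , ⌜ r₀ ⌝ ⟫ ∈ μ → ⟪ A₁ , ⌜ r₁ ⌝ ⟫ ∈ μ → ⟪ B , ⌜ r₀ * r₁ ⌝ ⟫ ∈ μ

open InModel public using (IsOrdinal; IsInfinite; IsRelationalLanguage; Reals)
open InModel.Structures.Measures public using (IsInvariantMeasure; IsDissociated)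

------------------------------------------------------------------------
-- Comparing two models

module _ {ℓ : Level} {𝒱 : ZFCModel ℓ} where

  ⌊_⌋ : TransitiveModel 𝒱 → ZFCModel ℓ
  ⌊ V ⌋ = TransitiveModel.model V

  ∣_∣ : TransitiveModel 𝒱 → Set ℓ
  ∣ V ∣ = ZFCModel.Carrier ⌊ V ⌋

  infix 4 _⊑_
  record _⊑_ (V₀ V₁ : TransitiveModel 𝒱) : Set ℓ where
    field
      inclusion : TransitiveModel.Class V₀ ⊆ TransitiveModel.Class V₁

  incl : {V₀ V₁ : TransitiveModel 𝒱} → V₀ ⊑ V₁ → ∣ V₀ ∣ → ∣ V₁ ∣
  incl V₀⊑V₁ = refine (_⊑_.inclusion V₀⊑V₁)

  module _ {V₀ V₁ : TransitiveModel 𝒱} (V₀⊑V₁ : V₀ ⊑ V₁) where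
    private
      module M₀ = InModel ⌊ V₀ ⌋
      module M₁ = InModel ⌊ V₁ ⌋

      ι : ∣ V₀ ∣ → ∣ V₁ ∣
      ι = incl V₀⊑V₁

    -- The (unique) ordered field embedding of the reals of V₀ into those of
    -- V₁, through which a real number of V₀ is regarded as one of V₁.
    record RealEmbedding (ℝ₀ : Reals ⌊ V₀ ⌋) (ℝ₁ : Reals ⌊ V₁ ⌋) : Set ℓ where
      private
        module ℝ₀ = M₀.Reals ℝ₀
        module ℝ₁ = M₁.Reals ℝ₁
      field
        embed          : ℝ₀.El → ℝ₁.El
        embed-internal : ∃ λ f → f M₁.≐ λ p → ∃ λ x → p ≡ M₁.⟪ ι ℝ₀.⌜ x ⌝ , ℝ₁.⌜ embed x ⌝ ⟫
        isMonomorphism : IsRingMonomorphism ℝ₀.rawRing ℝ₁.rawRing embed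
        mono-≤         : ∀ x y → x ℝ₀.≤ y → embed x ℝ₁.≤ embed y

    -- ν = μ^{V₁}
    record IsRelativization (κ X 𝓛 : ∣ V₀ ∣)
                            {ℝ₀ : Reals ⌊ V₀ ⌋} {ℝ₁ : Reals ⌊ V₁ ⌋}
                            (j : RealEmbedding ℝ₀ ℝ₁)
                            (μ : ∣ V₀ ∣) (ν : ∣ V₁ ∣) : Set ℓ where
      open RealEmbedding j
      private
        module Str₀ = M₀.Structures κ X 𝓛
        module Str₁ = M₁.Structures (ι κ) (ι X) (ι 𝓛)
        module μ₀ = Str₀.Measures ℝ₀
        module μ₁ = Str₁.Measures ℝ₁
      field
        isProbabilityκMeasure : μ₁.IsProbabilityκMeasure ν
        agrees : ∀ γ r → Str₀.IsBasicCode X γ →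
                 μ₀.HasMeasure μ γ r → μ₁.HasMeasure ν (ι γ) (embed r)

{-# OPTIONS --safe #-}

-- Dissociation need only be tested on the cylinders {N : P ⊆ N}, for P a finite set of facts
-- over X₀, respectively over X₁.  Indeed the measurable sets independent of a given one form
-- a λ-system, cylinders are closed under intersection, and by Dynkin's argument the λ-system
-- generated by the cylinders over Xᵢ is closed under κ-unions (made disjoint by induction
-- along κ), hence contains the interpretations of all codes over Xᵢ.  Cylinders are the
-- interpretations of basic codes, and V₀ and V₁ have the same finite sets of facts over a set
-- of V₀; so μ and its relativization agree on cylinders, and since the embedding of the reals
-- is injective and multiplicative, independence of cylinders passes from one model to the other.
--
-- Induction on codes inside a model requires a set closed under the formation of codes.  It
-- is the image, under a Mostowski collapse, of a set of names closed under κ-sequences.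

module Submission where

open import Defs
open import Algebra.Bundles using (CommutativeRing)
open import Algebra.Morphism.Structures using (IsRingMonomorphism)
import Algebra.Properties.Ring
open import Axiom.ExcludedMiddle using (ExcludedMiddle)
open import Data.Empty using (⊥; ⊥-elim; ⊥-elim-irr)
open import Data.Fin.Base using (Fin; zero; suc; _↑ˡ_; _↑ʳ_)
open import Data.Irrelevant using ([_])
open import Data.Nat.Base using (ℕ) renaming (suc to 1+_; _+_ to _+ℕ_)
open import Data.Product.Base using (∃; ∃₂; _×_; _,_; proj₁; proj₂)
open import Data.Product.Function.NonDependent.Propositional using (_×-⇔_)
open import Data.Refinement.Base using (value)
import Data.Refinement.Base as Refinement
open import Data.Sum.Base using (_⊎_; inj₁; inj₂; [_,_]′)
open import Data.Sum.Function.Propositional using (_⊎-⇔_)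
open import Data.Vec.Base using (Vec; []; _∷_; lookup; _++_)
open import Data.Vec.Properties using (lookup-++ˡ; lookup-++ʳ)
open import Function.Base using (_∘_; id)
open import Function.Bundles using (_⇔_; mk⇔; module Equivalence)
open import Function.Related.TypeIsomorphisms using (→-cong-⇔; ¬-cong-⇔)
open import Level using (Level)
open import Relation.Binary.PropositionalEquality using (_≡_; _≢_; refl; sym; trans; cong; cong₂; subst; subst₂)
open import Relation.Binary.Structures using (IsTotalOrder)
open import Relation.Nullary.Decidable.Core using (yes; no)
open import Relation.Nullary.Negation.Core using (¬_)
open import Relation.Unary using (Pred)

open Equivalence using (to; from)

-- Codes cannot be compared across the models directly. The larger model may have new κ-sequences,
-- hence codes over a finite set that the smaller one lacks, and `κ` may change its cardinality. So
-- each model runs the closure argument for itself, knowing of `κ` only that it is an infinite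
-- ordinal there; what is compared is finite.
--
-- Codes and interpretations are given as intersections of all sets with certain closure properties,
-- and such a definition yields nothing until one closed set is known to exist. Iterating power sets
-- up to a regular cardinal would call for ordinal recursion and cofinalities. Names avoid both:
-- once `L ⊗ Y` embeds in `Y`, a family of subsets of `Y` indexed by `L` is coded by a single subset
-- of `Y`, so `𝒫 Y` is closed at the first stage.
--
-- Separation and replacement are available for formulas only. Every induction inside a model
-- therefore states its claim as a formula, and the real operations enter these formulas through
-- their graphs.

module _ {a} {A : Set a} where

  Π-⇔ : ∀ {b c} {B : A → Set b} {C : A → Set c} → (∀ x → B x ⇔ C x) → (∀ x → B x) ⇔ (∀ x → C x)
  Π-⇔ e = mk⇔ (λ f x → to (e x) (f x)) (λ f x → from (e x) (f x))

  ∃-⇔ : ∀ {b c} {B : A → Set b} {C : A → Set c} → (∀ x → B x ⇔ C x) → ∃ B ⇔ ∃ C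
  ∃-⇔ e = mk⇔ (λ (x , b) → x , to (e x) b) (λ (x , c) → x , from (e x) c)

  ≡-⇔ : ∀ {x x′ y y′ : A} → x ≡ x′ → y ≡ y′ → (x ≡ y) ⇔ (x′ ≡ y′)
  ≡-⇔ refl refl = mk⇔ (λ e → e) (λ e → e)

-- Separation and replacement for formulas with parameters

module Definability {ℓ} (M : ZFCModel ℓ) where
  open ZFCModel M
  open InModel M

  infix 7 _∈ᶠ_ _≡ᶠ_
  infixr 6 _∧ᶠ_
  infixr 5 _∨ᶠ_
  infixr 4 _⇒ᶠ_ _⇔ᶠ_

  -- Formulas with parameters and with terms for ordered pairs and successors.  ⟦ φ ⟧ unfolds
  -- to the proposition that φ expresses, so a formula passed to sep or replace is matched
  -- with the intended proposition by computation.
  data Term (n : ℕ) : Set ℓ where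
    var     : Fin n → Term n
    con     : Carrier → Term n
    ⟪_,_⟫ᵗ  : Term n → Term n → Term n
    Sᵗ      : Term n → Term n

  data Form (n : ℕ) : Set ℓ where
    _∈ᶠ_ _≡ᶠ_      : Term n → Term n → Form n
    ¬ᶠ_            : Form n → Form n
    _∧ᶠ_ _∨ᶠ_ _⇒ᶠ_ _⇔ᶠ_ : Form n → Form n → Form n
    ∀ᶠ_ ∃ᶠ_        : Form (1+ n) → Form n

  ⟦_⟧ᵗ : ∀ {n} → Term n → Vec Carrier n → Carrier
  ⟦ var i ⟧ᵗ ρ       = lookup ρ i
  ⟦ con c ⟧ᵗ ρ       = c
  ⟦ ⟪ t , u ⟫ᵗ ⟧ᵗ ρ  = ⟪ ⟦ t ⟧ᵗ ρ , ⟦ u ⟧ᵗ ρ ⟫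
  ⟦ Sᵗ t ⟧ᵗ ρ        = S (⟦ t ⟧ᵗ ρ)

  ⟦_⟧ : ∀ {n} → Form n → Vec Carrier n → Set ℓ
  ⟦ t ∈ᶠ u ⟧ ρ = ⟦ t ⟧ᵗ ρ ∈ ⟦ u ⟧ᵗ ρ
  ⟦ t ≡ᶠ u ⟧ ρ = ⟦ t ⟧ᵗ ρ ≡ ⟦ u ⟧ᵗ ρ
  ⟦ ¬ᶠ φ ⟧ ρ   = ¬ ⟦ φ ⟧ ρ
  ⟦ φ ∧ᶠ ψ ⟧ ρ = ⟦ φ ⟧ ρ × ⟦ ψ ⟧ ρ
  ⟦ φ ∨ᶠ ψ ⟧ ρ = ⟦ φ ⟧ ρ ⊎ ⟦ ψ ⟧ ρ
  ⟦ φ ⇒ᶠ ψ ⟧ ρ = ⟦ φ ⟧ ρ → ⟦ ψ ⟧ ρ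
  ⟦ φ ⇔ᶠ ψ ⟧ ρ = ⟦ φ ⟧ ρ ⇔ ⟦ ψ ⟧ ρ
  ⟦ ∀ᶠ φ ⟧ ρ   = ∀ x → ⟦ φ ⟧ (x ∷ ρ)
  ⟦ ∃ᶠ φ ⟧ ρ   = ∃ λ x → ⟦ φ ⟧ (x ∷ ρ)

  wk : ∀ {n} → Term n → Term (1+ n)
  wk (var i)      = var (suc i)
  wk (con c)      = con c
  wk ⟪ t , u ⟫ᵗ   = ⟪ wk t , wk u ⟫ᵗ
  wk (Sᵗ t)       = Sᵗ (wk t)

  private
    sizeᵗ : ∀ {n} → Term n → ℕ
    sizeᵗ (var i)    = 0
    sizeᵗ (con c)    = 1
    sizeᵗ ⟪ t , u ⟫ᵗ = sizeᵗ t +ℕ sizeᵗ u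
    sizeᵗ (Sᵗ t)     = sizeᵗ t

    paramsᵗ : ∀ {n} (t : Term n) → Vec Carrier (sizeᵗ t)
    paramsᵗ (var i)    = []
    paramsᵗ (con c)    = c ∷ []
    paramsᵗ ⟪ t , u ⟫ᵗ = paramsᵗ t ++ paramsᵗ u
    paramsᵗ (Sᵗ t)     = paramsᵗ t

    size : ∀ {n} → Form n → ℕ
    size (t ∈ᶠ u) = sizeᵗ t +ℕ sizeᵗ u
    size (t ≡ᶠ u) = sizeᵗ t +ℕ sizeᵗ u
    size (¬ᶠ φ)   = size φ
    size (φ ∧ᶠ ψ) = size φ +ℕ size ψ
    size (φ ∨ᶠ ψ) = size φ +ℕ size ψ
    size (φ ⇒ᶠ ψ) = size φ +ℕ size ψ
    size (φ ⇔ᶠ ψ) = size φ +ℕ size ψ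
    size (∀ᶠ φ)   = size φ
    size (∃ᶠ φ)   = size φ

    params : ∀ {n} (φ : Form n) → Vec Carrier (size φ)
    params (t ∈ᶠ u) = paramsᵗ t ++ paramsᵗ u
    params (t ≡ᶠ u) = paramsᵗ t ++ paramsᵗ u
    params (¬ᶠ φ)   = params φ
    params (φ ∧ᶠ ψ) = params φ ++ params ψ
    params (φ ∨ᶠ ψ) = params φ ++ params ψ
    params (φ ⇒ᶠ ψ) = params φ ++ params ψ
    params (φ ⇔ᶠ ψ) = params φ ++ params ψ
    params (∀ᶠ φ)   = params φ
    params (∃ᶠ φ)   = params φ

    Renaming : ℕ → ℕ → Set
    Renaming m n = Fin m → Fin n

    lift : ∀ {m n} → Renaming m n → Renaming (1+ m) (1+ n)
    lift v zero    = zero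
    lift v (suc i) = suc (v i)

    infix 4 _↔̇_
    _↔̇_ : ∀ {n} → Formula n → Formula n → Formula n
    φ ↔̇ ψ = (φ ⇒̇ ψ) ∧̇ (ψ ⇒̇ φ)

    isPair : ∀ {n} (y a b : Fin n) → Formula n
    isPair y a b = ∀̇ ((zero ∈̇ suc y) ↔̇ ((zero ≡̇ suc a) ∨̇ (zero ≡̇ suc b)))

    isOrderedPair : ∀ {n} (y a b : Fin n) → Formula n
    isOrderedPair y a b = ∃̇ (∃̇ (isPair (suc zero) (suc (suc a)) (suc (suc a)) ∧̇
      (isPair zero (suc (suc a)) (suc (suc b)) ∧̇ isPair (suc (suc y)) (suc zero) zero)))

    isSuccessor : ∀ {n} (y a : Fin n) → Formula n
    isSuccessor y a = ∀̇ ((zero ∈̇ suc y) ↔̇ ((zero ∈̇ suc a) ∨̇ (zero ≡̇ suc a)))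

    -- trᵗ t v c y says that y is the value of t.
    trᵗ : ∀ {m n} (t : Term m) → Renaming m n → Renaming (sizeᵗ t) n → Fin n → Formula n
    trᵗ (var i)    v c y = y ≡̇ v i
    trᵗ (con _)    v c y = y ≡̇ c zero
    trᵗ ⟪ t , u ⟫ᵗ v c y = ∃̇ (∃̇
      (trᵗ t (suc ∘ suc ∘ v) (λ i → suc (suc (c (i ↑ˡ _)))) (suc zero) ∧̇
      (trᵗ u (suc ∘ suc ∘ v) (λ i → suc (suc (c (sizeᵗ t ↑ʳ i)))) zero ∧̇
       isOrderedPair (suc (suc y)) (suc zero) zero)))
    trᵗ (Sᵗ t)     v c y = ∃̇ (trᵗ t (suc ∘ v) (suc ∘ c) zero ∧̇ isSuccessor (suc y) zero)

    atom : ∀ {m n} (t u : Term m) → Renaming m n → Renaming (sizeᵗ t +ℕ sizeᵗ u) n →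
           (∀ {k} → Fin k → Fin k → Formula k) → Formula n
    atom t u v c R = ∃̇ (∃̇
      (trᵗ t (suc ∘ suc ∘ v) (λ i → suc (suc (c (i ↑ˡ _)))) (suc zero) ∧̇
      (trᵗ u (suc ∘ suc ∘ v) (λ i → suc (suc (c (sizeᵗ t ↑ʳ i)))) zero ∧̇
       R (suc zero) zero)))

    -- The language of `Formula` has no constants, so the parameters collected by `params` become
    -- additional free variables. The renaming `v` places the variables of `φ` in the context, and
    -- `c` places its parameters; under a quantifier only `v` acquires a new variable.
    tr : ∀ {m n} (φ : Form m) → Renaming m n → Renaming (size φ) n → Formula n
    tr (t ∈ᶠ u) v c = atom t u v c _∈̇_
    tr (t ≡ᶠ u) v c = atom t u v c _≡̇_
    tr (¬ᶠ φ)   v c = ¬̇ (tr φ v c)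
    tr (φ ∧ᶠ ψ) v c = tr φ v (c ∘ (_↑ˡ _)) ∧̇ tr ψ v (c ∘ (size φ ↑ʳ_))
    tr (φ ∨ᶠ ψ) v c = tr φ v (c ∘ (_↑ˡ _)) ∨̇ tr ψ v (c ∘ (size φ ↑ʳ_))
    tr (φ ⇒ᶠ ψ) v c = tr φ v (c ∘ (_↑ˡ _)) ⇒̇ tr ψ v (c ∘ (size φ ↑ʳ_))
    tr (φ ⇔ᶠ ψ) v c = tr φ v (c ∘ (_↑ˡ _)) ↔̇ tr ψ v (c ∘ (size φ ↑ʳ_))
    tr (∀ᶠ φ)   v c = ∀̇ (tr φ (lift v) (suc ∘ c))
    tr (∃ᶠ φ)   v c = ∃̇ (tr φ (lift v) (suc ∘ c))

    infix 4 _⊨_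
    _⊨_ : ∀ {n} → Vec Carrier n → Formula n → Set ℓ
    _⊨_ = Satisfies structure

    _≗[_]_ : ∀ {m n} → Vec Carrier m → Renaming m n → Vec Carrier n → Set ℓ
    σ ≗[ v ] ρ = ∀ i → lookup ρ (v i) ≡ lookup σ i

    lift-≗ : ∀ {m n} {σ : Vec Carrier m} {v : Renaming m n} {ρ} x → σ ≗[ v ] ρ → (x ∷ σ) ≗[ lift v ] (x ∷ ρ)
    lift-≗ x h zero    = refl
    lift-≗ x h (suc i) = h i

    left-≗ : ∀ {k l n} (p : Vec Carrier k) (q : Vec Carrier l) (c : Renaming (k +ℕ l) n) ρ →
             (p ++ q) ≗[ c ] ρ → p ≗[ c ∘ (_↑ˡ l) ] ρ
    left-≗ p q c ρ h i = trans (h (i ↑ˡ _)) (lookup-++ˡ p q i)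

    right-≗ : ∀ {k l n} (p : Vec Carrier k) (q : Vec Carrier l) (c : Renaming (k +ℕ l) n) ρ →
              (p ++ q) ≗[ c ] ρ → q ≗[ c ∘ (k ↑ʳ_) ] ρ
    right-≗ p q c ρ h i = trans (h (_ ↑ʳ i)) (lookup-++ʳ p q i)

    ↔̇-⇔ : ∀ {a b} {A B : Set a} {C D : Set b} → A ⇔ C → B ⇔ D → ((A → B) × (B → A)) ⇔ (C ⇔ D)
    ↔̇-⇔ e f = mk⇔ (λ (g , h) → mk⇔ (to f ∘ g ∘ from e) (to e ∘ h ∘ from f))
                  (λ g → (from f ∘ to g ∘ to e) , (from e ∘ from g ∘ to f))

    isPair-ok : ∀ {n} (ρ : Vec Carrier n) y a b → (ρ ⊨ isPair y a b) ⇔ (lookup ρ y ≡ ｛ lookup ρ a , lookup ρ b ｝)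
    isPair-ok ρ y a b = mk⇔
      (λ h → extensionality _ _ λ z → mk⇔ (from (pair z) ∘ proj₁ (h z)) (proj₂ (h z) ∘ to (pair z)))
      (λ e z → (λ z∈ → to (pair z) (subst (z ∈_) e z∈)) , λ z≡ → subst (z ∈_) (sym e) (from (pair z) z≡))
      where pair = proj₂ (pairing (lookup ρ a) (lookup ρ b))

    isOrderedPair-ok : ∀ {n} (ρ : Vec Carrier n) y a b →
                       (ρ ⊨ isOrderedPair y a b) ⇔ (lookup ρ y ≡ ⟪ lookup ρ a , lookup ρ b ⟫)
    isOrderedPair-ok ρ y a b = mk⇔
      (λ (p , q , hp , hq , hy) → trans (to (isPair-ok (q ∷ p ∷ ρ) (suc (suc y)) (suc zero) zero) hy)
        (cong₂ ｛_,_｝ (to (isPair-ok (q ∷ p ∷ ρ) (suc zero) (suc (suc a)) (suc (suc a))) hp)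
                       (to (isPair-ok (q ∷ p ∷ ρ) zero (suc (suc a)) (suc (suc b))) hq)))
      (λ e → let ρ′ = ｛ lookup ρ a , lookup ρ b ｝ ∷ ｛ lookup ρ a , lookup ρ a ｝ ∷ ρ in
        _ , _ , from (isPair-ok ρ′ (suc zero) (suc (suc a)) (suc (suc a))) refl ,
                from (isPair-ok ρ′ zero (suc (suc a)) (suc (suc b))) refl ,
                from (isPair-ok ρ′ (suc (suc y)) (suc zero) zero) e)

  ∈-S : ∀ x z → z ∈ S x ⇔ (z ∈ x ⊎ z ≡ x)
  ∈-S x z = mk⇔
    (λ h → let (y , y∈ , z∈y) = to (proj₂ (union _) z) h in case₁ (to (proj₂ (pairing _ _) y) y∈) z∈y)
    (λ { (inj₁ z∈x) → from (proj₂ (union _) z) (x , from (proj₂ (pairing _ _) x) (inj₁ refl) , z∈x)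
       ; (inj₂ refl) → from (proj₂ (union _) z)
           (｛ x , x ｝ , from (proj₂ (pairing _ _) _) (inj₂ refl) , from (proj₂ (pairing _ _) _) (inj₁ refl)) })
    where
    case₁ : ∀ {y} → y ≡ x ⊎ y ≡ ｛ x , x ｝ → z ∈ y → z ∈ x ⊎ z ≡ x
    case₁ (inj₁ refl) z∈y = inj₁ z∈y
    case₁ (inj₂ refl) z∈y with to (proj₂ (pairing _ _) z) z∈y
    ... | inj₁ e = inj₂ e
    ... | inj₂ e = inj₂ e

  private
    isSuccessor-ok : ∀ {n} (ρ : Vec Carrier n) y a → (ρ ⊨ isSuccessor y a) ⇔ (lookup ρ y ≡ S (lookup ρ a))
    isSuccessor-ok ρ y a = mk⇔
      (λ h → extensionality _ _ λ z → mk⇔ (from (∈-S _ z) ∘ proj₁ (h z)) (proj₂ (h z) ∘ to (∈-S _ z)))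
      (λ e z → (λ z∈ → to (∈-S _ z) (subst (z ∈_) e z∈)) , λ z≡ → subst (z ∈_) (sym e) (from (∈-S _ z) z≡))

    trᵗ-ok : ∀ {m n} (t : Term m) {v : Renaming m n} {c σ ρ} → σ ≗[ v ] ρ → paramsᵗ t ≗[ c ] ρ →
             ∀ y → (ρ ⊨ trᵗ t v c y) ⇔ (lookup ρ y ≡ ⟦ t ⟧ᵗ σ)
    trᵗ-ok (var i)    hv hc y = ≡-⇔ refl (hv i)
    trᵗ-ok (con c)    hv hc y = ≡-⇔ refl (hc zero)
    trᵗ-ok ⟪ t , u ⟫ᵗ {c = c} {ρ = ρ} hv hc y = mk⇔
      (λ (a , b , ha , hb , hy) → trans (to (isOrderedPair-ok (b ∷ a ∷ ρ) (suc (suc y)) (suc zero) zero) hy)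
        (cong₂ ⟪_,_⟫ (to (trᵗ-ok t {ρ = b ∷ a ∷ ρ} hv (left-≗ (paramsᵗ t) _ c ρ hc) (suc zero)) ha)
                     (to (trᵗ-ok u {ρ = b ∷ a ∷ ρ} hv (right-≗ (paramsᵗ t) _ c ρ hc) zero) hb)))
      (λ e → _ , _ , from (trᵗ-ok t {ρ = _ ∷ _ ∷ ρ} hv (left-≗ (paramsᵗ t) _ c ρ hc) (suc zero)) refl ,
                     from (trᵗ-ok u {ρ = _ ∷ _ ∷ ρ} hv (right-≗ (paramsᵗ t) _ c ρ hc) zero) refl ,
                     from (isOrderedPair-ok (_ ∷ _ ∷ ρ) (suc (suc y)) (suc zero) zero) e)
    trᵗ-ok (Sᵗ t) {ρ = ρ} hv hc y = mk⇔
      (λ (a , ha , hy) → trans (to (isSuccessor-ok (a ∷ ρ) (suc y) zero) hy)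
                               (cong S (to (trᵗ-ok t {ρ = a ∷ ρ} hv hc zero) ha)))
      (λ e → _ , from (trᵗ-ok t {ρ = _ ∷ ρ} hv hc zero) refl , from (isSuccessor-ok (_ ∷ ρ) (suc y) zero) e)

    atom-ok : ∀ {m n} (t u : Term m) {v : Renaming m n} {c σ ρ} → σ ≗[ v ] ρ → (paramsᵗ t ++ paramsᵗ u) ≗[ c ] ρ →
              (R : ∀ {k} → Fin k → Fin k → Formula k) (R′ : Carrier → Carrier → Set ℓ) →
              (∀ {a b} → (b ∷ a ∷ ρ ⊨ R (suc zero) zero) ⇔ R′ a b) →
              (ρ ⊨ atom t u v c R) ⇔ R′ (⟦ t ⟧ᵗ σ) (⟦ u ⟧ᵗ σ)
    atom-ok t u {c = c} {ρ = ρ} hv hc R R′ e = mk⇔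
      (λ (a , b , ha , hb , hR) → subst₂ R′
        (to (trᵗ-ok t {ρ = b ∷ a ∷ ρ} hv (left-≗ (paramsᵗ t) _ c ρ hc) (suc zero)) ha)
        (to (trᵗ-ok u {ρ = b ∷ a ∷ ρ} hv (right-≗ (paramsᵗ t) _ c ρ hc) zero) hb) (to e hR))
      (λ r → _ , _ , from (trᵗ-ok t {ρ = _ ∷ _ ∷ ρ} hv (left-≗ (paramsᵗ t) _ c ρ hc) (suc zero)) refl ,
                     from (trᵗ-ok u {ρ = _ ∷ _ ∷ ρ} hv (right-≗ (paramsᵗ t) _ c ρ hc) zero) refl , from e r)

    tr-ok : ∀ {m n} (φ : Form m) {v : Renaming m n} {c σ ρ} → σ ≗[ v ] ρ → params φ ≗[ c ] ρ →
            (ρ ⊨ tr φ v c) ⇔ ⟦ φ ⟧ σ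
    tr-ok (t ∈ᶠ u) hv hc = atom-ok t u hv hc _∈̇_ _∈_ (mk⇔ (λ z → z) (λ z → z))
    tr-ok (t ≡ᶠ u) hv hc = atom-ok t u hv hc _≡̇_ _≡_ (mk⇔ (λ z → z) (λ z → z))
    tr-ok (¬ᶠ φ)   hv hc = ¬-cong-⇔ (tr-ok φ hv hc)
    tr-ok (φ ∧ᶠ ψ) {c = c} {ρ = ρ} hv hc = tr-ok φ hv (left-≗ (params φ) _ c ρ hc) ×-⇔ tr-ok ψ hv (right-≗ (params φ) _ c ρ hc)
    tr-ok (φ ∨ᶠ ψ) {c = c} {ρ = ρ} hv hc = tr-ok φ hv (left-≗ (params φ) _ c ρ hc) ⊎-⇔ tr-ok ψ hv (right-≗ (params φ) _ c ρ hc)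
    tr-ok (φ ⇒ᶠ ψ) {c = c} {ρ = ρ} hv hc = →-cong-⇔ (tr-ok φ hv (left-≗ (params φ) _ c ρ hc)) (tr-ok ψ hv (right-≗ (params φ) _ c ρ hc))
    tr-ok (φ ⇔ᶠ ψ) {c = c} {ρ = ρ} hv hc = ↔̇-⇔ (tr-ok φ hv (left-≗ (params φ) _ c ρ hc)) (tr-ok ψ hv (right-≗ (params φ) _ c ρ hc))
    tr-ok (∀ᶠ φ)   hv hc = Π-⇔ λ x → tr-ok φ (lift-≗ x hv) hc
    tr-ok (∃ᶠ φ)   hv hc = ∃-⇔ λ x → tr-ok φ (lift-≗ x hv) hc

  private
    v₁ : ∀ {k} → Renaming 1 (1+ k)
    v₁ zero = zero

    v₂ : ∀ {k} → Renaming 2 (1+ 1+ k)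
    v₂ zero       = zero
    v₂ (suc zero) = suc zero

    ok₁ : ∀ (φ : Form 1) x → (x ∷ params φ ⊨ tr φ v₁ suc) ⇔ ⟦ φ ⟧ (x ∷ [])
    ok₁ φ x = tr-ok φ (λ { zero → refl }) (λ i → refl)

    ok₂ : ∀ (φ : Form 2) x y → (x ∷ y ∷ params φ ⊨ tr φ v₂ (suc ∘ suc)) ⇔ ⟦ φ ⟧ (x ∷ y ∷ [])
    ok₂ φ x y = tr-ok φ (λ { zero → refl ; (suc zero) → refl }) (λ i → refl)

  abstract
    sep : Form 1 → Carrier → Carrier
    sep φ a = proj₁ (separation (tr φ v₁ suc) (params φ) a)

    ∈-sep : ∀ φ a x → x ∈ sep φ a ⇔ (x ∈ a × ⟦ φ ⟧ (x ∷ []))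
    ∈-sep φ a x = mk⇔
      (λ h → let (x∈a , p) = to (proj₂ (separation (tr φ v₁ suc) (params φ) a) x) h in x∈a , to (ok₁ φ x) p)
      (λ (x∈a , p) → from (proj₂ (separation (tr φ v₁ suc) (params φ) a) x) (x∈a , from (ok₁ φ x) p))

    replace : (φ : Form 2) (a : Carrier) →
              (∀ x y y′ → x ∈ a → ⟦ φ ⟧ (x ∷ y ∷ []) → ⟦ φ ⟧ (x ∷ y′ ∷ []) → y ≡ y′) →
              ∃ λ b → b ≐ λ y → ∃ λ x → x ∈ a × ⟦ φ ⟧ (x ∷ y ∷ [])
    replace φ a u =
      let (b , hb) = replacement (tr φ v₂ (suc ∘ suc)) (params φ) a
                       (λ x y y′ x∈ p q → u x y y′ x∈ (to (ok₂ φ x y) p) (to (ok₂ φ x y′) q))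
      in b , λ y → mk⇔ (λ h → let (x , x∈ , p) = to (hb y) h in x , x∈ , to (ok₂ φ x y) p)
                       (λ (x , x∈ , p) → from (hb y) (x , x∈ , from (ok₂ φ x y) p))

-- Elementary set theory inside a model

module SetTheory {ℓ} (em : ExcludedMiddle ℓ) (M : ZFCModel ℓ) where
  open ZFCModel M
  open InModel M
  open Definability M public

  abstract
    byContradiction : {P : Set ℓ} → ¬ ¬ P → P
    byContradiction {P} ¬¬p with em {P}
    ... | yes p = p
    ... | no ¬p = ⊥-elim (¬¬p ¬p)

  v0 : ∀ {n} → Term (1+ n)
  v0 = var zero
  v1 : ∀ {n} → Term (1+ 1+ n)
  v1 = var (suc zero)
  v2 : ∀ {n} → Term (1+ 1+ 1+ n)
  v2 = var (suc (suc zero))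
  v3 : ∀ {n} → Term (1+ 1+ 1+ 1+ n)
  v3 = var (suc (suc (suc zero)))
  v4 : ∀ {n} → Term (1+ 1+ 1+ 1+ 1+ n)
  v4 = var (suc (suc (suc (suc zero))))
  v5 : ∀ {n} → Term (1+ 1+ 1+ 1+ 1+ 1+ n)
  v5 = var (suc (suc (suc (suc (suc zero)))))
  v6 : ∀ {n} → Term (1+ 1+ 1+ 1+ 1+ 1+ 1+ n)
  v6 = var (suc (suc (suc (suc (suc (suc zero))))))

  ext : ∀ {x y} → (∀ z → z ∈ x → z ∈ y) → (∀ z → z ∈ y → z ∈ x) → x ≡ y
  ext f g = extensionality _ _ λ z → mk⇔ (f z) (g z)

  ≐-unique : ∀ {a b} {P : Pred Carrier ℓ} → a ≐ P → b ≐ P → a ≡ b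
  ≐-unique ha hb = ext (λ z → from (hb z) ∘ to (ha z)) (λ z → from (ha z) ∘ to (hb z))

  ∉∅ : ∀ z → ¬ z ∈ ∅
  ∉∅ = proj₂ (proj₂ (proj₁ (proj₂ infinity)))

  ∈-pair : ∀ {x y} z → z ∈ ｛ x , y ｝ ⇔ (z ≡ x ⊎ z ≡ y)
  ∈-pair = proj₂ (pairing _ _)

  ∈-pairˡ : ∀ {x y} → x ∈ ｛ x , y ｝
  ∈-pairˡ = from (∈-pair _) (inj₁ refl)

  ∈-pairʳ : ∀ {x y} → y ∈ ｛ x , y ｝
  ∈-pairʳ = from (∈-pair _) (inj₂ refl)

  ∈-singleton : ∀ {x z} → z ∈ ｛ x , x ｝ → z ≡ x
  ∈-singleton h = [ id , id ]′ (to (∈-pair _) h)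

  ⟪⟫-inj : ∀ {x y x′ y′} → ⟪ x , y ⟫ ≡ ⟪ x′ , y′ ⟫ → x ≡ x′ × y ≡ y′
  ⟪⟫-inj {x} {y} {x′} {y′} e = x≡x′ , y≡y′ x≡x′ (fwd ∈-pairʳ) (bwd ∈-pairʳ)
    where
    fwd : ∀ {w} → w ∈ ⟪ x , y ⟫ → w ≡ ｛ x′ , x′ ｝ ⊎ w ≡ ｛ x′ , y′ ｝
    fwd h = to (∈-pair _) (subst (_ ∈_) e h)
    bwd : ∀ {w} → w ∈ ⟪ x′ , y′ ⟫ → w ≡ ｛ x , x ｝ ⊎ w ≡ ｛ x , y ｝
    bwd h = to (∈-pair _) (subst (_ ∈_) (sym e) h)
    x≡x′ : x ≡ x′
    x≡x′ with fwd {｛ x , x ｝} ∈-pairˡ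
    ... | inj₁ p = ∈-singleton (subst (x ∈_) p ∈-pairˡ)
    ... | inj₂ p = sym (∈-singleton (subst (x′ ∈_) (sym p) ∈-pairˡ))
    y≡y′ : x ≡ x′ → ｛ x , y ｝ ≡ ｛ x′ , x′ ｝ ⊎ ｛ x , y ｝ ≡ ｛ x′ , y′ ｝ →
           ｛ x′ , y′ ｝ ≡ ｛ x , x ｝ ⊎ ｛ x′ , y′ ｝ ≡ ｛ x , y ｝ → y ≡ y′
    y≡y′ refl (inj₁ p) (inj₁ q) = trans (∈-singleton (subst (y ∈_) p ∈-pairʳ)) (sym (∈-singleton (subst (y′ ∈_) q ∈-pairʳ)))
    y≡y′ refl (inj₁ p) (inj₂ q) with to (∈-pair _) (subst (y′ ∈_) q ∈-pairʳ)
    ... | inj₂ r = sym r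
    ... | inj₁ r = trans (∈-singleton (subst (y ∈_) p ∈-pairʳ)) (sym r)
    y≡y′ refl (inj₂ p) _ with to (∈-pair _) (subst (y ∈_) p ∈-pairʳ) | to (∈-pair _) (subst (y′ ∈_) (sym p) ∈-pairʳ)
    ... | inj₂ r | _      = r
    ... | inj₁ r | inj₂ q = sym q
    ... | inj₁ r | inj₁ q = trans r (sym q)

  -- Foundation, applied to the part of `a` that `φ` cuts out. With `φ` the negation of a property,
  -- it takes the place of ∈-induction.
  minimal : (φ : Form 1) → ∀ a x → x ∈ a → ⟦ φ ⟧ (x ∷ []) →
            ∃ λ m → m ∈ a × ⟦ φ ⟧ (m ∷ []) × (∀ z → z ∈ a → ⟦ φ ⟧ (z ∷ []) → ¬ z ∈ m)
  minimal φ a x x∈a p =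
    let (m , m∈ , h) = foundation (sep φ a) (x , from (∈-sep φ a x) (x∈a , p))
        (m∈a , q) = to (∈-sep φ a m) m∈
    in m , m∈a , q , λ z z∈a r → h z (from (∈-sep φ a z) (z∈a , r))

  ∈-irrefl : ∀ x → ¬ x ∈ x
  ∈-irrefl x x∈x with foundation ｛ x , x ｝ (x , ∈-pairˡ)
  ... | m , m∈ , h with ∈-singleton m∈
  ... | refl = h m m∈ x∈x

  ∈-asym : ∀ {x y} → x ∈ y → ¬ y ∈ x
  ∈-asym {x} {y} x∈y y∈x with foundation ｛ x , y ｝ (x , ∈-pairˡ)
  ... | m , m∈ , h with to (∈-pair _) m∈
  ... | inj₁ refl = h y ∈-pairʳ y∈x
  ... | inj₂ refl = h x ∈-pairˡ x∈y

  ∈-Sˡ : ∀ {x z} → z ∈ x → z ∈ S x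
  ∈-Sˡ h = from (∈-S _ _) (inj₁ h)

  ∈-Sʳ : ∀ {x} → x ∈ S x
  ∈-Sʳ = from (∈-S _ _) (inj₂ refl)

  S-inj : ∀ {x y} → S x ≡ S y → x ≡ y
  S-inj {x} {y} e with to (∈-S y x) (subst (x ∈_) e ∈-Sʳ) | to (∈-S x y) (subst (y ∈_) (sym e) ∈-Sʳ)
  ... | inj₂ p | _      = p
  ... | inj₁ _ | inj₂ q = sym q
  ... | inj₁ p | inj₁ q = ⊥-elim (∈-asym p q)

  ∅≢S : ∀ {x} → ∅ ≢ S x
  ∅≢S {x} e = ∉∅ x (subst (x ∈_) (sym e) ∈-Sʳ)

  abstract
    ⋃ : Carrier → Carrier
    ⋃ x = proj₁ (union x)

    ∈-⋃ : ∀ {x} z → z ∈ ⋃ x ⇔ (∃ λ y → y ∈ x × z ∈ y)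
    ∈-⋃ {x} = proj₂ (union x)

    𝒫 : Carrier → Carrier
    𝒫 x = proj₁ (powerset x)

    ∈-𝒫 : ∀ {x} y → y ∈ 𝒫 x ⇔ (∀ z → z ∈ y → z ∈ x)
    ∈-𝒫 {x} = proj₂ (powerset x)

  abstract
    infixl 6 _∪_
    _∪_ : Carrier → Carrier → Carrier
    x ∪ y = ⋃ ｛ x , y ｝

    ∈-∪ : ∀ {x y} z → z ∈ x ∪ y ⇔ (z ∈ x ⊎ z ∈ y)
    ∈-∪ {x} {y} z = mk⇔ to∪ [ (λ h → from (∈-⋃ z) (x , ∈-pairˡ , h)) , (λ h → from (∈-⋃ z) (y , ∈-pairʳ , h)) ]′
      where
      to∪ : z ∈ x ∪ y → z ∈ x ⊎ z ∈ y
      to∪ h with to (∈-⋃ z) h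
      ... | w , w∈ , z∈ with to (∈-pair w) w∈
      ... | inj₁ refl = inj₁ z∈
      ... | inj₂ refl = inj₂ z∈

  abstract
    infixl 7 _∩_ _∖_
    _∩_ _∖_ : Carrier → Carrier → Carrier
    x ∩ y = sep (v0 ∈ᶠ con y) x
    x ∖ y = sep (¬ᶠ (v0 ∈ᶠ con y)) x

    ∈-∩ : ∀ {x y} z → z ∈ x ∩ y ⇔ (z ∈ x × z ∈ y)
    ∈-∩ = ∈-sep _ _

    ∈-∖ : ∀ {x y} z → z ∈ x ∖ y ⇔ (z ∈ x × ¬ z ∈ y)
    ∈-∖ = ∈-sep _ _

    infixr 6 _⊗_
    _⊗_ : Carrier → Carrier → Carrier
    a ⊗ b = sep (∃ᶠ (∃ᶠ (v1 ∈ᶠ con a ∧ᶠ v0 ∈ᶠ con b ∧ᶠ v2 ≡ᶠ ⟪ v1 , v0 ⟫ᵗ))) (𝒫 (𝒫 (a ∪ b)))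

    ∈-⊗ : ∀ {a b} p → p ∈ a ⊗ b ⇔ (∃₂ λ x y → x ∈ a × y ∈ b × p ≡ ⟪ x , y ⟫)
    ∈-⊗ {a} {b} p = mk⇔ (λ h → proj₂ (to (∈-sep _ _ p) h))
      λ { (x , y , x∈ , y∈ , refl) → from (∈-sep _ _ p)
          (from (∈-𝒫 _) (λ q q∈ → from (∈-𝒫 _) λ z z∈ → bound x∈ y∈ (to (∈-pair q) q∈) z∈) , x , y , x∈ , y∈ , refl) }
      where
      bound : ∀ {x y q z} → x ∈ a → y ∈ b → q ≡ ｛ x , x ｝ ⊎ q ≡ ｛ x , y ｝ → z ∈ q → z ∈ a ∪ b
      bound x∈ y∈ (inj₁ refl) z∈ with ∈-singleton z∈
      ... | refl = from (∈-∪ _) (inj₁ x∈)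
      bound x∈ y∈ (inj₂ refl) z∈ with to (∈-pair _) z∈
      ... | inj₁ refl = from (∈-∪ _) (inj₁ x∈)
      ... | inj₂ refl = from (∈-∪ _) (inj₂ y∈)

  ∩-comm : ∀ x y → x ∩ y ≡ y ∩ x
  ∩-comm x y = ext (λ z h → let (a , b) = to (∈-∩ z) h in from (∈-∩ z) (b , a))
                   (λ z h → let (a , b) = to (∈-∩ z) h in from (∈-∩ z) (b , a))

  ⟪⟫∈⊗ : ∀ {a b x y} → ⟪ x , y ⟫ ∈ a ⊗ b ⇔ (x ∈ a × y ∈ b)
  ⟪⟫∈⊗ = mk⇔
    (λ h → let (x′ , y′ , x∈ , y∈ , e) = to (∈-⊗ _) h ; (e₁ , e₂) = ⟪⟫-inj e in
           subst (_∈ _) (sym e₁) x∈ , subst (_∈ _) (sym e₂) y∈)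
    (λ (x∈ , y∈) → from (∈-⊗ _) (_ , _ , x∈ , y∈ , refl))

  -- Both components of a Kuratowski pair lie two unions below a set of pairs, so this one set
  -- bounds the domain and the range at once.
  field′ : Carrier → Carrier
  field′ f = ⋃ (⋃ f)

  fieldˡ : ∀ {f x y} → ⟪ x , y ⟫ ∈ f → x ∈ field′ f
  fieldˡ h = from (∈-⋃ _) (_ , from (∈-⋃ _) (_ , h , ∈-pairʳ) , ∈-pairˡ)

  fieldʳ : ∀ {f x y} → ⟪ x , y ⟫ ∈ f → y ∈ field′ f
  fieldʳ h = from (∈-⋃ _) (_ , from (∈-⋃ _) (_ , h , ∈-pairʳ) , ∈-pairʳ)

  natᶠ evenᶠ : ∀ {n} → Term n → Form n
  natᶠ t = ∀ᶠ (con ∅ ∈ᶠ v0 ⇒ᶠ ∀ᶠ (v0 ∈ᶠ v1 ⇒ᶠ Sᵗ v0 ∈ᶠ v1) ⇒ᶠ wk t ∈ᶠ v0)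
  evenᶠ t = ∀ᶠ (con ∅ ∈ᶠ v0 ⇒ᶠ ∀ᶠ (v0 ∈ᶠ v1 ⇒ᶠ Sᵗ (Sᵗ v0) ∈ᶠ v1) ⇒ᶠ wk t ∈ᶠ v0)

  nat-∅ : IsNat ∅
  nat-∅ w h _ = h

  nat-S : ∀ {n} → IsNat n → IsNat (S n)
  nat-S h w z s = s _ (h w z s)

  abstract
    ω : Carrier
    ω = sep (natᶠ v0) (proj₁ infinity)

    ∈-ω : ω ≐ IsNat
    ∈-ω n = mk⇔ (λ h → proj₂ (to (∈-sep _ _ n) h)) λ h → from (∈-sep _ _ n) (h _ z s , h)
      where
      z : ∅ ∈ proj₁ infinity
      z = proj₁ (proj₂ (proj₁ (proj₂ infinity)))
      s : ∀ x → x ∈ proj₁ infinity → S x ∈ proj₁ infinity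
      s x x∈ = let (y , y∈ , hy) = proj₂ (proj₂ infinity) x x∈ in
               subst (_∈ _) (≐-unique hy (∈-S x)) y∈

  natInd : (φ : Form 1) → ⟦ φ ⟧ (∅ ∷ []) → (∀ k → IsNat k → ⟦ φ ⟧ (k ∷ []) → ⟦ φ ⟧ (S k ∷ [])) →
           ∀ n → IsNat n → ⟦ φ ⟧ (n ∷ [])
  natInd φ z s n hn = proj₂ (to (∈-sep φ ω n) (hn (sep φ ω)
    (from (∈-sep φ ω ∅) (from (∈-ω ∅) nat-∅ , z))
    λ k k∈ → let (k∈ω , p) = to (∈-sep φ ω k) k∈ ; hk = to (∈-ω k) k∈ω in
             from (∈-sep φ ω (S k)) (from (∈-ω (S k)) (nat-S hk) , s k hk p)))

  nat-elem : ∀ n → IsNat n → ∀ k → k ∈ n → IsNat k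
  nat-elem n hn k k∈ = to (∈-ω k) (natInd (∀ᶠ (v0 ∈ᶠ v1 ⇒ᶠ v0 ∈ᶠ con ω)) (λ k k∈ → ⊥-elim (∉∅ k k∈))
    (λ m hm ih k k∈ → [ ih k , (λ { refl → from (∈-ω k) hm }) ]′ (to (∈-S m k) k∈)) n hn k k∈)

  nat-trans : ∀ n → IsNat n → ∀ k j → k ∈ n → j ∈ k → j ∈ n
  nat-trans = natInd (∀ᶠ (∀ᶠ (v1 ∈ᶠ v2 ⇒ᶠ v0 ∈ᶠ v1 ⇒ᶠ v0 ∈ᶠ v2))) (λ k j k∈ _ → ⊥-elim (∉∅ k k∈))
    (λ m hm ih k j k∈ j∈ → ∈-Sˡ ([ (λ k∈m → ih k j k∈m j∈) , (λ { refl → j∈ }) ]′ (to (∈-S m k) k∈)))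

  S∈S⇒∈ : ∀ {n k} → IsNat n → S k ∈ S n → k ∈ n
  S∈S⇒∈ {n} {k} hn h = [ (λ Sk∈ → nat-trans n hn (S k) k Sk∈ ∈-Sʳ) , (λ { refl → ∈-Sʳ }) ]′ (to (∈-S n (S k)) h)

  funᶠ : ∀ {n} → Term n → Term n → Term n → Form n
  funᶠ f a b =
    ∀ᶠ (v0 ∈ᶠ wk f ⇒ᶠ ∃ᶠ (∃ᶠ ((v1 ∈ᶠ wk (wk (wk a)) ∧ᶠ v0 ∈ᶠ wk (wk (wk b))) ∧ᶠ v2 ≡ᶠ ⟪ v1 , v0 ⟫ᵗ))) ∧ᶠ
    ∀ᶠ (v0 ∈ᶠ wk a ⇒ᶠ ∃ᶠ (⟪ v1 , v0 ⟫ᵗ ∈ᶠ wk (wk f) ∧ᶠ ∀ᶠ (⟪ v2 , v0 ⟫ᵗ ∈ᶠ wk (wk (wk f)) ⇒ᶠ v0 ≡ᶠ v1)))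

  ∅-fun : {Q : Pred Carrier ℓ} → ∅ ∶ (_∈ ∅) ⟶ Q
  ∅-fun = (λ p p∈ → ⊥-elim (∉∅ p p∈)) , (λ x x∈ → ⊥-elim (∉∅ x x∈))

  module _ {f : Carrier} {P Q : Pred Carrier ℓ} (hf : f ∶ P ⟶ Q) where

    fun-type : ∀ {x y} → ⟪ x , y ⟫ ∈ f → P x × Q y
    fun-type h with proj₁ hf _ h
    ... | x′ , y′ , pq , e with ⟪⟫-inj e
    ... | refl , refl = pq

    fun-unique : ∀ {x y y′} → ⟪ x , y ⟫ ∈ f → ⟪ x , y′ ⟫ ∈ f → y ≡ y′
    fun-unique h h′ = let (_ , _ , u) = proj₂ hf _ (proj₁ (fun-type h)) in trans (u _ h) (sym (u _ h′))

    fun-value : ∀ {x} → P x → ∃ λ y → ⟪ x , y ⟫ ∈ f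
    fun-value px = let (y , h , _) = proj₂ hf _ px in y , h

    fun-map : {Q′ : Pred Carrier ℓ} → (∀ {x y} → ⟪ x , y ⟫ ∈ f → Q′ y) → f ∶ P ⟶ Q′
    fun-map g = (λ p p∈ → let (x , y , (px , _) , e) = proj₁ hf p p∈ in
                  x , y , (px , g (subst (_∈ f) e p∈)) , e) , proj₂ hf

  fun-weaken : ∀ {f} {P Q Q′ : Pred Carrier ℓ} → f ∶ P ⟶ Q → (∀ {y} → Q y → Q′ y) → f ∶ P ⟶ Q′
  fun-weaken hf s = fun-map hf λ h → s (proj₂ (fun-type hf h))

  abstract
    -- The third variable of `φ` is the pair collected by replacement, which is in scope where `φ`
    -- is used. `inv` says that `φ` ignores it, which holds by computation for each formula
    -- supplied; this spares a weakening operation on formulas.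
    mkFun : (φ : Form 3) → (∀ x y p → ⟦ φ ⟧ (y ∷ x ∷ p ∷ []) ≡ ⟦ φ ⟧ (y ∷ x ∷ ∅ ∷ [])) →
            ∀ a {Q : Pred Carrier ℓ} →
            (∀ x → x ∈ a → ∃ λ y → Q y × ⟦ φ ⟧ (y ∷ x ∷ ∅ ∷ [])) →
            (∀ x y y′ → x ∈ a → ⟦ φ ⟧ (y ∷ x ∷ ∅ ∷ []) → ⟦ φ ⟧ (y′ ∷ x ∷ ∅ ∷ []) → y ≡ y′) →
            ∃ λ f → (f ∶ (_∈ a) ⟶ Q) × (∀ x y → ⟪ x , y ⟫ ∈ f ⇔ (x ∈ a × ⟦ φ ⟧ (y ∷ x ∷ ∅ ∷ [])))
    mkFun φ inv a {Q} val uniq = f , (pairs , total) , spec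
      where
      conv : ∀ {x y p} → ⟦ φ ⟧ (y ∷ x ∷ p ∷ []) → ⟦ φ ⟧ (y ∷ x ∷ ∅ ∷ [])
      conv {x} {y} {p} h = subst id (inv x y p) h
      graph : ∃ λ b → b ≐ λ p → ∃ λ x → x ∈ a × ∃ λ y → p ≡ ⟪ x , y ⟫ × ⟦ φ ⟧ (y ∷ x ∷ p ∷ [])
      graph = replace (∃ᶠ (v2 ≡ᶠ ⟪ v1 , v0 ⟫ᵗ ∧ᶠ φ)) a
        λ { x p p′ x∈ (y , refl , h) (y′ , refl , h′) → cong ⟪ x ,_⟫ (uniq x y y′ x∈ (conv h) (conv h′)) }
      f : Carrier
      f = proj₁ graph
      spec : ∀ x y → ⟪ x , y ⟫ ∈ f ⇔ (x ∈ a × ⟦ φ ⟧ (y ∷ x ∷ ∅ ∷ []))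
      spec x y = mk⇔ to′ λ (x∈ , h) → from (proj₂ graph _) (x , x∈ , y , refl , subst id (sym (inv x y _)) h)
        where
        to′ : ⟪ x , y ⟫ ∈ f → x ∈ a × ⟦ φ ⟧ (y ∷ x ∷ ∅ ∷ [])
        to′ h with to (proj₂ graph _) h
        ... | x′ , x∈ , y′ , e , q with ⟪⟫-inj e
        ... | refl , refl = x∈ , conv q
      pairs : ∀ p → p ∈ f → ∃₂ λ x y → (x ∈ a × Q y) × p ≡ ⟪ x , y ⟫
      pairs p p∈ with to (proj₂ graph p) p∈
      ... | x , x∈ , y , e , h with val x x∈
      ... | y′ , q , h′ = x , y , (x∈ , subst Q (uniq x y′ y x∈ h′ (conv h)) q) , e
      total : ∀ x → x ∈ a → ∃ λ y → ⟪ x , y ⟫ ∈ f × (∀ y′ → ⟪ x , y′ ⟫ ∈ f → y′ ≡ y)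
      total x x∈ = let (y , q , h) = val x x∈ in
        y , from (spec x y) (x∈ , h) , λ y′ h′ → uniq x y′ y x∈ (proj₂ (to (spec x y′) h′)) h

  abstract
    infix 8 _◂_
    _◂_ : Carrier → Carrier → Carrier
    f ◂ p = f ∪ ｛ p , p ｝

    ∈-◂ : ∀ {f p} z → z ∈ f ◂ p ⇔ (z ∈ f ⊎ z ≡ p)
    ∈-◂ z = mk⇔ ([ inj₁ , inj₂ ∘ ∈-singleton ]′ ∘ to (∈-∪ z))
                [ from (∈-∪ z) ∘ inj₁ , (λ { refl → from (∈-∪ z) (inj₂ ∈-pairˡ) }) ]′

  ◂ˡ : ∀ {f p z} → z ∈ f → z ∈ f ◂ p
  ◂ˡ h = from (∈-◂ _) (inj₁ h)

  ◂ʳ : ∀ {f p} → p ∈ f ◂ p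
  ◂ʳ = from (∈-◂ _) (inj₂ refl)

  -- The argument `n` is new because `n` is not an element of itself.
  ◂-fun : ∀ {f n y} {Q : Pred Carrier ℓ} → f ∶ (_∈ n) ⟶ Q → Q y → f ◂ ⟪ n , y ⟫ ∶ (_∈ S n) ⟶ Q
  ◂-fun {f} {n} {y} {Q} hf qy = pairs , total
    where
    pairs : ∀ p → p ∈ f ◂ ⟪ n , y ⟫ → ∃₂ λ x z → (x ∈ S n × Q z) × p ≡ ⟪ x , z ⟫
    pairs p p∈ with to (∈-◂ p) p∈
    ... | inj₁ h = let (x , z , (x∈ , q) , e) = proj₁ hf p h in x , z , (∈-Sˡ x∈ , q) , e
    ... | inj₂ e = n , y , (∈-Sʳ , qy) , e
    new : ∀ y′ → ⟪ n , y′ ⟫ ∈ f ◂ ⟪ n , y ⟫ → y′ ≡ y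
    new y′ h with to (∈-◂ _) h
    ... | inj₁ h′ = ⊥-elim (∈-irrefl n (proj₁ (fun-type hf h′)))
    ... | inj₂ e  = proj₂ (⟪⟫-inj e)
    old : ∀ {x z y′} → x ∈ n → ⟪ x , z ⟫ ∈ f → ⟪ x , y′ ⟫ ∈ f ◂ ⟪ n , y ⟫ → y′ ≡ z
    old x∈ h h′ with to (∈-◂ _) h′
    ... | inj₁ h″ = fun-unique hf h″ h
    ... | inj₂ e with ⟪⟫-inj e
    ... | refl , _ = ⊥-elim (∈-irrefl n x∈)
    total : ∀ x → x ∈ S n → ∃ λ z → ⟪ x , z ⟫ ∈ f ◂ ⟪ n , y ⟫ × (∀ y′ → ⟪ x , y′ ⟫ ∈ f ◂ ⟪ n , y ⟫ → y′ ≡ z)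
    total x x∈ with to (∈-S n x) x∈
    ... | inj₂ refl = y , ◂ʳ , new
    ... | inj₁ x∈n  = let (z , h) = fun-value hf x∈n in z , ◂ˡ h , λ y′ → old x∈n h

  abstract
    _⊙_ : Carrier → Carrier → Carrier
    g ⊙ f = sep (∃ᶠ (∃ᶠ (∃ᶠ (⟪ v2 , v1 ⟫ᵗ ∈ᶠ con f ∧ᶠ ⟪ v1 , v0 ⟫ᵗ ∈ᶠ con g ∧ᶠ v3 ≡ᶠ ⟪ v2 , v0 ⟫ᵗ)))) (field′ f ⊗ field′ g)

    ⊙-isComposite : ∀ g f → IsComposite (g ⊙ f) g f
    ⊙-isComposite g f p = mk⇔ (λ h → proj₂ (to (∈-sep _ _ p) h))
      λ { (x , y , z , hf , hg , refl) → from (∈-sep _ _ p)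
          (from ⟪⟫∈⊗ (fieldˡ hf , fieldʳ hg) , x , y , z , hf , hg , refl) }

  ∈-composite : ∀ {h g f} → IsComposite h g f → ∀ {x z} → ⟪ x , z ⟫ ∈ h → ∃ λ y → ⟪ x , y ⟫ ∈ f × ⟪ y , z ⟫ ∈ g
  ∈-composite c hh with to (c _) hh
  ... | x , y , z , hf , hg , e with ⟪⟫-inj e
  ... | refl , refl = y , hf , hg

  composite-∈ : ∀ {h g f} → IsComposite h g f → ∀ {x y z} → ⟪ x , y ⟫ ∈ f → ⟪ y , z ⟫ ∈ g → ⟪ x , z ⟫ ∈ h
  composite-∈ c hf hg = from (c _) (_ , _ , _ , hf , hg , refl)

  composite-fun : ∀ {h g f} {P Q R : Pred Carrier ℓ} → IsComposite h g f → f ∶ P ⟶ Q → g ∶ Q ⟶ R → h ∶ P ⟶ R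
  composite-fun c hf hg =
    (λ p p∈ → let (x , y , z , h₁ , h₂ , e) = to (c p) p∈ in
      x , z , (proj₁ (fun-type hf h₁) , proj₂ (fun-type hg h₂)) , e) ,
    λ x px → let (y , h₁) = fun-value hf px ; (z , h₂) = fun-value hg (proj₂ (fun-type hf h₁)) in
      z , composite-∈ c h₁ h₂ , λ z′ h → let (y′ , h₁′ , h₂′) = ∈-composite c h in
        fun-unique hg (subst (λ u → ⟪ u , z′ ⟫ ∈ _) (fun-unique hf h₁′ h₁) h₂′) h₂

  abstract
    -- Choice, applied to the fibres of f.
    section : ∀ {f P Q} → f ∶ P ⟶ Q → ∃ λ c → ∀ {x y} → ⟪ x , y ⟫ ∈ f →
              ∃ λ z → (z ∈ c × ⟪ z , y ⟫ ∈ f) × (∀ w → w ∈ c → ⟪ w , y ⟫ ∈ f → w ≡ z)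
    section {f} hf = proj₁ ch , λ {x} {y} h →
        let F = fibre y
            (z , (z∈F , z∈c) , u) = proj₂ ch F (from (∈-sep _ _ F)
               (from (∈-𝒫 _) (λ w w∈ → proj₁ (to (∈-sep _ _ w) w∈)) , y , (x , h) ,
                λ w → mk⇔ (λ w∈ → proj₂ (to (∈-sep _ _ w) w∈)) λ wy → from (∈-sep _ _ w) (fieldˡ wy , wy)))
        in z , (z∈c , proj₂ (to (∈-sep _ _ z) z∈F)) , λ w w∈c wy → u w (from (∈-sep _ _ w) (fieldˡ wy , wy)) w∈c
      where
      fibre : Carrier → Carrier
      fibre y = sep (⟪ v0 , con y ⟫ᵗ ∈ᶠ con f) (field′ f)
      fibres : Carrier
      fibres = sep (∃ᶠ (∃ᶠ (⟪ v0 , v1 ⟫ᵗ ∈ᶠ con f) ∧ᶠ ∀ᶠ (v0 ∈ᶠ v2 ⇔ᶠ ⟪ v0 , v1 ⟫ᵗ ∈ᶠ con f))) (𝒫 (field′ f))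
      ch : ∃ λ c → ∀ F → F ∈ fibres → ∃ λ z → (z ∈ F × z ∈ c) × (∀ w → w ∈ F → w ∈ c → w ≡ z)
      ch = choice fibres
        (λ F F∈ → let (_ , y , (x , h) , e) = to (∈-sep _ _ F) F∈ in x , from (e x) h)
        λ F G z F∈ G∈ z∈F z∈G →
          let (_ , y , _ , e) = to (∈-sep _ _ F) F∈ ; (_ , y′ , _ , e′) = to (∈-sep _ _ G) G∈
              y≡y′ = fun-unique hf (to (e z) z∈F) (to (e′ z) z∈G)
          in ext (λ w w∈ → from (e′ w) (subst (λ u → ⟪ w , u ⟫ ∈ f) y≡y′ (to (e w) w∈)))
                 (λ w w∈ → from (e w) (subst (λ u → ⟪ w , u ⟫ ∈ f) (sym y≡y′) (to (e′ w) w∈)))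

  nat-cases : ∀ n → IsNat n → n ≡ ∅ ⊎ (∃ λ k → IsNat k × n ≡ S k)
  nat-cases = natInd (v0 ≡ᶠ con ∅ ∨ᶠ ∃ᶠ (natᶠ v0 ∧ᶠ v1 ≡ᶠ Sᵗ v0)) (inj₁ refl) λ k hk _ → inj₂ (k , hk , refl)

-- A set closed under κ-sequences

module Universes {ℓ} (em : ExcludedMiddle ℓ) (M : ZFCModel ℓ) where
  open ZFCModel M
  open InModel M
  open SetTheory em M

  module Sequences (L : Carrier) where

    -- Subsets of ω × L stand for sequences of sets of labels; only the injectivity of
    -- prefixing a label matters.
    Y : Carrier
    Y = 𝒫 (ω ⊗ L)

    private
      prefixᶠ : Form 3
      prefixᶠ = ∃ᶠ (∃ᶠ (v3 ≡ᶠ ⟪ v1 , v0 ⟫ᵗ ∧ᶠ v0 ∈ᶠ con Y ∧ᶠ ∀ᶠ (v0 ∈ᶠ v3 ⇔ᶠ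
        (v0 ≡ᶠ ⟪ con ∅ , v2 ⟫ᵗ ∨ᶠ ∃ᶠ (∃ᶠ (⟪ v1 , v0 ⟫ᵗ ∈ᶠ v3 ∧ᶠ v2 ≡ᶠ ⟪ Sᵗ v1 , v0 ⟫ᵗ))))))

      Prefix : (i s q : Carrier) → Set ℓ
      Prefix i s q = q ≐ λ p → p ≡ ⟪ ∅ , i ⟫ ⊎ (∃₂ λ k y → ⟪ k , y ⟫ ∈ s × p ≡ ⟪ S k , y ⟫)

      exists : ∀ x → x ∈ L ⊗ Y → ∃ λ q → q ∈ Y × ⟦ prefixᶠ ⟧ (q ∷ x ∷ ∅ ∷ [])
      exists x x∈ with to (∈-⊗ x) x∈
      ... | i , s , i∈ , s∈ , refl = q , from (∈-𝒫 q) (λ z z∈ → proj₁ (to (∈-sep _ _ z) z∈)) , i , s , refl , s∈ ,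
          λ p → mk⇔ (λ p∈ → proj₂ (to (∈-sep _ _ p) p∈)) λ h → from (∈-sep _ _ p) (bound h , h)
        where
        q = sep (v0 ≡ᶠ ⟪ con ∅ , con i ⟫ᵗ ∨ᶠ ∃ᶠ (∃ᶠ (⟪ v1 , v0 ⟫ᵗ ∈ᶠ con s ∧ᶠ v2 ≡ᶠ ⟪ Sᵗ v1 , v0 ⟫ᵗ))) (ω ⊗ L)
        bound : ∀ {p} → p ≡ ⟪ ∅ , i ⟫ ⊎ (∃₂ λ k y → ⟪ k , y ⟫ ∈ s × p ≡ ⟪ S k , y ⟫) → p ∈ ω ⊗ L
        bound (inj₁ refl) = from ⟪⟫∈⊗ (from (∈-ω _) nat-∅ , i∈)
        bound (inj₂ (k , y , h , refl)) = let (k∈ , y∈) = to ⟪⟫∈⊗ (to (∈-𝒫 s) s∈ _ h) in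
          from ⟪⟫∈⊗ (from (∈-ω _) (nat-S (to (∈-ω k) k∈)) , y∈)

      unique : ∀ x y y′ → x ∈ L ⊗ Y → ⟦ prefixᶠ ⟧ (y ∷ x ∷ ∅ ∷ []) → ⟦ prefixᶠ ⟧ (y′ ∷ x ∷ ∅ ∷ []) → y ≡ y′
      unique x y y′ _ (i , s , refl , _ , h) (i′ , s′ , e , _ , h′) with ⟪⟫-inj e
      ... | refl , refl = ≐-unique h h′

      fun = mkFun prefixᶠ (λ x y p → refl) (L ⊗ Y) {_∈ Y} exists unique

    abstract
      J : Carrier
      J = proj₁ fun

      J-fun : J ∶ (_∈ L ⊗ Y) ⟶ (_∈ Y)
      J-fun = proj₁ (proj₂ fun)

      J-graph : ∀ x q → ⟪ x , q ⟫ ∈ J ⇔ (x ∈ L ⊗ Y × ⟦ prefixᶠ ⟧ (q ∷ x ∷ ∅ ∷ []))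
      J-graph = proj₂ (proj₂ fun)

    private
      J-spec : ∀ {i s q} → ⟪ ⟪ i , s ⟫ , q ⟫ ∈ J → s ∈ Y × Prefix i s q
      J-spec h with proj₂ (to (J-graph _ _) h)
      ... | i , s , e , s∈ , p with ⟪⟫-inj e
      ... | refl , refl = s∈ , p

      sub : ∀ {i s i′ s′ q} → s ∈ Y → Prefix i s q → Prefix i′ s′ q → ∀ p → p ∈ s → p ∈ s′
      sub {s = s} s∈ h h′ p p∈ with to (∈-⊗ p) (to (∈-𝒫 s) s∈ p p∈)
      ... | k , y , _ , _ , refl with to (h′ ⟪ S k , y ⟫) (from (h ⟪ S k , y ⟫) (inj₂ (k , y , p∈ , refl)))
      ... | inj₁ e = ⊥-elim (∅≢S (sym (proj₁ (⟪⟫-inj e))))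
      ... | inj₂ (k′ , y′ , p′ , e) with ⟪⟫-inj e
      ... | e₁ , refl with S-inj e₁
      ... | refl = p′

    -- Position 0 returns the label and the later positions return the old sequence. By this
    -- injection a family of subsets of `Y`, indexed by labels, can be packed into one subset of `Y`
    -- and recovered from it.
    J-inj : ∀ {i s i′ s′ q} → ⟪ ⟪ i , s ⟫ , q ⟫ ∈ J → ⟪ ⟪ i′ , s′ ⟫ , q ⟫ ∈ J → i ≡ i′ × s ≡ s′
    J-inj {i} {s} {i′} {s′} h h′ with J-spec h | J-spec h′
    ... | s∈ , p | s′∈ , p′ = label , ext (sub s∈ p p′) (sub s′∈ p′ p)
      where
      label : i ≡ i′
      label with to (p′ ⟪ ∅ , i ⟫) (from (p ⟪ ∅ , i ⟫) (inj₁ refl))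
      ... | inj₁ e = proj₂ (⟪⟫-inj e)
      ... | inj₂ (_ , _ , _ , e) = ⊥-elim (∅≢S (proj₁ (⟪⟫-inj e)))

    ∅∈Y : ∅ ∈ Y
    ∅∈Y = from (∈-𝒫 ∅) λ z z∈ → ⊥-elim (∉∅ z z∈)

    -- A prefixed sequence has its label at position 0. So the empty sequence is never the result of
    -- packing and is free to mark the names of atoms.
    J≢∅ : ∀ {x} → ¬ ⟪ x , ∅ ⟫ ∈ J
    J≢∅ {x} h with to (∈-⊗ x) (proj₁ (fun-type J-fun h))
    ... | i , s , _ , _ , refl = ∉∅ _ (from (proj₂ (J-spec h) _) (inj₁ refl))

  -- A name is a subset w of Y.  It names an atom of Z, or else the set of the objects named
  -- by its children indexed by K.  Foundation makes the named object unique, so the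
  -- named objects form a set by replacement.
  module Names (Z K : Carrier) where
    open Sequences (K ∪ Z)

    Atomᶠ : ∀ {n} → Term n → Term n → Form n
    Atomᶠ w x = x ∈ᶠ con Z ∧ᶠ con ∅ ∈ᶠ w ∧ᶠ
      ∃ᶠ (v0 ∈ᶠ wk w ∧ᶠ ⟪ ⟪ wk x , con ∅ ⟫ᵗ , v0 ⟫ᵗ ∈ᶠ con J) ∧ᶠ
      ∀ᶠ (∀ᶠ (⟪ ⟪ v1 , con ∅ ⟫ᵗ , v0 ⟫ᵗ ∈ᶠ con J ⇒ᶠ v0 ∈ᶠ wk (wk w) ⇒ᶠ v1 ≡ᶠ wk (wk x)))

    Childᶠ : ∀ {n} → Term n → Term n → Term n → Form n
    Childᶠ w i v = ∀ᶠ (v0 ∈ᶠ wk v ⇔ᶠ ∃ᶠ (v0 ∈ᶠ wk (wk w) ∧ᶠ ⟪ ⟪ wk (wk i) , v1 ⟫ᵗ , v0 ⟫ᵗ ∈ᶠ con J))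

    Nodeᶠ : ∀ {n} → Term n → Term n → Term n → Form n
    Nodeᶠ d w x = ¬ᶠ (con ∅ ∈ᶠ w) ∧ᶠ
      ∀ᶠ (v0 ∈ᶠ con K ⇒ᶠ ∃ᶠ (∃ᶠ (Childᶠ (wk³ w) v2 v1 ∧ᶠ ⟪ v1 , v0 ⟫ᵗ ∈ᶠ wk³ d ∧ᶠ v0 ∈ᶠ wk³ x))) ∧ᶠ
      ∀ᶠ (v0 ∈ᶠ wk x ⇒ᶠ ∃ᶠ (∃ᶠ (v1 ∈ᶠ con K ∧ᶠ Childᶠ (wk³ w) v1 v0 ∧ᶠ ⟪ v0 , v2 ⟫ᵗ ∈ᶠ wk³ d)))
      where
      wk³ : ∀ {n} → Term n → Term (1+ 1+ 1+ n)
      wk³ t = wk (wk (wk t))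

    Goodᶠ : ∀ {n} → Term n → Form n
    Goodᶠ d = ∀ᶠ (∀ᶠ (⟪ v1 , v0 ⟫ᵗ ∈ᶠ wk (wk d) ⇒ᶠ Atomᶠ v1 v0 ∨ᶠ Nodeᶠ (wk (wk d)) v1 v0))

    Namesᶠ : ∀ {n} → Term n → Term n → Form n
    Namesᶠ w x = ∃ᶠ (Goodᶠ v0 ∧ᶠ ⟪ wk w , wk x ⟫ᵗ ∈ᶠ v0)

    Atom : (w x : Carrier) → Set ℓ
    Atom w x = x ∈ Z × ∅ ∈ w × (∃ λ q → q ∈ w × ⟪ ⟪ x , ∅ ⟫ , q ⟫ ∈ J) ×
               (∀ z q → ⟪ ⟪ z , ∅ ⟫ , q ⟫ ∈ J → q ∈ w → z ≡ x)

    Child : (w i v : Carrier) → Set ℓ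
    Child w i v = v ≐ λ s → ∃ λ q → q ∈ w × ⟪ ⟪ i , s ⟫ , q ⟫ ∈ J

    Node : (d w x : Carrier) → Set ℓ
    Node d w x = ¬ ∅ ∈ w ×
      (∀ i → i ∈ K → ∃₂ λ v y → Child w i v × ⟪ v , y ⟫ ∈ d × y ∈ x) ×
      (∀ y → y ∈ x → ∃₂ λ i v → i ∈ K × Child w i v × ⟪ v , y ⟫ ∈ d)

    -- An approximation to the naming relation, as in proofs of the recursion theorem: every pair of
    -- `d` is justified by pairs of `d`.
    Good : Carrier → Set ℓ
    Good d = ∀ w x → ⟪ w , x ⟫ ∈ d → Atom w x ⊎ Node d w x

    Names : (w x : Carrier) → Set ℓ
    Names w x = ∃ λ d → Good d × ⟪ w , x ⟫ ∈ d

    -- The induction is on the named set, not on the name, which need not be well-founded. In a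
    -- minimal counterexample every element is named by a child, children at the same index are the
    -- same subset of `Y`, and so `d` and `d′` agree on what they name.
    good-unique : ∀ {d d′ w x x′} → Good d → Good d′ → ⟪ w , x ⟫ ∈ d → ⟪ w , x′ ⟫ ∈ d′ → x ≡ x′
    good-unique {d} {d′} g g′ h h′ = byContradiction λ x≢x′ → bad (minimal Badᶠ (field′ d) _ (fieldʳ h) (_ , _ , h , h′ , x≢x′))
      where
      Badᶠ : Form 1
      Badᶠ = ∃ᶠ (∃ᶠ (⟪ v1 , v2 ⟫ᵗ ∈ᶠ con d ∧ᶠ ⟪ v1 , v0 ⟫ᵗ ∈ᶠ con d′ ∧ᶠ ¬ᶠ (v2 ≡ᶠ v0)))
      Bad : Carrier → Set ℓ
      Bad x = ∃₂ λ w x′ → ⟪ w , x ⟫ ∈ d × ⟪ w , x′ ⟫ ∈ d′ × ¬ x ≡ x′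
      bad : (∃ λ m → m ∈ field′ d × Bad m × (∀ z → z ∈ field′ d → Bad z → ¬ z ∈ m)) → ⊥
      bad (m , _ , (w , m′ , h , h′ , m≢m′) , min) with g w m h | g′ w m′ h′
      ... | inj₁ (_ , _ , (q , q∈ , hq) , _) | inj₁ (_ , _ , _ , u) = m≢m′ (u m q hq q∈)
      ... | inj₁ (_ , ∅∈ , _) | inj₂ (∅∉ , _) = ∅∉ ∅∈
      ... | inj₂ (∅∉ , _) | inj₁ (_ , ∅∈ , _) = ∅∉ ∅∈
      ... | inj₂ (_ , c , r) | inj₂ (_ , c′ , r′) = m≢m′ (ext
          (λ y y∈ → let (i , v , i∈ , hc , hd) = r y y∈ ; (v′ , y′ , hc′ , hd′ , y′∈) = c′ i i∈ in
            subst (_∈ m′) (sym (same y∈ hd (subst (λ u → ⟪ u , y′ ⟫ ∈ d′) (≐-unique hc′ hc) hd′))) y′∈)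
          (λ y′ y′∈ → let (i , v′ , i∈ , hc′ , hd′) = r′ y′ y′∈ ; (v , y , hc , hd , y∈) = c i i∈ in
            subst (_∈ m) (same y∈ hd (subst (λ u → ⟪ u , y′ ⟫ ∈ d′) (≐-unique hc′ hc) hd′)) y∈))
        where
        same : ∀ {v y y′} → y ∈ m → ⟪ v , y ⟫ ∈ d → ⟪ v , y′ ⟫ ∈ d′ → y ≡ y′
        same y∈ hd hd′ = byContradiction λ ne → min _ (fieldʳ hd) (_ , _ , hd , hd′ , ne) y∈

    private
      image = replace (Namesᶠ v0 v1) (𝒫 Y)
        λ { w x x′ w∈ (d , g , h) (d′ , g′ , h′) → good-unique g g′ h h′ }

    abstract
      U : Carrier
      U = proj₁ image

      ∈-U : ∀ x → x ∈ U ⇔ (∃ λ w → w ∈ 𝒫 Y × Names w x)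
      ∈-U = proj₂ image

    named : ∀ {w x} → w ∈ 𝒫 Y → Names w x → x ∈ U
    named w∈ n = from (∈-U _) (_ , w∈ , n)

    abstract
      naming : Carrier
      naming = sep (∃ᶠ (∃ᶠ (v2 ≡ᶠ ⟪ v1 , v0 ⟫ᵗ ∧ᶠ Namesᶠ v1 v0))) (𝒫 Y ⊗ U)

      naming⊆ : ∀ p → p ∈ naming → p ∈ 𝒫 Y ⊗ U
      naming⊆ p p∈ = proj₁ (to (∈-sep _ _ p) p∈)

      ∈-naming : ∀ {w x} → ⟪ w , x ⟫ ∈ naming ⇔ (w ∈ 𝒫 Y × Names w x)
      ∈-naming {w} {x} = mk⇔ to′ λ (w∈ , n) → from (∈-sep _ _ _) (from ⟪⟫∈⊗ (w∈ , named w∈ n) , w , x , refl , n)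
        where
        to′ : ⟪ w , x ⟫ ∈ naming → w ∈ 𝒫 Y × Names w x
        to′ h with to (∈-sep _ _ _) h
        ... | h⊗ , w′ , x′ , e , n with ⟪⟫-inj e
        ... | refl , refl = proj₁ (to ⟪⟫∈⊗ h⊗) , n

    Child-∈ : ∀ {w i v} → Child w i v → v ∈ 𝒫 Y
    Child-∈ c = from (∈-𝒫 _) λ s s∈ → let (_ , _ , h) = to (c s) s∈ in
      proj₂ (to ⟪⟫∈⊗ (proj₁ (fun-type J-fun h)))

    -- The condition uses `d` only positively, so it survives enlargement, and pairs with a name in
    -- `𝒫 Y` suffice because children are subsets of `Y`. Hence a justified pair can be adjoined to
    -- a good relation, and the relation `naming`, which collects all of them, is good.
    node-mono : ∀ {d d′} → (∀ {v y} → v ∈ 𝒫 Y → ⟪ v , y ⟫ ∈ d → ⟪ v , y ⟫ ∈ d′) →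
                ∀ {w x} → Atom w x ⊎ Node d w x → Atom w x ⊎ Node d′ w x
    node-mono i (inj₁ a) = inj₁ a
    node-mono i (inj₂ (∅∉ , c , r)) = inj₂ (∅∉ ,
      (λ k k∈ → let (v , y , hc , h , y∈) = c k k∈ in v , y , hc , i (Child-∈ hc) h , y∈) ,
      (λ y y∈ → let (k , v , k∈ , hc , h) = r y y∈ in k , v , k∈ , hc , i (Child-∈ hc) h))

    good-extend : ∀ {d w x} → Good d → Atom w x ⊎ Node d w x → Good (d ◂ ⟪ w , x ⟫)
    good-extend g h w′ x′ p with to (∈-◂ _) p
    ... | inj₁ p′ = node-mono (λ _ → ◂ˡ) (g w′ x′ p′)
    ... | inj₂ e with ⟪⟫-inj e
    ... | refl , refl = node-mono (λ _ → ◂ˡ) h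

    naming-good : Good naming
    naming-good w x h = let (w∈ , d , g , hd) = to ∈-naming h in
      node-mono (λ v∈ hv → from ∈-naming (v∈ , d , g , hv)) (g w x hd)

    naming-fun : naming ∶ (λ w → ∃ λ x → ⟪ w , x ⟫ ∈ naming) ⟶ (_∈ U)
    naming-fun =
      (λ p p∈ → let (w , x , _ , x∈ , e) = to (∈-⊗ p) (naming⊆ p p∈) in
        w , x , ((x , subst (_∈ naming) e p∈) , x∈) , e) ,
      λ w (x , h) → x , h , λ x′ h′ → good-unique naming-good naming-good h′ h

    atoms : ∀ x → x ∈ Z → x ∈ U
    atoms x x∈ = named (from (∈-𝒫 w) (λ q q∈ → [ (λ { refl → ∅∈Y }) , (λ { refl → proj₂ (fun-type J-fun hq) }) ]′ (to (∈-pair q) q∈)))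
      (∅ ◂ ⟪ w , x ⟫ , good-extend (λ _ _ h → ⊥-elim (∉∅ _ h)) (inj₁ (x∈ , ∈-pairˡ , (q₀ , ∈-pairʳ , hq) , u)) , ◂ʳ)
      where
      q₀ = proj₁ (fun-value J-fun (from ⟪⟫∈⊗ (from (∈-∪ x) (inj₂ x∈) , ∅∈Y)))
      hq : ⟪ ⟪ x , ∅ ⟫ , q₀ ⟫ ∈ J
      hq = proj₂ (fun-value J-fun (from ⟪⟫∈⊗ (from (∈-∪ x) (inj₂ x∈) , ∅∈Y)))
      -- The member `∅` marks the name of an atom, and `q₀`, the sequence with the single label `x`,
      -- tells which atom.
      w = ｛ ∅ , q₀ ｝
      u : ∀ z q → ⟪ ⟪ z , ∅ ⟫ , q ⟫ ∈ J → q ∈ w → z ≡ x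
      u z q h q∈ with to (∈-pair q) q∈
      ... | inj₁ refl = ⊥-elim (J≢∅ h)
      ... | inj₂ refl = proj₁ (J-inj h hq)

    -- Choice selects in `c` one name for each object of `U`. Packing the selected names of the
    -- elements of `x` along the surjection `f` gives a name of `x`; no bound on the complexity of
    -- the elements is involved.
    module Join {x f : Carrier} (hf : f ∶ (_∈ K) ⟶ (_∈ x)) (onto : ∀ y → y ∈ x → ∃ λ i → ⟪ i , y ⟫ ∈ f)
                (x⊆U : ∀ y → y ∈ x → y ∈ U) where

      abstract
        c : Carrier
        c = proj₁ (section naming-fun)

        name : ∀ {y} → y ∈ x → ∃ λ v → (v ∈ c × ⟪ v , y ⟫ ∈ naming) × (∀ v′ → v′ ∈ c → ⟪ v′ , y ⟫ ∈ naming → v′ ≡ v)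
        name y∈ = let (v , v∈ , n) = to (∈-U _) (x⊆U _ y∈) in proj₂ (section naming-fun) (from ∈-naming (v∈ , n))

        w : Carrier
        w = sep (∃ᶠ (∃ᶠ (∃ᶠ (∃ᶠ (⟪ v3 , v1 ⟫ᵗ ∈ᶠ con f ∧ᶠ v0 ∈ᶠ con c ∧ᶠ ⟪ v0 , v1 ⟫ᵗ ∈ᶠ con naming ∧ᶠ
              v2 ∈ᶠ v0 ∧ᶠ ⟪ ⟪ v3 , v2 ⟫ᵗ , v4 ⟫ᵗ ∈ᶠ con J))))) Y

        ∈-w : ∀ q → q ∈ w ⇔ (q ∈ Y × ∃ λ i → ∃₂ λ s y → ∃ λ v → ⟪ i , y ⟫ ∈ f × v ∈ c × ⟪ v , y ⟫ ∈ naming ×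
                                     s ∈ v × ⟪ ⟪ i , s ⟫ , q ⟫ ∈ J)
        ∈-w = ∈-sep _ Y

      w∈ : w ∈ 𝒫 Y
      w∈ = from (∈-𝒫 w) λ q q∈ → proj₁ (to (∈-w q) q∈)

      ∅∉ : ¬ ∅ ∈ w
      ∅∉ h = let (_ , _ , _ , _ , _ , _ , _ , _ , _ , j) = to (∈-w ∅) h in J≢∅ j

      child : ∀ {i y v} → ⟪ i , y ⟫ ∈ f → v ∈ c × ⟪ v , y ⟫ ∈ naming → (∀ v′ → v′ ∈ c → ⟪ v′ , y ⟫ ∈ naming → v′ ≡ v) → Child w i v
      child {i} {y} {v} h (v∈c , hv) u s = mk⇔ to′ from′
        where
        to′ : s ∈ v → ∃ λ q → q ∈ w × ⟪ ⟪ i , s ⟫ , q ⟫ ∈ J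
        to′ s∈ = let s∈Y = to (∈-𝒫 v) (proj₁ (to ∈-naming hv)) s s∈
                     (q , hq) = fun-value J-fun (from ⟪⟫∈⊗ (from (∈-∪ i) (inj₁ (proj₁ (fun-type hf h))) , s∈Y))
                 in q , from (∈-w q) (proj₂ (fun-type J-fun hq) , i , s , y , v , h , v∈c , hv , s∈ , hq) , hq
        from′ : (∃ λ q → q ∈ w × ⟪ ⟪ i , s ⟫ , q ⟫ ∈ J) → s ∈ v
        from′ (q , q∈ , hq) with to (∈-w q) q∈
        ... | _ , i′ , s′ , y′ , v′ , h′ , v′∈ , hv′ , s∈ , hq′ with J-inj hq hq′
        ... | refl , refl with fun-unique hf h h′
        ... | refl = subst (s ∈_) (u v′ v′∈ hv′) s∈

      child′ : ∀ {i y} → ⟪ i , y ⟫ ∈ f → y ∈ x → ∃ λ v → Child w i v × ⟪ v , y ⟫ ∈ naming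
      child′ h y∈ = let (v , hv , u) = name y∈ in v , child h hv u , proj₂ hv

      node : Node naming w x
      node = ∅∉ ,
        (λ i i∈ → let (y , h) = fun-value hf i∈ ; y∈ = proj₂ (fun-type hf h) ; (v , hc , hv) = child′ h y∈ in
          v , y , hc , hv , y∈) ,
        (λ y y∈ → let (i , h) = onto y y∈ ; (v , hc , hv) = child′ h y∈ in i , v , proj₁ (fun-type hf h) , hc , hv)

      join : x ∈ U
      join = named w∈ (naming ◂ ⟪ w , x ⟫ , good-extend naming-good (inj₂ node) , ◂ʳ)

  abstract
    universe : ∀ Z K → ∃ λ U → (∀ x → x ∈ Z → x ∈ U) ×
      (∀ x f → (f ∶ (_∈ K) ⟶ (_∈ x)) → (∀ y → y ∈ x → ∃ λ i → ⟪ i , y ⟫ ∈ f) → (∀ y → y ∈ x → y ∈ U) → x ∈ U)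
    universe Z K = U , atoms , λ x f → Join.join
      where open Names Z K

  record Closed (κ Z U : Carrier) : Set ℓ where
    field
      base   : ∀ x → x ∈ Z → x ∈ U
      index  : ∀ x → x ∈ κ → x ∈ U
      nats   : ∀ x → IsNat x → x ∈ U
      pairs  : ∀ x y → x ∈ U → y ∈ U → ⟪ x , y ⟫ ∈ U
      κ-funs : ∀ f → (f ∶ (_∈ κ) ⟶ (_∈ U)) → f ∈ U
      n-funs : ∀ n f → IsNat n → (f ∶ (_∈ n) ⟶ (_∈ U)) → f ∈ U

  closedSet : ∀ κ Z → ∃ (Closed κ Z)
  closedSet κ Z = U , record
    { base   = λ x h → atom (from (∈-∪ x) (inj₁ h))
    ; index  = λ x h → atom (from (∈-∪ x) (inj₂ (from (∈-∪ x) (inj₁ h))))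
    ; nats   = λ x h → atom (from (∈-∪ x) (inj₂ (from (∈-∪ x) (inj₂ (from (∈-ω x) h)))))
    ; pairs  = opair
    ; κ-funs = λ f → funs κ f λ x h → from (∈-∪ x) (inj₁ h)
    ; n-funs = λ n f hn → funs n f λ x h → from (∈-∪ x) (inj₂ (from (∈-ω x) (nat-elem n hn x h)))
    }
    where
    -- One index set has to have as images the κ-sequences, the finite sequences and the unordered
    -- pairs.
    K = κ ∪ ω
    u = universe (Z ∪ K) K
    U = proj₁ u
    atom : ∀ {x} → x ∈ Z ∪ K → x ∈ U
    atom = proj₁ (proj₂ u) _
    pair : ∀ x y → x ∈ U → y ∈ U → ｛ x , y ｝ ∈ U
    pair x y x∈ y∈ = proj₂ (proj₂ u) _ f hf onto λ z z∈ → [ (λ { refl → x∈ }) , (λ { refl → y∈ }) ]′ (to (∈-pair z) z∈)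
      where
      φ : Form 3
      φ = (v1 ≡ᶠ con ∅ ∧ᶠ v0 ≡ᶠ con x) ∨ᶠ (¬ᶠ (v1 ≡ᶠ con ∅) ∧ᶠ v0 ≡ᶠ con y)
      val : ∀ i → i ∈ K → ∃ λ z → z ∈ ｛ x , y ｝ × ⟦ φ ⟧ (z ∷ i ∷ ∅ ∷ [])
      val i _ with em {i ≡ ∅}
      ... | yes e = x , ∈-pairˡ , inj₁ (e , refl)
      ... | no ¬e = y , ∈-pairʳ , inj₂ (¬e , refl)
      uniq : ∀ i z z′ → i ∈ K → ⟦ φ ⟧ (z ∷ i ∷ ∅ ∷ []) → ⟦ φ ⟧ (z′ ∷ i ∷ ∅ ∷ []) → z ≡ z′
      uniq i z z′ _ (inj₁ (_ , p)) (inj₁ (_ , q)) = trans p (sym q)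
      uniq i z z′ _ (inj₂ (_ , p)) (inj₂ (_ , q)) = trans p (sym q)
      uniq i z z′ _ (inj₁ (e , _)) (inj₂ (¬e , _)) = ⊥-elim (¬e e)
      uniq i z z′ _ (inj₂ (¬e , _)) (inj₁ (e , _)) = ⊥-elim (¬e e)
      F = mkFun φ (λ x y p → refl) K {_∈ ｛ x , y ｝} val uniq
      f = proj₁ F
      hf = proj₁ (proj₂ F)
      ∈K : ∀ {k} → IsNat k → k ∈ K
      ∈K hk = from (∈-∪ _) (inj₂ (from (∈-ω _) hk))
      onto : ∀ z → z ∈ ｛ x , y ｝ → ∃ λ i → ⟪ i , z ⟫ ∈ f
      onto z z∈ with to (∈-pair z) z∈
      ... | inj₁ refl = ∅ , from (proj₂ (proj₂ F) _ _) (∈K nat-∅ , inj₁ (refl , refl))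
      ... | inj₂ refl = S ∅ , from (proj₂ (proj₂ F) _ _) (∈K (nat-S nat-∅) , inj₂ ((λ e → ∅≢S (sym e)) , refl))
    opair : ∀ x y → x ∈ U → y ∈ U → ⟪ x , y ⟫ ∈ U
    opair x y x∈ y∈ = pair _ _ (pair x x x∈ x∈) (pair x y x∈ y∈)
    funs : ∀ a F → (∀ x → x ∈ a → x ∈ K) → (F ∶ (_∈ a) ⟶ (_∈ U)) → F ∈ U
    funs a F a⊆K hF with em {∃ λ p → p ∈ F}
    -- The empty function is not an image of the nonempty `K`, but it is among the atoms, as the
    -- natural number zero.
    ... | no empty = subst (_∈ U) (ext (λ z z∈ → ⊥-elim (∉∅ z z∈)) (λ z z∈ → ⊥-elim (empty (z , z∈))))
                       (atom (from (∈-∪ ∅) (inj₂ (from (∈-∪ ∅) (inj₂ (from (∈-ω ∅) nat-∅))))))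
    ... | yes (p₀ , p₀∈) = proj₂ (proj₂ u) F (proj₁ G) (proj₁ (proj₂ G)) onto F⊆U
      where
      -- Indices outside the domain go to some pair `p₀` of `F`, which makes `F` an image of all of
      -- `K`.
      φ : Form 3
      φ = (v1 ∈ᶠ con a ∧ᶠ v0 ∈ᶠ con F ∧ᶠ ∃ᶠ (v1 ≡ᶠ ⟪ v2 , v0 ⟫ᵗ)) ∨ᶠ (¬ᶠ (v1 ∈ᶠ con a) ∧ᶠ v0 ≡ᶠ con p₀)
      val : ∀ i → i ∈ K → ∃ λ z → z ∈ F × ⟦ φ ⟧ (z ∷ i ∷ ∅ ∷ [])
      val i _ with em {i ∈ a}
      ... | yes i∈ = let (y , h) = fun-value hF i∈ in ⟪ i , y ⟫ , h , inj₁ (i∈ , h , y , refl)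
      ... | no i∉  = p₀ , p₀∈ , inj₂ (i∉ , refl)
      uniq : ∀ i z z′ → i ∈ K → ⟦ φ ⟧ (z ∷ i ∷ ∅ ∷ []) → ⟦ φ ⟧ (z′ ∷ i ∷ ∅ ∷ []) → z ≡ z′
      uniq i z z′ _ (inj₁ (_ , h , y , refl)) (inj₁ (_ , h′ , y′ , refl)) = cong ⟪ i ,_⟫ (fun-unique hF h h′)
      uniq i z z′ _ (inj₂ (_ , p)) (inj₂ (_ , q)) = trans p (sym q)
      uniq i z z′ _ (inj₁ (e , _)) (inj₂ (¬e , _)) = ⊥-elim (¬e e)
      uniq i z z′ _ (inj₂ (¬e , _)) (inj₁ (e , _)) = ⊥-elim (¬e e)
      G = mkFun φ (λ x y p → refl) K {_∈ F} val uniq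
      F⊆U : ∀ p → p ∈ F → p ∈ U
      F⊆U p p∈ with proj₁ hF p p∈
      ... | i , y , (i∈ , y∈) , refl = opair i y (atom (from (∈-∪ i) (inj₂ (a⊆K i i∈)))) y∈
      onto : ∀ p → p ∈ F → ∃ λ i → ⟪ i , p ⟫ ∈ proj₁ G
      onto p p∈ with proj₁ hF p p∈
      ... | i , y , (i∈ , y∈) , refl = i , from (proj₂ (proj₂ G) _ _) (a⊆K i i∈ , inj₁ (i∈ , p∈ , y , refl))

-- Codes, their interpretations, and cylinders

module Codes {ℓ} (em : ExcludedMiddle ℓ) (M : ZFCModel ℓ) (κ X 𝓛 : ZFCModel.Carrier M)
             (rel : InModel.IsRelationalLanguage M 𝓛) where
  open ZFCModel M
  open InModel M
  open SetTheory em M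
  open Universes em M
  open Structures κ X 𝓛

  arity-nat : ∀ {R n} → ⟪ R , n ⟫ ∈ 𝓛 → IsNat n
  arity-nat h = proj₂ (fun-type (proj₂ rel) h)

  abstract
    U : Carrier
    U = proj₁ (closedSet κ (field′ 𝓛 ∪ X))

    U-closed : Closed κ (field′ 𝓛 ∪ X) U
    U-closed = proj₂ (closedSet κ (field′ 𝓛 ∪ X))

  open Closed U-closed

  symbol∈U : ∀ {R n} → ⟪ R , n ⟫ ∈ 𝓛 → R ∈ U
  symbol∈U h = base _ (from (∈-∪ _) (inj₁ (fieldˡ h)))

  point∈U : ∀ {x} → x ∈ X → x ∈ U
  point∈U h = base _ (from (∈-∪ _) (inj₂ h))

  IsFact : Carrier → Pred Carrier ℓ
  IsFact Z p = ∃₂ λ R n → ∃ λ t → ⟪ R , n ⟫ ∈ 𝓛 × (t ∶ (_∈ n) ⟶ (_∈ Z)) × p ≡ ⟪ R , t ⟫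

  IsFact-mono : ∀ {Z Z′ p} → (∀ x → x ∈ Z → x ∈ Z′) → IsFact Z p → IsFact Z′ p
  IsFact-mono s (R , n , t , h , ht , e) = R , n , t , h , fun-weaken ht (s _) , e

  fact∈U : ∀ {p} → IsFact X p → p ∈ U
  fact∈U (R , n , t , h , ht , refl) =
    pairs R t (symbol∈U h) (n-funs n t (arity-nat h) (fun-weaken ht point∈U))

  factᶠ : ∀ {n} → Term n → Term n → Form n
  factᶠ z p = ∃ᶠ (∃ᶠ (∃ᶠ (⟪ v2 , v1 ⟫ᵗ ∈ᶠ con 𝓛 ∧ᶠ funᶠ v0 v1 (wk (wk (wk z))) ∧ᶠ wk (wk (wk p)) ≡ᶠ ⟪ v2 , v0 ⟫ᵗ)))

  abstract
    facts : Carrier → Carrier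
    facts Z = sep (factᶠ (con Z) v0) U

    ∈-facts : ∀ {Z} → (∀ x → x ∈ Z → x ∈ X) → facts Z ≐ IsFact Z
    ∈-facts Z⊆X p = mk⇔ (λ h → proj₂ (to (∈-sep _ _ p) h))
                        (λ h → from (∈-sep _ _ p) (fact∈U (IsFact-mono Z⊆X h) , h))

  Str : Carrier
  Str = 𝒫 (facts X)

  ∈-Str : Str ≐ IsStructure
  ∈-Str N = mk⇔ (λ h p p∈ → to (∈-facts (λ _ x∈ → x∈) p) (to (∈-𝒫 N) h p p∈))
                (λ h → from (∈-𝒫 N) λ p p∈ → from (∈-facts (λ _ x∈ → x∈) p) (h p p∈))

  structures : ∀ {A} → IsSetOfStructures A → A ∈ 𝒫 Str
  structures h = from (∈-𝒫 _) λ N N∈ → from (∈-Str N) (h N N∈)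

  𝒫Str : ∀ {A} → A ∈ 𝒫 Str → IsSetOfStructures A
  𝒫Str h N N∈ = to (∈-Str N) (to (∈-𝒫 _) h N N∈)

  literal∈U : ∀ {m l} → IsNat m → IsLiteral m l → l ∈ U
  literal∈U hm (k , α , hk , inj₁ (i , j , i∈ , j∈ , refl) , refl) =
    pairs _ _ (nats k hk) (pairs _ _ (nats ∅ nat-∅)
      (pairs _ _ (nats i (nat-elem _ hm i i∈)) (nats j (nat-elem _ hm j j∈))))
  literal∈U hm (k , α , hk , inj₂ (R , n , s , h , hs , refl) , refl) =
    pairs _ _ (nats k hk) (pairs _ _ (nats (S ∅) (nat-S nat-∅)) (pairs _ _ (symbol∈U h)
      (n-funs n s (arity-nat h) (fun-weaken hs λ y∈ → nats _ (nat-elem _ hm _ y∈)))))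

  basic∈U : ∀ {m φ a} → IsNat m → IsConjunction m φ → (a ∶ (_∈ m) ⟶ (_∈ X)) → basic φ a ∈ U
  basic∈U hm (n , hn , hφ) ha = pairs _ _ (nats ∅ nat-∅) (pairs _ _
    (n-funs n _ hn (fun-weaken hφ (literal∈U hm)))
    (n-funs _ _ hm (fun-weaken ha point∈U)))

  tag₁ : IsNat (S ∅)
  tag₁ = nat-S nat-∅
  tag₂ : IsNat (S (S ∅))
  tag₂ = nat-S tag₁
  tag₃ : IsNat (S (S (S ∅)))
  tag₃ = nat-S tag₂

  U-codes : IsClosedUnderCodes X U
  U-codes = record
    { basics    = λ { γ (m , φ , a , hm , hφ , ha , refl) → basic∈U hm hφ ha }
    ; negations = λ γ γ∈ → pairs _ _ (nats _ tag₁) γ∈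
    ; joins     = λ Γ hΓ → pairs _ _ (nats _ tag₂) (κ-funs Γ hΓ)
    ; meets     = λ Γ hΓ → pairs _ _ (nats _ tag₃) (κ-funs Γ hΓ)
    }

  basic≢neg : ∀ {φ a γ} → basic φ a ≢ neg γ
  basic≢neg e = ∅≢S (proj₁ (⟪⟫-inj e))
  basic≢⋁ : ∀ {φ a Γ} → basic φ a ≢ ⋁ Γ
  basic≢⋁ e = ∅≢S (proj₁ (⟪⟫-inj e))
  basic≢⋀ : ∀ {φ a Γ} → basic φ a ≢ ⋀ Γ
  basic≢⋀ e = ∅≢S (proj₁ (⟪⟫-inj e))
  neg≢⋁ : ∀ {γ Γ} → neg γ ≢ ⋁ Γ
  neg≢⋁ e = ∅≢S (S-inj (proj₁ (⟪⟫-inj e)))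
  neg≢⋀ : ∀ {γ Γ} → neg γ ≢ ⋀ Γ
  neg≢⋀ e = ∅≢S (S-inj (proj₁ (⟪⟫-inj e)))
  ⋁≢⋀ : ∀ {Γ Γ′} → ⋁ Γ ≢ ⋀ Γ′
  ⋁≢⋀ e = ∅≢S (S-inj (S-inj (proj₁ (⟪⟫-inj e))))

  -- The claim to be proved is that codes in `C` are interpreted as members of `D`. That an
  -- immediate part of the code lies in `C` is left as a hypothesis, so that each application
  -- supplies its own inversion of `C`.
  record InterpretationStep (C D : Carrier) : Set ℓ where
    field
      basics    : ∀ m φ a A → IsNat m → IsConjunction m φ → (a ∶ (_∈ m) ⟶ (_∈ X)) → basic φ a ∈ C →
                  (A ≐ λ N → IsStructure N × ConjunctionHolds N a φ) → A ∈ D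
      negations : ∀ γ A B → neg γ ∈ C → IsSetOfStructures A → (γ ∈ C → A ∈ D) →
                  (B ≐ λ N → IsStructure N × ¬ N ∈ A) → B ∈ D
      joins     : ∀ Γ 𝒜 V → (Γ ∶ (_∈ κ) ⟶ (_∈ U)) → (𝒜 ∶ (_∈ κ) ⟶ IsSetOfStructures) → ⋁ Γ ∈ C →
                  (∀ i γ A → ⟪ i , γ ⟫ ∈ Γ → ⟪ i , A ⟫ ∈ 𝒜 → γ ∈ C → A ∈ D) →
                  (V ≐ λ N → ∃₂ λ i A → ⟪ i , A ⟫ ∈ 𝒜 × N ∈ A) → V ∈ D
      meets     : ∀ Γ 𝒜 V → (Γ ∶ (_∈ κ) ⟶ (_∈ U)) → (𝒜 ∶ (_∈ κ) ⟶ IsSetOfStructures) → ⋀ Γ ∈ C →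
                  (∀ i γ A → ⟪ i , γ ⟫ ∈ Γ → ⟪ i , A ⟫ ∈ 𝒜 → γ ∈ C → A ∈ D) →
                  (V ≐ λ N → IsStructure N × (∀ i A → ⟪ i , A ⟫ ∈ 𝒜 → N ∈ A)) → V ∈ D

  module _ {C D : Carrier} (step : InterpretationStep C D) where
    private
      module Step = InterpretationStep step

      abstract
        E : Carrier
        -- `InterpretedAs` quantifies over sets, so the implication has to be cut out of a set: `U`
        -- contains all codes over `X`, and `𝒫 Str` all their interpretations.
        E = sep (∃ᶠ (∃ᶠ (v2 ≡ᶠ ⟪ v1 , v0 ⟫ᵗ ∧ᶠ (v1 ∈ᶠ con C ⇒ᶠ v0 ∈ᶠ con D)))) (U ⊗ 𝒫 Str)

        ∈-E : ∀ {γ A} → ⟪ γ , A ⟫ ∈ E ⇔ (γ ∈ U × A ∈ 𝒫 Str × (γ ∈ C → A ∈ D))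
        ∈-E {γ} {A} = mk⇔ to′ λ (γ∈ , A∈ , h) → from (∈-sep _ _ _) (from ⟪⟫∈⊗ (γ∈ , A∈) , γ , A , refl , h)
          where
          to′ : ⟪ γ , A ⟫ ∈ E → γ ∈ U × A ∈ 𝒫 Str × (γ ∈ C → A ∈ D)
          to′ h with to (∈-sep _ _ _) h
          ... | h⊗ , γ′ , A′ , e , p with ⟪⟫-inj e
          ... | refl , refl = proj₁ (to ⟪⟫∈⊗ h⊗) , proj₂ (to ⟪⟫∈⊗ h⊗) , p

      in-E : ∀ {Γ 𝒜} → (𝒜 ∶ (_∈ κ) ⟶ IsSetOfStructures) →
             (∀ i γ A → ⟪ i , γ ⟫ ∈ Γ → ⟪ i , A ⟫ ∈ 𝒜 → ⟪ γ , A ⟫ ∈ E) →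
             (∀ i γ A → ⟪ i , γ ⟫ ∈ Γ → ⟪ i , A ⟫ ∈ 𝒜 → γ ∈ C → A ∈ D)
      in-E h𝒜 h i γ A hγ hA = proj₂ (proj₂ (to ∈-E (h i γ A hγ hA)))

      codes-in-U : ∀ {Γ} → (Γ ∶ (_∈ κ) ⟶ IsCode X) → Γ ∶ (_∈ κ) ⟶ (_∈ U)
      codes-in-U hΓ = fun-weaken hΓ λ y∈ → y∈ U U-codes

      E-closed : IsClosedUnderInterpretation E
      E-closed = record
        { basics    = λ m φ a A hm hφ ha hA → from ∈-E (basic∈U hm hφ ha ,
            structures (λ N N∈ → proj₁ (to (hA N) N∈)) , λ c → Step.basics m φ a A hm hφ ha c hA)
        ; negations = λ γ A B h hB → let (γ∈ , A∈ , p) = to ∈-E h in from ∈-E (pairs _ _ (nats _ tag₁) γ∈ ,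
            structures (λ N N∈ → proj₁ (to (hB N) N∈)) , λ c → Step.negations γ A B c (𝒫Str A∈) p hB)
        ; joins     = λ Γ 𝒜 V hΓ h𝒜 h hV → from ∈-E (pairs _ _ (nats _ tag₂) (κ-funs Γ (codes-in-U hΓ)) ,
            structures (λ N N∈ → let (_ , A , hA , N∈A) = to (hV N) N∈ in proj₂ (fun-type h𝒜 hA) N N∈A) ,
            λ c → Step.joins Γ 𝒜 V (codes-in-U hΓ) h𝒜 c (in-E h𝒜 h) hV)
        ; meets     = λ Γ 𝒜 V hΓ h𝒜 h hV → from ∈-E (pairs _ _ (nats _ tag₃) (κ-funs Γ (codes-in-U hΓ)) ,
            structures (λ N N∈ → proj₁ (to (hV N) N∈)) ,
            λ c → Step.meets Γ 𝒜 V (codes-in-U hΓ) h𝒜 c (in-E h𝒜 h) hV)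
        }

    interpretation-induction : ∀ {γ A} → γ ∈ C → γ InterpretedAs A → A ∈ D
    interpretation-induction c h = proj₂ (proj₂ (to ∈-E (h E E-closed))) c

  -- The induction on codes also shows that a basic code has only one interpretation,
  -- by taking for C the singleton of that code.
  basic-interpretation-unique : ∀ {φ a A B} → (B ≐ λ N → IsStructure N × ConjunctionHolds N a φ) →
                                basic φ a InterpretedAs A → A ≡ B
  basic-interpretation-unique {φ} {a} {A} {B} hB h = ∈-singleton (interpretation-induction
    {C = ｛ basic φ a , basic φ a ｝} {D = ｛ B , B ｝} (record
      { basics    = bas
      ; negations = λ γ A B c _ _ _ → ⊥-elim (basic≢neg (sym (∈-singleton c)))
      ; joins     = λ Γ 𝒜 V _ _ c _ _ → ⊥-elim (basic≢⋁ (sym (∈-singleton c)))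
      ; meets     = λ Γ 𝒜 V _ _ c _ _ → ⊥-elim (basic≢⋀ (sym (∈-singleton c)))
      }) ∈-pairˡ h)
    where
    bas : ∀ m φ′ a′ A → IsNat m → IsConjunction m φ′ → (a′ ∶ (_∈ m) ⟶ (_∈ X)) →
          basic φ′ a′ ∈ ｛ basic φ a , basic φ a ｝ →
          (A ≐ λ N → IsStructure N × ConjunctionHolds N a′ φ′) → A ∈ ｛ B , B ｝
    bas m φ′ a′ A _ _ _ c hA with ⟪⟫-inj (proj₂ (⟪⟫-inj (∈-singleton c)))
    ... | refl , refl with ≐-unique hA hB
    ... | refl = ∈-pairˡ

  compositeᶠ : ∀ {n} → Term n → Term n → Term n → Form n
  compositeᶠ h g f = ∀ᶠ (v0 ∈ᶠ wk h ⇔ᶠ ∃ᶠ (∃ᶠ (∃ᶠ (⟪ v2 , v1 ⟫ᵗ ∈ᶠ wk⁴ f ∧ᶠ ⟪ v1 , v0 ⟫ᵗ ∈ᶠ wk⁴ g ∧ᶠ v3 ≡ᶠ ⟪ v2 , v0 ⟫ᵗ))))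
    where
    wk⁴ : ∀ {n} → Term n → Term (1+ 1+ 1+ 1+ n)
    wk⁴ t = wk (wk (wk (wk t)))

  private
    wk³ : ∀ {n} → Term n → Term (1+ 1+ 1+ n)
    wk³ t = wk (wk (wk t))

  atomicᶠ literalᶠ : ∀ {n} → (N a α : Term n) → Form n
  atomicᶠ N a α =
    ∃ᶠ (∃ᶠ (∃ᶠ (⟪ v2 , v0 ⟫ᵗ ∈ᶠ wk³ a ∧ᶠ ⟪ v1 , v0 ⟫ᵗ ∈ᶠ wk³ a ∧ᶠ wk³ α ≡ᶠ ⟪ con ∅ , ⟪ v2 , v1 ⟫ᵗ ⟫ᵗ))) ∨ᶠ
    ∃ᶠ (∃ᶠ (∃ᶠ (compositeᶠ v0 (wk³ a) v1 ∧ᶠ ⟪ v2 , v0 ⟫ᵗ ∈ᶠ wk³ N ∧ᶠ wk³ α ≡ᶠ ⟪ Sᵗ (con ∅) , ⟪ v2 , v1 ⟫ᵗ ⟫ᵗ)))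
  literalᶠ N a l = ∃ᶠ (∃ᶠ (wk (wk l) ≡ᶠ ⟪ v1 , v0 ⟫ᵗ ∧ᶠ
    ((evenᶠ v1 ∧ᶠ atomicᶠ (wk (wk N)) (wk (wk a)) v0) ∨ᶠ (¬ᶠ (evenᶠ v1) ∧ᶠ ¬ᶠ (atomicᶠ (wk (wk N)) (wk (wk a)) v0)))))

  relation-holds : ∀ {N a R s t} → IsComposite t a s →
                   AtomicHolds N a ⟪ S ∅ , ⟪ R , s ⟫ ⟫ ⇔ ⟪ R , t ⟫ ∈ N
  relation-holds {N} {a} {R} {s} {t} ct = mk⇔ to′ λ h → inj₂ (R , s , t , ct , h , refl)
    where
    to′ : AtomicHolds N a ⟪ S ∅ , ⟪ R , s ⟫ ⟫ → ⟪ R , t ⟫ ∈ N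
    to′ (inj₁ (_ , _ , _ , _ , _ , e)) = ⊥-elim (∅≢S (sym (proj₁ (⟪⟫-inj e))))
    to′ (inj₂ (_ , _ , _ , ct′ , h , e)) with ⟪⟫-inj (proj₂ (⟪⟫-inj e))
    ... | refl , refl with ≐-unique ct′ ct
    ... | refl = h

  even-holds : ∀ {N a k α} → IsEven k → LiteralHolds N a ⟪ k , α ⟫ ⇔ AtomicHolds N a α
  even-holds {N} {a} {k} {α} ev = mk⇔ to′ λ h → k , α , refl , inj₁ (ev , h)
    where
    to′ : LiteralHolds N a ⟪ k , α ⟫ → AtomicHolds N a α
    to′ (_ , _ , e , h) with ⟪⟫-inj e
    to′ (_ , _ , e , inj₁ (_ , h))  | refl , refl = h
    to′ (_ , _ , e , inj₂ (¬ev , _)) | refl , refl = ⊥-elim (¬ev ev)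

  odd-holds : ∀ {N a k α} → ¬ IsEven k → LiteralHolds N a ⟪ k , α ⟫ ⇔ (¬ AtomicHolds N a α)
  odd-holds {N} {a} {k} {α} ¬ev = mk⇔ to′ λ h → k , α , refl , inj₂ (¬ev , h)
    where
    to′ : LiteralHolds N a ⟪ k , α ⟫ → ¬ AtomicHolds N a α
    to′ (_ , _ , e , h) with ⟪⟫-inj e
    to′ (_ , _ , e , inj₁ (ev , _)) | refl , refl = ⊥-elim (¬ev ev)
    to′ (_ , _ , e , inj₂ (_ , h))  | refl , refl = h

  -- The set `Z` enters only through `fact`: a code over `Z` can inspect a structure only by asking
  -- for single facts over `Z`.
  record IsAlgebra (Z D : Carrier) : Set ℓ where
    field
      str   : Str ∈ D
      compl : ∀ A → A ∈ D → Str ∖ A ∈ D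
      inter : ∀ A B → A ∈ D → B ∈ D → A ∩ B ∈ D
      union : ∀ 𝒜 V → (𝒜 ∶ (_∈ κ) ⟶ (_∈ D)) → (V ≐ λ N → ∃₂ λ i A → ⟪ i , A ⟫ ∈ 𝒜 × N ∈ A) → V ∈ D
      fact  : ∀ p → IsFact Z p → ∃ λ A → A ∈ D × (A ≐ λ N → IsStructure N × p ∈ N)

  module _ {Z D : Carrier} (alg : IsAlgebra Z D) where
    open IsAlgebra alg

    complement∈ : ∀ {A B} → A ∈ D → (B ≐ λ N → IsStructure N × ¬ N ∈ A) → B ∈ D
    complement∈ {A} A∈ hB = subst (_∈ D) (ext
      (λ N N∈ → let (h , h′) = to (∈-∖ N) N∈ in from (hB N) (to (∈-Str N) h , h′))
      (λ N N∈ → let (h , h′) = to (hB N) N∈ in from (∈-∖ N) (from (∈-Str N) h , h′))) (compl A A∈)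

    -- Meant for equalities between variables, which the tuple decides independently of the
    -- structure.
    constant∈ : (P : Set ℓ) → ∃ λ A → A ∈ D × (A ≐ λ N → IsStructure N × P)
    constant∈ P with em {P}
    ... | yes p = Str , str , λ N → mk⇔ (λ h → to (∈-Str N) h , p) (λ h → from (∈-Str N) (proj₁ h))
    ... | no ¬p = Str ∖ Str , compl Str str , λ N → mk⇔
      (λ h → let (a , b) = to (∈-∖ N) h in ⊥-elim (b a)) (λ h → ⊥-elim (¬p (proj₂ h)))

    atomic∈ : ∀ {m a α} → (a ∶ (_∈ m) ⟶ (_∈ Z)) → IsAtomic m α →
              ∃ λ A → A ∈ D × (A ≐ λ N → IsStructure N × AtomicHolds N a α)
    atomic∈ {m} {a} ha (inj₁ (i , j , i∈ , j∈ , refl)) =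
      let (A , A∈ , hA) = constant∈ (∃ λ x → ⟪ i , x ⟫ ∈ a × ⟪ j , x ⟫ ∈ a)
      in A , A∈ , λ N → mk⇔
        (λ h → let (hN , x , hi , hj) = to (hA N) h in hN , inj₁ (i , j , x , hi , hj , refl))
        (λ (hN , h) → from (hA N) (hN , eq h))
      where
      eq : ∀ {N} → AtomicHolds N a ⟪ ∅ , ⟪ i , j ⟫ ⟫ → ∃ λ x → ⟪ i , x ⟫ ∈ a × ⟪ j , x ⟫ ∈ a
      eq (inj₂ (_ , _ , _ , _ , _ , e)) = ⊥-elim (∅≢S (proj₁ (⟪⟫-inj e)))
      eq (inj₁ (_ , _ , x , hi , hj , e)) with ⟪⟫-inj (proj₂ (⟪⟫-inj e))
      ... | refl , refl = x , hi , hj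
    atomic∈ {m} {a} ha (inj₂ (R , n , s , hR , hs , refl)) =
      let ct = ⊙-isComposite a s
          (A , A∈ , hA) = fact ⟪ R , a ⊙ s ⟫ (R , n , a ⊙ s , hR , composite-fun ct hs ha , refl)
      in A , A∈ , λ N → mk⇔
        (λ h → proj₁ (to (hA N) h) , from (relation-holds ct) (proj₂ (to (hA N) h)))
        (λ (hN , h) → from (hA N) (hN , to (relation-holds ct) h))

    literal∈ : ∀ {m a l} → (a ∶ (_∈ m) ⟶ (_∈ Z)) → IsLiteral m l →
               ∃ λ A → A ∈ D × (A ≐ λ N → IsStructure N × LiteralHolds N a l)
    literal∈ {a = a} ha (k , α , _ , hα , refl) with atomic∈ ha hα | em {IsEven k}
    ... | A , A∈ , hA | yes ev = A , A∈ , λ N → mk⇔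
      (λ h → proj₁ (to (hA N) h) , from (even-holds ev) (proj₂ (to (hA N) h)))
      (λ (hN , h) → from (hA N) (hN , to (even-holds ev) h))
    ... | A , A∈ , hA | no ¬ev = Str ∖ A , compl A A∈ , λ N → mk⇔
      (λ h → let (N∈ , N∉) = to (∈-∖ N) h ; hN = to (∈-Str N) N∈ in
        hN , from (odd-holds ¬ev) λ h′ → N∉ (from (hA N) (hN , h′)))
      (λ (hN , h) → from (∈-∖ N) (from (∈-Str N) hN , λ N∈ → to (odd-holds ¬ev) h (proj₂ (to (hA N) N∈))))

    conjunction∈ : ∀ {m φ a A} → (a ∶ (_∈ m) ⟶ (_∈ Z)) → IsConjunction m φ →
                   (A ≐ λ N → IsStructure N × ConjunctionHolds N a φ) → A ∈ D
    conjunction∈ {m} {φ} {a} {A} ha (n , hn , hφ) hA =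
      let (B , B∈ , hB) = natInd Partialᶠ zero′ suc′ n hn in
      subst (_∈ D) (ext
        (λ N N∈ → let (hN , h) = to (hB N) N∈ in
          from (hA N) (to (∈-Str N) hN , λ i l hl → h i l (proj₁ (fun-type hφ hl)) hl))
        (λ N N∈ → let (hN , h) = to (hA N) N∈ in from (hB N) (from (∈-Str N) hN , λ i l _ → h i l))) B∈
      where
      Partialᶠ : Form 1
      Partialᶠ = ∃ᶠ (v0 ∈ᶠ con D ∧ᶠ ∀ᶠ (v0 ∈ᶠ v1 ⇔ᶠ (v0 ∈ᶠ con Str ∧ᶠ
        ∀ᶠ (∀ᶠ (v1 ∈ᶠ v4 ⇒ᶠ ⟪ v1 , v0 ⟫ᵗ ∈ᶠ con φ ⇒ᶠ literalᶠ v2 (con a) v0)))))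
      Partial : Carrier → Set ℓ
      Partial k = ∃ λ B → B ∈ D × (B ≐ λ N → N ∈ Str × (∀ i l → i ∈ k → ⟪ i , l ⟫ ∈ φ → LiteralHolds N a l))
      zero′ : Partial ∅
      zero′ = Str , str , λ N → mk⇔ (λ h → h , λ i l i∈ → ⊥-elim (∉∅ i i∈)) proj₁
      suc′ : ∀ k → IsNat k → Partial k → Partial (S k)
      suc′ k _ (B , B∈ , hB) with em {∃ λ l → ⟪ k , l ⟫ ∈ φ}
      -- The induction runs through all natural numbers, so `k` may be past the end of `φ`; then
      -- there is no further literal to impose.
      ... | no none = B , B∈ , λ N → mk⇔
        (λ h → let (hN , p) = to (hB N) h in hN , λ i l i∈ hl →
          [ (λ i∈k → p i l i∈k hl) , (λ { refl → ⊥-elim (none (l , hl)) }) ]′ (to (∈-S k i) i∈))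
        (λ (hN , p) → from (hB N) (hN , λ i l i∈ → p i l (∈-Sˡ i∈)))
      ... | yes (l₀ , hl₀) with literal∈ ha (proj₂ (fun-type hφ hl₀))
      ... | C , C∈ , hC = B ∩ C , inter B C B∈ C∈ , λ N → mk⇔
        (λ h → let (N∈B , N∈C) = to (∈-∩ N) h ; (hN , p) = to (hB N) N∈B in hN , λ i l i∈ hl →
          [ (λ i∈k → p i l i∈k hl)
          , (λ { refl → subst (LiteralHolds N a) (fun-unique hφ hl₀ hl) (proj₂ (to (hC N) N∈C)) }) ]′ (to (∈-S k i) i∈))
        (λ (hN , p) → from (∈-∩ N) (from (hB N) (hN , λ i l i∈ → p i l (∈-Sˡ i∈)) ,
          from (hC N) (to (∈-Str N) hN , p k l₀ ∈-Sʳ hl₀)))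

  module _ (Z : Carrier) (Z⊆X : ∀ x → x ∈ Z → x ∈ X) where
    private
      -- Weaker than being a basic code over `Z`, since nothing is asked of `φ`. An induction along
      -- the interpretation supplies the other conditions, and the support of the tuple is all that
      -- must be read off the code.
      Supported : Pred Carrier ℓ
      Supported γ = ∃₂ λ φ a → γ ≡ basic φ a × (∀ k x → ⟪ k , x ⟫ ∈ a → x ∈ Z)

      CodeClosed : Pred Carrier ℓ
      CodeClosed T = (∀ γ → γ ∈ U → Supported γ → γ ∈ T) × (∀ γ → γ ∈ T → neg γ ∈ T) ×
                    (∀ Γ → (Γ ∶ (_∈ κ) ⟶ (_∈ T)) → ⋁ Γ ∈ T × ⋀ Γ ∈ T)

      Supportedᶠ : ∀ {n} → Term n → Form n
      Supportedᶠ γ = ∃ᶠ (∃ᶠ (wk (wk γ) ≡ᶠ ⟪ con ∅ , ⟪ v1 , v0 ⟫ᵗ ⟫ᵗ ∧ᶠ ∀ᶠ (∀ᶠ (⟪ v1 , v0 ⟫ᵗ ∈ᶠ v2 ⇒ᶠ v0 ∈ᶠ con Z))))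

      CodeClosedᶠ : ∀ {n} → Term n → Form n
      CodeClosedᶠ T = ∀ᶠ (v0 ∈ᶠ con U ⇒ᶠ Supportedᶠ v0 ⇒ᶠ v0 ∈ᶠ wk T) ∧ᶠ
        ∀ᶠ (v0 ∈ᶠ wk T ⇒ᶠ ⟪ Sᵗ (con ∅) , v0 ⟫ᵗ ∈ᶠ wk T) ∧ᶠ
        ∀ᶠ (funᶠ v0 (con κ) (wk T) ⇒ᶠ (⟪ Sᵗ (Sᵗ (con ∅)) , v0 ⟫ᵗ ∈ᶠ wk T ∧ᶠ ⟪ Sᵗ (Sᵗ (Sᵗ (con ∅))) , v0 ⟫ᵗ ∈ᶠ wk T))

      abstract
        C : Carrier
        C = sep (∀ᶠ (CodeClosedᶠ v0 ⇒ᶠ v1 ∈ᶠ v0)) U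

        ∈-C : ∀ γ → γ ∈ C ⇔ (γ ∈ U × (∀ T → CodeClosed T → γ ∈ T))
        ∈-C = ∈-sep _ U

      C-least : ∀ {γ T} → γ ∈ C → CodeClosed T → γ ∈ T
      C-least h i = proj₂ (to (∈-C _) h) _ i

      C-fun : ∀ {Γ T} → CodeClosed T → (Γ ∶ (_∈ κ) ⟶ (_∈ C)) → Γ ∶ (_∈ κ) ⟶ (_∈ T)
      C-fun i hΓ = fun-weaken hΓ λ y∈ → C-least y∈ i

      C⊆U : ∀ {γ} → γ ∈ C → γ ∈ U
      C⊆U h = proj₁ (to (∈-C _) h)

      C-closed : CodeClosed C
      C-closed =
        (λ γ γ∈ h → from (∈-C γ) (γ∈ , λ T i → proj₁ i γ γ∈ h)) ,
        (λ γ γ∈ → from (∈-C _) (pairs _ _ (nats _ tag₁) (C⊆U γ∈) , λ T i → proj₁ (proj₂ i) γ (C-least γ∈ i))) ,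
        (λ Γ hΓ → let hU = κ-funs Γ (fun-weaken hΓ C⊆U) in
          from (∈-C _) (pairs _ _ (nats _ tag₂) hU , λ T i → proj₁ (proj₂ (proj₂ i) Γ (C-fun i hΓ))) ,
          from (∈-C _) (pairs _ _ (nats _ tag₃) hU , λ T i → proj₂ (proj₂ (proj₂ i) Γ (C-fun i hΓ))))

      IsCode⇒∈C : ∀ {γ} → IsCode Z γ → γ ∈ C
      IsCode⇒∈C h = h C (record
        { basics    = λ { γ (m , φ , a , hm , hφ , ha , refl) → proj₁ C-closed _
            (basic∈U hm hφ (fun-weaken ha (Z⊆X _)))
            (φ , a , refl , λ k x h → proj₂ (fun-type ha h)) }
        ; negations = proj₁ (proj₂ C-closed)
        ; joins     = λ Γ hΓ → proj₁ (proj₂ (proj₂ C-closed) Γ hΓ)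
        ; meets     = λ Γ hΓ → proj₂ (proj₂ (proj₂ C-closed) Γ hΓ)
        })

      data Generated (δ : Carrier) : Set ℓ where
        supported : Supported δ → Generated δ
        negation  : ∀ γ → γ ∈ C → δ ≡ neg γ → Generated δ
        join      : ∀ Γ → (Γ ∶ (_∈ κ) ⟶ (_∈ C)) → δ ≡ ⋁ Γ → Generated δ
        meet      : ∀ Γ → (Γ ∶ (_∈ κ) ⟶ (_∈ C)) → δ ≡ ⋀ Γ → Generated δ

      -- A code not generated in any of these ways could be removed from C.
      C-generated : ∀ {δ} → δ ∈ C → Generated δ
      C-generated {δ} δ∈ = byContradiction λ ¬g →
        proj₂ (to (∈-∖ δ) (C-least δ∈
          ( (λ γ γ∈ h → keep (proj₁ C-closed γ γ∈ h) λ e → ¬g (supported (subst Supported e h)))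
          , (λ γ γ∈ → keep (proj₁ (proj₂ C-closed) γ (old γ∈)) λ e → ¬g (negation γ (old γ∈) (sym e)))
          , (λ Γ hΓ → let hΓ′ = fun-weaken hΓ old in
              keep (proj₁ (proj₂ (proj₂ C-closed) Γ hΓ′)) (λ e → ¬g (join Γ hΓ′ (sym e))) ,
              keep (proj₂ (proj₂ (proj₂ C-closed) Γ hΓ′)) (λ e → ¬g (meet Γ hΓ′ (sym e))))))) ∈-pairˡ
        where
        old : ∀ {γ} → γ ∈ C ∖ ｛ δ , δ ｝ → γ ∈ C
        old h = proj₁ (to (∈-∖ _) h)
        keep : ∀ {γ} → γ ∈ C → γ ≢ δ → γ ∈ C ∖ ｛ δ , δ ｝
        keep h ne = from (∈-∖ _) (h , λ h′ → ne (∈-singleton h′))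

      inv-basic : ∀ {φ a} → basic φ a ∈ C → ∀ k x → ⟪ k , x ⟫ ∈ a → x ∈ Z
      inv-basic h with C-generated h
      ... | negation _ _ e = ⊥-elim (basic≢neg e)
      ... | join _ _ e     = ⊥-elim (basic≢⋁ e)
      ... | meet _ _ e     = ⊥-elim (basic≢⋀ e)
      ... | supported (φ , a , e , s) with ⟪⟫-inj (proj₂ (⟪⟫-inj e))
      ... | refl , refl = s

      inv-neg : ∀ {γ} → neg γ ∈ C → γ ∈ C
      inv-neg h with C-generated h
      ... | supported (_ , _ , e , _) = ⊥-elim (basic≢neg (sym e))
      ... | join _ _ e     = ⊥-elim (neg≢⋁ e)
      ... | meet _ _ e     = ⊥-elim (neg≢⋀ e)
      ... | negation _ γ∈ e with ⟪⟫-inj e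
      ... | _ , refl = γ∈

      inv-⋁ : ∀ {Γ} → ⋁ Γ ∈ C → Γ ∶ (_∈ κ) ⟶ (_∈ C)
      inv-⋁ h with C-generated h
      ... | supported (_ , _ , e , _) = ⊥-elim (basic≢⋁ (sym e))
      ... | negation _ _ e = ⊥-elim (neg≢⋁ (sym e))
      ... | meet _ _ e     = ⊥-elim (⋁≢⋀ e)
      ... | join _ hΓ e with ⟪⟫-inj e
      ... | _ , refl = hΓ

      inv-⋀ : ∀ {Γ} → ⋀ Γ ∈ C → Γ ∶ (_∈ κ) ⟶ (_∈ C)
      inv-⋀ h with C-generated h
      ... | supported (_ , _ , e , _) = ⊥-elim (basic≢⋀ (sym e))
      ... | negation _ _ e = ⊥-elim (neg≢⋀ (sym e))
      ... | join _ _ e     = ⊥-elim (⋁≢⋀ (sym e))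
      ... | meet _ hΓ e with ⟪⟫-inj e
      ... | _ , refl = hΓ

    module _ {D : Carrier} (alg : IsAlgebra Z D) where
      private
        module D = IsAlgebra alg

        family∈ : ∀ {Γ 𝒜} → (Γ ∶ (_∈ κ) ⟶ (_∈ C)) → (𝒜 ∶ (_∈ κ) ⟶ IsSetOfStructures) →
                  (∀ i γ A → ⟪ i , γ ⟫ ∈ Γ → ⟪ i , A ⟫ ∈ 𝒜 → γ ∈ C → A ∈ D) → 𝒜 ∶ (_∈ κ) ⟶ (_∈ D)
        family∈ hΓ h𝒜 h = fun-map h𝒜 λ {i} {A} hA →
          let (γ , hγ) = fun-value hΓ (proj₁ (fun-type h𝒜 hA)) in h i γ A hγ hA (proj₂ (fun-type hΓ hγ))

        -- De Morgan's law; `co` is the κ-sequence of the complements.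
        intersection∈ : ∀ 𝒜 V → (𝒜 ∶ (_∈ κ) ⟶ (_∈ D)) →
                        (V ≐ λ N → IsStructure N × (∀ i A → ⟪ i , A ⟫ ∈ 𝒜 → N ∈ A)) → V ∈ D
        intersection∈ 𝒜 V h𝒜 hV = complement∈ alg (D.union (proj₁ co) (Str ∖ V) (proj₁ (proj₂ co)) λ N → mk⇔
            (λ h → let (N∈ , N∉) = to (∈-∖ N) h in
              byContradiction λ none → N∉ (from (hV N) (to (∈-Str N) N∈ , λ i A hA → byContradiction λ N∉A →
                none (i , Str ∖ A , from (proj₂ (proj₂ co) i _) (proj₁ (fun-type h𝒜 hA) , A , hA , λ N → ∈-∖ N) ,
                      from (∈-∖ N) (N∈ , N∉A)))))
            (λ (i , B , hB , N∈B) → let (_ , A , hA , e) = to (proj₂ (proj₂ co) i B) hB ; (N∈ , N∉A) = to (e N) N∈B in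
              from (∈-∖ N) (N∈ , λ N∈V → N∉A (proj₂ (to (hV N) N∈V) i A hA))))
          λ N → mk⇔ (λ N∈V → proj₁ (to (hV N) N∈V) , λ h → proj₂ (to (∈-∖ N) h) N∈V)
                    (λ (hN , h) → byContradiction λ N∉V → h (from (∈-∖ N) (from (∈-Str N) hN , N∉V)))
          where
          co = mkFun (∃ᶠ (⟪ v2 , v0 ⟫ᵗ ∈ᶠ con 𝒜 ∧ᶠ ∀ᶠ (v0 ∈ᶠ v2 ⇔ᶠ (v0 ∈ᶠ con Str ∧ᶠ ¬ᶠ (v0 ∈ᶠ v1))))) (λ _ _ _ → refl) κ {_∈ D}
            (λ i i∈ → let (A , hA) = fun-value h𝒜 i∈ in
              Str ∖ A , D.compl A (proj₂ (fun-type h𝒜 hA)) , A , hA , λ N → ∈-∖ N)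
            (λ i B B′ _ (A , hA , e) (A′ , hA′ , e′) → ≐-unique e
              (subst (λ A → B′ ≐ λ N → N ∈ Str × ¬ N ∈ A) (fun-unique h𝒜 hA′ hA) e′))

      code-interpretation∈ : ∀ {γ A} → IsCode Z γ → γ InterpretedAs A → A ∈ D
      code-interpretation∈ hγ = interpretation-induction (record
        { basics    = λ m φ a A hm hφ ha c hA →
            conjunction∈ alg (fun-map ha λ xy → inv-basic c _ _ xy) hφ hA
        ; negations = λ γ A B c _ h hB → complement∈ alg (h (inv-neg c)) hB
        ; joins     = λ Γ 𝒜 V _ h𝒜 c h hV → D.union 𝒜 V (family∈ (inv-⋁ c) h𝒜 h) hV
        ; meets     = λ Γ 𝒜 V _ h𝒜 c h hV → intersection∈ 𝒜 V (family∈ (inv-⋀ c) h𝒜 h) hV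
        }) (IsCode⇒∈C hγ)

  -- One inclusion between the graphs suffices, because both functions are total on `P`.
  fun-ext : ∀ {f g} {P Q R : Pred Carrier ℓ} → (f ∶ P ⟶ Q) → (g ∶ P ⟶ R) →
            (∀ {x y} → ⟪ x , y ⟫ ∈ f → ⟪ x , y ⟫ ∈ g) → f ≡ g
  fun-ext {f} {g} hf hg sub = ext fwd bwd
    where
    fwd : ∀ z → z ∈ f → z ∈ g
    fwd z z∈ with proj₁ hf z z∈
    ... | x , y , _ , refl = sub z∈
    bwd : ∀ z → z ∈ g → z ∈ f
    bwd z z∈ with proj₁ hg z z∈
    ... | x , y , (px , _) , refl with fun-value hf px
    ... | y′ , h = subst (λ y → ⟪ x , y ⟫ ∈ f) (fun-unique hg (sub h) z∈) h

  abstract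
    cyl : Carrier → Carrier
    cyl P = sep (∀ᶠ (v0 ∈ᶠ con P ⇒ᶠ v0 ∈ᶠ v1)) Str

    cyl-Str : ∀ P N → N ∈ cyl P ⇔ (N ∈ Str × (∀ p → p ∈ P → p ∈ N))
    cyl-Str P = ∈-sep _ Str

  ∈-cyl : ∀ P → cyl P ≐ λ N → IsStructure N × (∀ p → p ∈ P → p ∈ N)
  ∈-cyl P N = mk⇔ (λ h → let (a , b) = to (cyl-Str P N) h in to (∈-Str N) a , b)
                  (λ (a , b) → from (cyl-Str P N) (from (∈-Str N) a , b))

  cyl-singleton : ∀ p → cyl ｛ p , p ｝ ≐ λ N → IsStructure N × p ∈ N
  cyl-singleton p N = mk⇔ (λ h → let (hN , x) = to (∈-cyl _ N) h in hN , x p ∈-pairˡ)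
                          (λ (hN , x) → from (∈-cyl _ N) (hN , λ q q∈ → subst (_∈ N) (sym (∈-singleton q∈)) x))

  cyl-∪ : ∀ P Q → cyl P ∩ cyl Q ≡ cyl (P ∪ Q)
  cyl-∪ P Q = ext
    (λ N h → let (a , b) = to (∈-∩ N) h ; (hN , hP) = to (cyl-Str P N) a ; (_ , hQ) = to (cyl-Str Q N) b in
      from (cyl-Str (P ∪ Q) N) (hN , λ p h → [ hP p , hQ p ]′ (to (∈-∪ p) h)))
    (λ N h → let (hN , hPQ) = to (cyl-Str (P ∪ Q) N) h in
      from (∈-∩ N) (from (cyl-Str P N) (hN , λ p p∈ → hPQ p (from (∈-∪ p) (inj₁ p∈))) ,
                    from (cyl-Str Q N) (hN , λ p p∈ → hPQ p (from (∈-∪ p) (inj₂ p∈)))))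

  private
    Cylinderᶠ : Carrier → Form 1
    Cylinderᶠ F = ∃ᶠ (v0 ∈ᶠ con F ∧ᶠ ∀ᶠ (v0 ∈ᶠ v2 ⇔ᶠ (v0 ∈ᶠ con Str ∧ᶠ ∀ᶠ (v0 ∈ᶠ v2 ⇒ᶠ v0 ∈ᶠ v1))))

  abstract
    cylinders : Carrier → Carrier
    cylinders F = sep (Cylinderᶠ F) (𝒫 Str)

    ∈-cylinders : ∀ {F} A → A ∈ cylinders F ⇔ (∃ λ P → P ∈ F × A ≡ cyl P)
    ∈-cylinders {F} A = mk⇔
      (λ h → let (_ , P , P∈ , e) = to (∈-sep (Cylinderᶠ F) (𝒫 Str) A) h in P , P∈ , ≐-unique e (cyl-Str P))
      (λ { (P , P∈ , refl) → from (∈-sep (Cylinderᶠ F) (𝒫 Str) (cyl P)) (from (∈-𝒫 _) (λ N N∈ → proj₁ (to (cyl-Str P N) N∈)) , P , P∈ , cyl-Str P) })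

  -- 𝓕 Z consists of the finite sets of facts over Z; this impredicative form of finiteness
  -- gives induction without enumerations.
  module _ (Z : Carrier) where
    private
      Inductive : Pred Carrier ℓ
      Inductive T = ∅ ∈ T × (∀ P p Q → P ∈ T → p ∈ facts Z → (Q ≐ λ z → z ∈ P ⊎ z ≡ p) → Q ∈ T)

      Inductiveᶠ : ∀ {n} → Term n → Form n
      Inductiveᶠ T = con ∅ ∈ᶠ T ∧ᶠ ∀ᶠ (∀ᶠ (∀ᶠ (v2 ∈ᶠ wk (wk (wk T)) ⇒ᶠ v1 ∈ᶠ con (facts Z) ⇒ᶠ
        ∀ᶠ (v0 ∈ᶠ v1 ⇔ᶠ (v0 ∈ᶠ v3 ∨ᶠ v0 ≡ᶠ v2)) ⇒ᶠ v0 ∈ᶠ wk (wk (wk T)))))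

    abstract
      𝓕 : Carrier
      𝓕 = sep (∀ᶠ (Inductiveᶠ v0 ⇒ᶠ v1 ∈ᶠ v0)) (𝒫 (facts Z))

      private
        ∈-𝓕 : ∀ P → P ∈ 𝓕 ⇔ (P ∈ 𝒫 (facts Z) × (∀ T → Inductive T → P ∈ T))
        ∈-𝓕 = ∈-sep _ _

    𝓕-∅ : ∅ ∈ 𝓕
    𝓕-∅ = from (∈-𝓕 ∅) (from (∈-𝒫 ∅) (λ z z∈ → ⊥-elim (∉∅ z z∈)) , λ T → proj₁)

    𝓕-◂ : ∀ {P p} → P ∈ 𝓕 → p ∈ facts Z → P ◂ p ∈ 𝓕
    𝓕-◂ {P} {p} hP hp = let (P⊆ , h) = to (∈-𝓕 P) hP in from (∈-𝓕 _)
      (from (∈-𝒫 _) (λ z z∈ → [ to (∈-𝒫 P) P⊆ z , (λ { refl → hp }) ]′ (to (∈-◂ z) z∈)) ,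
       λ T i → proj₂ i P p _ (h T i) hp ∈-◂)

    𝓕-induction : (φ : Form 1) → ⟦ φ ⟧ (∅ ∷ []) →
      (∀ P p → P ∈ 𝓕 → p ∈ facts Z → ⟦ φ ⟧ (P ∷ []) → ⟦ φ ⟧ (P ◂ p ∷ [])) → ∀ P → P ∈ 𝓕 → ⟦ φ ⟧ (P ∷ [])
    𝓕-induction φ z s P hP = proj₂ (to (∈-sep φ 𝓕 P) (proj₂ (to (∈-𝓕 P) hP) (sep φ 𝓕)
      ( from (∈-sep φ 𝓕 ∅) (𝓕-∅ , z)
      , λ P p Q P∈ hp hQ → let (hP , h) = to (∈-sep φ 𝓕 P) P∈ in
          subst (_∈ sep φ 𝓕) (≐-unique ∈-◂ hQ) (from (∈-sep φ 𝓕 _) (𝓕-◂ hP hp , s P p hP hp h)))))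

    -- By induction on `Q`. As `∪` is not a term of the formula language, the formula speaks of a
    -- set `W` having the elements of the union.
    ∪∈𝓕 : ∀ P Q → P ∈ 𝓕 → Q ∈ 𝓕 → P ∪ Q ∈ 𝓕
    ∪∈𝓕 P Q hP hQ = conclude (𝓕-induction Unionᶠ start next Q hQ)
      where
      Unionᶠ : Form 1
      Unionᶠ = ∃ᶠ (v0 ∈ᶠ con 𝓕 ∧ᶠ ∀ᶠ (v0 ∈ᶠ v1 ⇔ᶠ (v0 ∈ᶠ con P ∨ᶠ v0 ∈ᶠ v2)))
      conclude : (∃ λ W → W ∈ 𝓕 × (W ≐ λ z → z ∈ P ⊎ z ∈ Q)) → P ∪ Q ∈ 𝓕
      conclude (W , W∈ , e) = subst (_∈ 𝓕) (≐-unique e ∈-∪) W∈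
      start : ∃ λ W → W ∈ 𝓕 × (W ≐ λ z → z ∈ P ⊎ z ∈ ∅)
      start = P , hP , λ z → mk⇔ inj₁ [ id , (λ h → ⊥-elim (∉∅ z h)) ]′
      next : ∀ R p → R ∈ 𝓕 → p ∈ facts Z → (∃ λ W → W ∈ 𝓕 × (W ≐ λ z → z ∈ P ⊎ z ∈ R)) →
             ∃ λ W → W ∈ 𝓕 × (W ≐ λ z → z ∈ P ⊎ z ∈ R ◂ p)
      next R p hR hp (W , W∈ , e) = W ◂ p , 𝓕-◂ W∈ hp , λ z → mk⇔
        (λ h → [ (λ w → [ inj₁ , (λ r → inj₂ (◂ˡ r)) ]′ (to (e z) w)) , (λ { refl → inj₂ ◂ʳ }) ]′ (to (∈-◂ z) h))
        [ (λ h → ◂ˡ (from (e z) (inj₁ h))) ,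
          (λ h → [ (λ r → ◂ˡ (from (e z) (inj₂ r))) , (λ { refl → ◂ʳ }) ]′ (to (∈-◂ z) h)) ]′

    singleton∈𝓕 : ∀ {p} → p ∈ facts Z → ｛ p , p ｝ ∈ 𝓕
    singleton∈𝓕 {p} hp = subst (_∈ 𝓕) (ext
      (λ z h → [ (λ z∈ → ⊥-elim (∉∅ z z∈)) , (λ { refl → ∈-pairˡ }) ]′ (to (∈-◂ z) h))
      (λ z h → subst (_∈ ∅ ◂ p) (sym (∈-singleton h)) ◂ʳ)) (𝓕-◂ 𝓕-∅ hp)

  𝓕-mono : ∀ Z Z′ → (∀ p → p ∈ facts Z → p ∈ facts Z′) → ∀ P → P ∈ 𝓕 Z → P ∈ 𝓕 Z′
  𝓕-mono Z Z′ s = 𝓕-induction Z (v0 ∈ᶠ con (𝓕 Z′)) (𝓕-∅ Z′) λ P p _ hp h → 𝓕-◂ Z′ h (s p hp)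

  -- Under the tuple a on m variables, the literal l says that the fact p holds.
  Expresses : (m a p l : Carrier) → Set ℓ
  Expresses m a p l = ∃₂ λ R n → ∃₂ λ s t → ⟪ R , n ⟫ ∈ 𝓛 × (s ∶ (_∈ n) ⟶ (_∈ m)) × IsComposite t a s ×
                      p ≡ ⟪ R , t ⟫ × l ≡ ⟪ ∅ , ⟪ S ∅ , ⟪ R , s ⟫ ⟫ ⟫

  Represents : (m a φ P : Carrier) → Set ℓ
  Represents m a φ P = (∀ i l → ⟪ i , l ⟫ ∈ φ → ∃ λ p → p ∈ P × Expresses m a p l) ×
                       (∀ p → p ∈ P → ∃₂ λ i l → ⟪ i , l ⟫ ∈ φ × Expresses m a p l)

  expresses-literal : ∀ {m a p l} → Expresses m a p l → IsLiteral m l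
  expresses-literal (R , n , s , t , hR , hs , _ , _ , e) =
    ∅ , ⟪ S ∅ , ⟪ R , s ⟫ ⟫ , nat-∅ , inj₂ (R , n , s , hR , hs , refl) , e

  even-∅ : IsEven ∅
  even-∅ w h _ = h

  expresses-holds : ∀ {m a p l N} → Expresses m a p l → LiteralHolds N a l ⇔ (p ∈ N)
  expresses-holds {N = N} (R , n , s , t , _ , _ , ct , refl , refl) = mk⇔
    (λ h → to (relation-holds {N} ct) (to (even-holds {N} even-∅) h))
    (λ h → from (even-holds {N} even-∅) (from (relation-holds {N} ct) h))

  represents-holds : ∀ {m a φ P N} → Represents m a φ P → ConjunctionHolds N a φ ⇔ (∀ p → p ∈ P → p ∈ N)
  represents-holds {N = N} (r₁ , r₂) = mk⇔
    (λ h p p∈ → let (i , l , hl , x) = r₂ p p∈ in to (expresses-holds {N = N} x) (h i l hl))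
    (λ h i l hl → let (p , p∈ , x) = r₁ i l hl in from (expresses-holds {N = N} x) (h p p∈))

  -- To write the fact with the variables of `a`, the tuple `t` must factor as `a` after some `s`.
  -- The tuple `a` may repeat points, so a section of it chooses which variable stands for each
  -- point.
  expressible : ∀ {m a Z p} → (a ∶ (_∈ m) ⟶ (_∈ X)) → (∀ x → x ∈ Z → ∃ λ i → ⟪ i , x ⟫ ∈ a) →
                (∀ x → x ∈ Z → x ∈ X) → IsFact Z p → ∃ (Expresses m a p)
  expressible {m} {a} {Z} ha onto Z⊆X (R , n , t , hR , ht , refl) =
    _ , R , n , s , t , hR , hs , subst (λ t → IsComposite t a s) same (⊙-isComposite a s) , refl , refl
    where
    c : Carrier
    c = proj₁ (section ha)
    sec : ∃ λ s → (s ∶ (_∈ n) ⟶ (_∈ m)) × (∀ i j → ⟪ i , j ⟫ ∈ s ⇔ (i ∈ n × ∃ λ x → ⟪ i , x ⟫ ∈ t × ⟪ j , x ⟫ ∈ a × j ∈ c))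
    sec = mkFun (∃ᶠ (⟪ v2 , v0 ⟫ᵗ ∈ᶠ con t ∧ᶠ ⟪ v1 , v0 ⟫ᵗ ∈ᶠ con a ∧ᶠ v1 ∈ᶠ con c)) (λ _ _ _ → refl) n
      (λ i i∈ → let (x , hx) = fun-value ht i∈ ; (_ , hk) = onto x (proj₂ (fun-type ht hx))
                    (j , (j∈c , hj) , _) = proj₂ (section ha) hk
                in j , proj₁ (fun-type ha hj) , x , hx , hj , j∈c)
      (λ i j j′ _ (x , hx , hj , j∈) (x′ , hx′ , hj′ , j′∈) →
        let (_ , _ , u) = proj₂ (section ha) hj in
        trans (u j j∈ hj) (sym (u j′ j′∈ (subst (λ x → ⟪ j′ , x ⟫ ∈ a) (fun-unique ht hx′ hx) hj′))))
    s : Carrier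
    s = proj₁ sec
    hs : s ∶ (_∈ n) ⟶ (_∈ m)
    hs = proj₁ (proj₂ sec)
    same : a ⊙ s ≡ t
    same = fun-ext (composite-fun (⊙-isComposite a s) hs ha) ht λ {i} {y} h →
      let (j , hij , hjy) = ∈-composite (⊙-isComposite a s) h
          (_ , x , hx , hj , _) = to (proj₂ (proj₂ sec) i j) hij
      in subst (λ y → ⟪ i , y ⟫ ∈ t) (fun-unique ha hj hjy) hx

  -- A basic code for the cylinder of `P`, kept as its finite constituents so that it can be carried
  -- to the larger model one constituent at a time.
  record Coded (Z P : Carrier) : Set ℓ where
    field
      m φ a      : Carrier
      m-nat      : IsNat m
      tuple      : a ∶ (_∈ m) ⟶ (_∈ Z)
      n          : Carrier
      n-nat      : IsNat n
      conj       : φ ∶ (_∈ n) ⟶ IsLiteral m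
      represents : Represents m a φ P

    code : Carrier
    code = basic φ a

  module _ {Z : Carrier} (Z⊆X : ∀ x → x ∈ Z → x ∈ X) where

    coded : ∀ {m a} → IsNat m → (a ∶ (_∈ m) ⟶ (_∈ Z)) → (∀ x → x ∈ Z → ∃ λ i → ⟪ i , x ⟫ ∈ a) →
            ∀ P → P ∈ 𝓕 Z → Coded Z P
    coded {m} {a} hm ha onto P hP = finish P (𝓕-induction Z Codedᶠ start next P hP)
      where
      haX : a ∶ (_∈ m) ⟶ (_∈ X)
      haX = fun-weaken ha (Z⊆X _)
      Expressesᶠ : ∀ {n} → Term n → Term n → Form n
      Expressesᶠ p l = ∃ᶠ (∃ᶠ (∃ᶠ (∃ᶠ (⟪ v3 , v2 ⟫ᵗ ∈ᶠ con 𝓛 ∧ᶠ funᶠ v1 v2 (con m) ∧ᶠ compositeᶠ v0 (con a) v1 ∧ᶠ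
        wk (wk (wk (wk p))) ≡ᶠ ⟪ v3 , v0 ⟫ᵗ ∧ᶠ
        wk (wk (wk (wk l))) ≡ᶠ ⟪ con ∅ , ⟪ Sᵗ (con ∅) , ⟪ v3 , v1 ⟫ᵗ ⟫ᵗ ⟫ᵗ))))
      -- The values of the conjunction are only required to lie in `U`, which saves a formula for
      -- literals; that they are literals follows from `Represents`.
      Codedᶠ : Form 1
      Codedᶠ = ∃ᶠ (∃ᶠ (natᶠ v0 ∧ᶠ funᶠ v1 v0 (con U) ∧ᶠ
        ∀ᶠ (∀ᶠ (⟪ v1 , v0 ⟫ᵗ ∈ᶠ v3 ⇒ᶠ ∃ᶠ (v0 ∈ᶠ v5 ∧ᶠ Expressesᶠ v0 v1))) ∧ᶠ
        ∀ᶠ (v0 ∈ᶠ v3 ⇒ᶠ ∃ᶠ (∃ᶠ (⟪ v1 , v0 ⟫ᵗ ∈ᶠ v4 ∧ᶠ Expressesᶠ v2 v0)))))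
      Done : Carrier → Set ℓ
      Done P = ∃₂ λ φ n → IsNat n × (φ ∶ (_∈ n) ⟶ (_∈ U)) × Represents m a φ P
      finish : ∀ P → Done P → Coded Z P
      finish P (φ , n , hn , hφ , r) = record
        { m = m ; φ = φ ; a = a ; m-nat = hm ; tuple = ha ; n = n ; n-nat = hn ; represents = r
        ; conj = fun-map hφ λ {i} {l} hl → expresses-literal (proj₂ (proj₂ (proj₁ r i l hl))) }
      start : Done ∅
      start = ∅ , ∅ , nat-∅ , ∅-fun , (λ i l h → ⊥-elim (∉∅ _ h)) , λ p p∈ → ⊥-elim (∉∅ p p∈)
      next : ∀ P p → P ∈ 𝓕 Z → p ∈ facts Z → Done P → Done (P ◂ p)
      next P p _ hp (φ , n , hn , hφ , r₁ , r₂) with expressible haX onto Z⊆X (to (∈-facts Z⊆X p) hp)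
      ... | l , x = φ ◂ ⟪ n , l ⟫ , S n , nat-S hn , ◂-fun hφ (literal∈U hm (expresses-literal x)) , r₁′ , r₂′
        where
        r₁′ : ∀ i k → ⟪ i , k ⟫ ∈ φ ◂ ⟪ n , l ⟫ → ∃ λ q → q ∈ P ◂ p × Expresses m a q k
        r₁′ i k h with to (∈-◂ _) h
        ... | inj₁ h′ = let (q , q∈ , y) = r₁ i k h′ in q , ◂ˡ q∈ , y
        ... | inj₂ e  = p , ◂ʳ , subst (Expresses m a p) (sym (proj₂ (⟪⟫-inj e))) x
        r₂′ : ∀ q → q ∈ P ◂ p → ∃₂ λ i k → ⟪ i , k ⟫ ∈ φ ◂ ⟪ n , l ⟫ × Expresses m a q k
        r₂′ q h with to (∈-◂ q) h
        ... | inj₁ q∈  = let (i , k , hk , y) = r₂ q q∈ in i , k , ◂ˡ hk , y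
        ... | inj₂ refl = n , l , ◂ʳ , x

    module _ {P : Carrier} (C : Coded Z P) where
      open Coded C

      private
        tupleX : a ∶ (_∈ m) ⟶ (_∈ X)
        tupleX = fun-weaken tuple (Z⊆X _)

      code-holds : cyl P ≐ λ N → IsStructure N × ConjunctionHolds N a φ
      code-holds N = mk⇔
        (λ h → let (hN , x) = to (∈-cyl P N) h in hN , from (represents-holds {N = N} represents) x)
        (λ (hN , x) → from (∈-cyl P N) (hN , to (represents-holds {N = N} represents) x))

      code-isBasic : IsBasicCode Z code
      code-isBasic = m , φ , a , m-nat , (n , n-nat , conj) , tuple , refl

      code-isBasicX : IsBasicCode X code
      code-isBasicX = m , φ , a , m-nat , (n , n-nat , conj) , tupleX , refl

      code-isCode : IsCode Z code
      code-isCode B cl = IsClosedUnderCodes.basics cl code code-isBasic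

      code-interpretation : code InterpretedAs cyl P
      code-interpretation E cl = IsClosedUnderInterpretation.basics cl m φ a (cyl P) m-nat (n , n-nat , conj) tupleX code-holds

      code-unique : ∀ {A} → code InterpretedAs A → A ≡ cyl P
      code-unique = basic-interpretation-unique code-holds

  -- A code for the intersection of a cylinder over `X₀` with one over `X₁` needs a single tuple
  -- listing both sets. Appending the entries of `f₁` one by one avoids addition of natural numbers,
  -- and a repeated entry does no harm.
  concatenate : ∀ {n₀ n₁ f₀ f₁ X₀ X₁} → IsNat n₀ → IsNat n₁ → (f₀ ∶ (_∈ n₀) ⟶ (_∈ X₀)) → (f₁ ∶ (_∈ n₁) ⟶ (_∈ X₁)) →
    (∀ x → x ∈ X₀ → ∃ λ i → ⟪ i , x ⟫ ∈ f₀) → (∀ x → x ∈ X₁ → ∃ λ i → ⟪ i , x ⟫ ∈ f₁) →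
    ∃₂ λ m a → IsNat m × (a ∶ (_∈ m) ⟶ (_∈ X₀ ∪ X₁)) × (∀ x → x ∈ X₀ ∪ X₁ → ∃ λ i → ⟪ i , x ⟫ ∈ a)
  concatenate {n₀} {n₁} {f₀} {f₁} {X₀} {X₁} hn₀ hn₁ hf₀ hf₁ onto₀ onto₁ =
    let (m , a , hm , ha , c₀ , c₁) = natInd Listᶠ start next n₁ hn₁ in
    m , a , hm , ha , λ x h → [ c₀ x , (λ x∈ → let (i , hi) = onto₁ x x∈ in c₁ i x (proj₁ (fun-type hf₁ hi)) hi) ]′ (to (∈-∪ x) h)
    where
    Listᶠ : Form 1
    Listᶠ = ∃ᶠ (∃ᶠ (natᶠ v1 ∧ᶠ funᶠ v0 v1 (con (X₀ ∪ X₁)) ∧ᶠ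
      ∀ᶠ (v0 ∈ᶠ con X₀ ⇒ᶠ ∃ᶠ (⟪ v0 , v1 ⟫ᵗ ∈ᶠ v2)) ∧ᶠ
      ∀ᶠ (∀ᶠ (v1 ∈ᶠ v4 ⇒ᶠ ⟪ v1 , v0 ⟫ᵗ ∈ᶠ con f₁ ⇒ᶠ ∃ᶠ (⟪ v0 , v1 ⟫ᵗ ∈ᶠ v3)))))
    Listed : Carrier → Set ℓ
    Listed k = ∃₂ λ m a → IsNat m × (a ∶ (_∈ m) ⟶ (_∈ X₀ ∪ X₁)) × (∀ x → x ∈ X₀ → ∃ λ i → ⟪ i , x ⟫ ∈ a) ×
               (∀ i x → i ∈ k → ⟪ i , x ⟫ ∈ f₁ → ∃ λ j → ⟪ j , x ⟫ ∈ a)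
    start : Listed ∅
    start = n₀ , f₀ , hn₀ , fun-weaken hf₀ (λ y∈ → from (∈-∪ _) (inj₁ y∈)) , onto₀ ,
            λ i x i∈ → ⊥-elim (∉∅ i i∈)
    next : ∀ k → IsNat k → Listed k → Listed (S k)
    next k hk (m , a , hm , ha , c₀ , c₁) with em {∃ λ y → ⟪ k , y ⟫ ∈ f₁}
    ... | no none = m , a , hm , ha , c₀ , λ i x i∈ h →
      [ (λ i∈k → c₁ i x i∈k h) , (λ { refl → ⊥-elim (none (x , h)) }) ]′ (to (∈-S k i) i∈)
    ... | yes (y , hy) = S m , a ◂ ⟪ m , y ⟫ , nat-S hm , ◂-fun ha (from (∈-∪ y) (inj₂ (proj₂ (fun-type hf₁ hy)))) ,
      (λ x x∈ → let (i , h) = c₀ x x∈ in i , ◂ˡ h) ,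
      λ i x i∈ h → [ (λ i∈k → let (j , hj) = c₁ i x i∈k h in j , ◂ˡ hj)
                   , (λ e → m , subst (λ z → ⟪ m , z ⟫ ∈ a ◂ ⟪ m , y ⟫)
                                  (fun-unique hf₁ hy (subst (λ i → ⟪ i , x ⟫ ∈ f₁) e h)) ◂ʳ) ]′ (to (∈-S k i) i∈)

-- Dynkin's argument along κ

module Dynkin {ℓ} (em : ExcludedMiddle ℓ) (M : ZFCModel ℓ) (κ X 𝓛 : ZFCModel.Carrier M)
              (ord : InModel.IsOrdinal M κ) (rel : InModel.IsRelationalLanguage M 𝓛) where
  open ZFCModel M
  open InModel M
  open SetTheory em M
  open Structures κ X 𝓛
  open Codes em M κ X 𝓛 rel

  -- Take a minimal `a` that is incomparable with something, and then a minimal `b` incomparable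
  -- with this `a`. Every element of one is comparable with the other, which forces `a` and `b` to
  -- have the same elements.
  trichotomy : ∀ i j → i ∈ κ → j ∈ κ → i ∈ j ⊎ i ≡ j ⊎ j ∈ i
  trichotomy i j i∈ j∈ = byContradiction λ bad → case (minimal Incomparableᶠ κ i i∈ (j , j∈ , bad))
    where
    Comparable : Carrier → Carrier → Set ℓ
    Comparable a b = a ∈ b ⊎ a ≡ b ⊎ b ∈ a
    Incomparableᶠ : Form 1
    Incomparableᶠ = ∃ᶠ (v0 ∈ᶠ con κ ∧ᶠ ¬ᶠ (v1 ∈ᶠ v0 ∨ᶠ v1 ≡ᶠ v0 ∨ᶠ v0 ∈ᶠ v1))
    case : (∃ λ a → a ∈ κ × (∃ λ b → b ∈ κ × ¬ Comparable a b) ×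
            (∀ z → z ∈ κ → (∃ λ b → b ∈ κ × ¬ Comparable z b) → ¬ z ∈ a)) → ⊥
    case (a , a∈ , (b₀ , b₀∈ , bad₀) , mina) with minimal (¬ᶠ (con a ∈ᶠ v0 ∨ᶠ con a ≡ᶠ v0 ∨ᶠ v0 ∈ᶠ con a)) κ b₀ b₀∈ bad₀
    ... | b , b∈ , bad , minb = bad (inj₂ (inj₁ (ext sub sup)))
      where
      sub : ∀ x → x ∈ a → x ∈ b
      sub x x∈ with byContradiction {Comparable x b} (λ nc → mina x (proj₁ ord x a x∈ a∈) (b , b∈ , nc) x∈)
      ... | inj₁ h           = h
      ... | inj₂ (inj₁ refl) = ⊥-elim (bad (inj₂ (inj₂ x∈)))
      ... | inj₂ (inj₂ h)    = ⊥-elim (bad (inj₂ (inj₂ (proj₂ ord a a∈ b x h x∈))))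
      sup : ∀ x → x ∈ b → x ∈ a
      sup x x∈ with byContradiction {Comparable a x} (λ nc → minb x (proj₁ ord x b x∈ b∈) nc x∈)
      ... | inj₂ (inj₂ h)    = h
      ... | inj₂ (inj₁ refl) = ⊥-elim (bad (inj₁ x∈))
      ... | inj₁ h           = ⊥-elim (bad (inj₁ (proj₂ ord b b∈ a x h x∈)))

  Disjoint : Pred Carrier ℓ
  Disjoint 𝒜 = ∀ i j A B N → ⟪ i , A ⟫ ∈ 𝒜 → ⟪ j , B ⟫ ∈ 𝒜 → i ≢ j → N ∈ A → ¬ N ∈ B

  IsUnion : Carrier → Carrier → Set ℓ
  IsUnion 𝒜 V = V ≐ λ N → ∃₂ λ i A → ⟪ i , A ⟫ ∈ 𝒜 × N ∈ A

  IsλSystem : Pred Carrier ℓ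
  IsλSystem G = Str ∈ G ×
    (∀ A B C → A ∈ G → B ∈ G → (∀ N → N ∈ A → N ∈ B) → (C ≐ λ N → N ∈ B × ¬ N ∈ A) → C ∈ G) ×
    (∀ 𝒜 V → (𝒜 ∶ (_∈ κ) ⟶ (_∈ G)) → Disjoint 𝒜 → IsUnion 𝒜 V → V ∈ G)

  -- Used twice: for the closure of the λ-system under intersections, and for κ-additivity inside a
  -- fixed set `A`.
  traces : ∀ A {𝒜} {P Q : Pred Carrier ℓ} → (𝒜 ∶ (_∈ κ) ⟶ P) → (∀ B → P B → Q (A ∩ B)) →
           ∃ λ ℬ → (ℬ ∶ (_∈ κ) ⟶ Q) × (∀ i B → ⟪ i , B ⟫ ∈ 𝒜 → ⟪ i , A ∩ B ⟫ ∈ ℬ) ×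
             (Disjoint 𝒜 → Disjoint ℬ) × (∀ V → IsUnion 𝒜 V → IsUnion ℬ (A ∩ V))
  traces A {𝒜} {P} {Q} h𝒜 cap = ℬ , proj₁ (proj₂ family) , member , disjoint , isUnion
    where
    family : ∃ λ ℬ → (ℬ ∶ (_∈ κ) ⟶ Q) ×
             (∀ i C → ⟪ i , C ⟫ ∈ ℬ ⇔ (i ∈ κ × ∃ λ B → ⟪ i , B ⟫ ∈ 𝒜 × (C ≐ λ N → N ∈ A × N ∈ B)))
    family = mkFun (∃ᶠ (⟪ v2 , v0 ⟫ᵗ ∈ᶠ con 𝒜 ∧ᶠ ∀ᶠ (v0 ∈ᶠ v2 ⇔ᶠ (v0 ∈ᶠ con A ∧ᶠ v0 ∈ᶠ v1)))) (λ _ _ _ → refl) κ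
      (λ i i∈ → let (B , hB) = fun-value h𝒜 i∈ in A ∩ B , cap B (proj₂ (fun-type h𝒜 hB)) , B , hB , ∈-∩)
      (λ i C C′ _ (B , hB , e) (B′ , hB′ , e′) → ≐-unique e
        (subst (λ B → C′ ≐ λ N → N ∈ A × N ∈ B) (fun-unique h𝒜 hB′ hB) e′))
    ℬ : Carrier
    ℬ = proj₁ family
    spec : ∀ i C → ⟪ i , C ⟫ ∈ ℬ ⇔ (i ∈ κ × ∃ λ B → ⟪ i , B ⟫ ∈ 𝒜 × (C ≐ λ N → N ∈ A × N ∈ B))
    spec = proj₂ (proj₂ family)
    member : ∀ i B → ⟪ i , B ⟫ ∈ 𝒜 → ⟪ i , A ∩ B ⟫ ∈ ℬ
    member i B hB = from (spec i (A ∩ B)) (proj₁ (fun-type h𝒜 hB) , B , hB , ∈-∩)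
    disjoint : Disjoint 𝒜 → Disjoint ℬ
    disjoint dis i j C C′ N hC hC′ ne N∈ N∈′ =
      let (_ , B , hB , e) = to (spec i C) hC ; (_ , B′ , hB′ , e′) = to (spec j C′) hC′ in
      dis i j B B′ N hB hB′ ne (proj₂ (to (e N) N∈)) (proj₂ (to (e′ N) N∈′))
    isUnion : ∀ V → IsUnion 𝒜 V → IsUnion ℬ (A ∩ V)
    isUnion V hV N = mk⇔
      (λ h → let (a , v) = to (∈-∩ N) h ; (i , B , hB , N∈B) = to (hV N) v in
        i , A ∩ B , member i B hB , from (∈-∩ N) (a , N∈B))
      (λ (i , C , hC , N∈C) → let (_ , B , hB , e) = to (spec i C) hC ; (a , b) = to (e N) N∈C in
        from (∈-∩ N) (a , from (hV N) (i , B , hB , b)))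

  λSystemᶠ : ∀ {n} → Term n → Form n
  λSystemᶠ G = con Str ∈ᶠ G ∧ᶠ
    ∀ᶠ (∀ᶠ (∀ᶠ (v2 ∈ᶠ wk (wk (wk G)) ⇒ᶠ v1 ∈ᶠ wk (wk (wk G)) ⇒ᶠ ∀ᶠ (v0 ∈ᶠ v3 ⇒ᶠ v0 ∈ᶠ v2) ⇒ᶠ
      ∀ᶠ (v0 ∈ᶠ v1 ⇔ᶠ (v0 ∈ᶠ v2 ∧ᶠ ¬ᶠ (v0 ∈ᶠ v3))) ⇒ᶠ v0 ∈ᶠ wk (wk (wk G))))) ∧ᶠ
    ∀ᶠ (∀ᶠ (funᶠ v1 (con κ) (wk (wk G)) ⇒ᶠ
      ∀ᶠ (∀ᶠ (∀ᶠ (∀ᶠ (∀ᶠ (⟪ v4 , v2 ⟫ᵗ ∈ᶠ v6 ⇒ᶠ ⟪ v3 , v1 ⟫ᵗ ∈ᶠ v6 ⇒ᶠ ¬ᶠ (v4 ≡ᶠ v3) ⇒ᶠ v0 ∈ᶠ v2 ⇒ᶠ ¬ᶠ (v0 ∈ᶠ v1)))))) ⇒ᶠ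
      ∀ᶠ (v0 ∈ᶠ v1 ⇔ᶠ ∃ᶠ (∃ᶠ (⟪ v1 , v0 ⟫ᵗ ∈ᶠ v4 ∧ᶠ v2 ∈ᶠ v0))) ⇒ᶠ v0 ∈ᶠ wk (wk G)))

  module _ (Π : Carrier) (Π⊆ : ∀ A → A ∈ Π → A ∈ 𝒫 Str) (Π∩ : ∀ A B → A ∈ Π → B ∈ Π → A ∩ B ∈ Π) where

    abstract
      D : Carrier
      D = sep (∀ᶠ (∀ᶠ (v0 ∈ᶠ con Π ⇒ᶠ v0 ∈ᶠ v1) ⇒ᶠ λSystemᶠ v0 ⇒ᶠ v1 ∈ᶠ v0)) (𝒫 Str)

      ∈-D : ∀ A → A ∈ D ⇔ (A ∈ 𝒫 Str × (∀ G → (∀ B → B ∈ Π → B ∈ G) → IsλSystem G → A ∈ G))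
      ∈-D = ∈-sep _ (𝒫 Str)

    D-least : ∀ {G} → (∀ B → B ∈ Π → B ∈ G) → IsλSystem G → ∀ A → A ∈ D → A ∈ G
    D-least h l A A∈ = proj₂ (to (∈-D A) A∈) _ h l

    Π⊆D : ∀ A → A ∈ Π → A ∈ D
    Π⊆D A A∈ = from (∈-D A) (Π⊆ A A∈ , λ G h _ → h A A∈)

    D⊆ : ∀ {A N} → A ∈ D → N ∈ A → N ∈ Str
    D⊆ A∈ = to (∈-𝒫 _) (proj₁ (to (∈-D _) A∈)) _

    private
      D-λSystem : IsλSystem D
      D-λSystem =
        from (∈-D _) (from (∈-𝒫 _) (λ _ h → h) , λ G _ → proj₁) ,
        (λ A B C A∈ B∈ s hC → from (∈-D _) (from (∈-𝒫 _) (λ N N∈ → D⊆ B∈ (proj₁ (to (hC N) N∈))) ,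
          λ G h l → proj₁ (proj₂ l) A B C (D-least h l A A∈) (D-least h l B B∈) s hC)) ,
        (λ 𝒜 V h𝒜 dis hV → from (∈-D _)
          (from (∈-𝒫 _) (λ N N∈ → let (_ , A , hA , N∈A) = to (hV N) N∈ in D⊆ (proj₂ (fun-type h𝒜 hA)) N∈A) ,
          λ G h l → proj₂ (proj₂ l) 𝒜 V (fun-weaken h𝒜 (D-least h l _)) dis hV))

      Str∈D : Str ∈ D
      Str∈D = proj₁ D-λSystem

      difference∈D : ∀ A B C → A ∈ D → B ∈ D → (∀ N → N ∈ A → N ∈ B) → (C ≐ λ N → N ∈ B × ¬ N ∈ A) → C ∈ D
      difference∈D = proj₁ (proj₂ D-λSystem)

      disjointUnion∈D : ∀ 𝒜 V → (𝒜 ∶ (_∈ κ) ⟶ (_∈ D)) → Disjoint 𝒜 → IsUnion 𝒜 V → V ∈ D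
      disjointUnion∈D = proj₂ (proj₂ D-λSystem)

      compl∈D : ∀ A → A ∈ D → Str ∖ A ∈ D
      compl∈D A A∈ = difference∈D A Str _ A∈ Str∈D (λ N → D⊆ A∈) ∈-∖

      Sliceᶠ : Carrier → Form 1
      Sliceᶠ A = ∃ᶠ (v0 ∈ᶠ con D ∧ᶠ ∀ᶠ (v0 ∈ᶠ v1 ⇔ᶠ (v0 ∈ᶠ con A ∧ᶠ v0 ∈ᶠ v2)))

      slice : Carrier → Carrier
      slice A = sep (Sliceᶠ A) D

      ∈-slice : ∀ {A} B → B ∈ slice A ⇔ (B ∈ D × A ∩ B ∈ D)
      ∈-slice {A} B = mk⇔
        (λ h → let (B∈ , C , C∈ , hC) = to (∈-sep (Sliceᶠ A) D B) h in B∈ , subst (_∈ D) (≐-unique hC ∈-∩) C∈)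
        (λ (B∈ , C∈) → from (∈-sep (Sliceᶠ A) D B) (B∈ , A ∩ B , C∈ , ∈-∩))

      slice-λSystem : ∀ A → A ∈ D → IsλSystem (slice A)
      slice-λSystem A A∈ =
        from (∈-slice Str) (Str∈D , subst (_∈ D)
          (ext (λ N N∈ → from (∈-∩ N) (N∈ , D⊆ A∈ N∈)) (λ N N∈ → proj₁ (to (∈-∩ N) N∈))) A∈) ,
        (λ B B′ C B∈ B′∈ s hC → let (B∈D , AB∈) = to (∈-slice B) B∈ ; (B′∈D , AB′∈) = to (∈-slice B′) B′∈ in
          from (∈-slice C) (difference∈D B B′ C B∈D B′∈D s hC ,
            difference∈D (A ∩ B) (A ∩ B′) (A ∩ C) AB∈ AB′∈
              (λ N h → let (a , b) = to (∈-∩ N) h in from (∈-∩ N) (a , s N b))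
              λ N → mk⇔
                (λ h → let (a , c) = to (∈-∩ N) h ; (b′ , ¬b) = to (hC N) c in
                  from (∈-∩ N) (a , b′) , λ ab → ¬b (proj₂ (to (∈-∩ N) ab)))
                (λ (h , ¬h) → let (a , b′) = to (∈-∩ N) h in
                  from (∈-∩ N) (a , from (hC N) (b′ , λ b → ¬h (from (∈-∩ N) (a , b))))))) ,
        λ 𝒜 V h𝒜 dis hV → from (∈-slice V)
          ( disjointUnion∈D 𝒜 V (fun-weaken h𝒜 λ y∈ → proj₁ (to (∈-slice _) y∈)) dis hV
          , let (ℬ , hℬ , _ , disjoint , isUnion) = traces A h𝒜 (λ B B∈ → proj₂ (to (∈-slice B) B∈)) in
            disjointUnion∈D ℬ (A ∩ V) hℬ (disjoint dis) (isUnion V hV))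

      -- Two rounds of minimality. For `P` in `Π` the slice at `P` contains `Π`, hence `D`. Read by
      -- symmetry, this says that the slice at any `A` in `D` contains `Π`, hence `D` as well.
      inter∈D : ∀ A B → A ∈ D → B ∈ D → A ∩ B ∈ D
      inter∈D A B A∈ B∈ = proj₂ (to (∈-slice B) (D-least
        (λ P P∈ → from (∈-slice P) (Π⊆D P P∈ , subst (_∈ D) (∩-comm P A)
          (proj₂ (to (∈-slice A) (D-least (λ Q Q∈ → from (∈-slice Q) (Π⊆D Q Q∈ , Π⊆D _ (Π∩ P Q P∈ Q∈)))
            (slice-λSystem P (Π⊆D P P∈)) A A∈)))))
        (slice-λSystem A A∈) B B∈))

    -- Unions of arbitrary κ-sequences reduce to disjoint ones: by induction on i, the union
    -- of the first i sets is the disjoint union of the differences A_j ∖ ⋃_{j′<j} A_j′.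
    private
      module _ (𝒜 : Carrier) (h𝒜 : 𝒜 ∶ (_∈ κ) ⟶ (_∈ D)) where
        Segment : (i N : Carrier) → Set ℓ
        Segment i N = ∃ λ j → j ∈ i × ∃ λ A → ⟪ j , A ⟫ ∈ 𝒜 × N ∈ A

        SegmentIn : Carrier → Set ℓ
        SegmentIn i = ∃ λ W → W ∈ D × (W ≐ Segment i)

        Segmentᶠ : ∀ {n} → Term n → Term n → Form n
        Segmentᶠ i N = ∃ᶠ (v0 ∈ᶠ wk i ∧ᶠ ∃ᶠ (⟪ v1 , v0 ⟫ᵗ ∈ᶠ con 𝒜 ∧ᶠ wk (wk N) ∈ᶠ v0))

        step : ∀ i → (∀ j → j ∈ i → j ∈ κ) → IsTransitive i → (∀ j → j ∈ i → SegmentIn j) → SegmentIn i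
        step i i⊆κ tr ih = V , disjointUnion∈D ℬ V hℬ disjoint isUnion , hV
          where
          New : (j N : Carrier) → Set ℓ
          New j N = (j ∈ i × ∃ λ A → ⟪ j , A ⟫ ∈ 𝒜 × N ∈ A) × ¬ Segment j N
          Newᶠ : Form 3
          Newᶠ = ∀ᶠ (v0 ∈ᶠ v1 ⇔ᶠ ((v2 ∈ᶠ con i ∧ᶠ ∃ᶠ (⟪ v3 , v0 ⟫ᵗ ∈ᶠ con 𝒜 ∧ᶠ v1 ∈ᶠ v0)) ∧ᶠ ¬ᶠ (Segmentᶠ v2 v0)))
          new : ∀ j → j ∈ κ → ∃ λ B → B ∈ D × (B ≐ New j)
          new j j∈ with em {j ∈ i}
          -- Indices outside `i` contribute the empty set. The segment thus becomes the union of a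
          -- sequence indexed by all of `κ`, whatever the order type of `i`.
          ... | no j∉ = Str ∖ Str , compl∈D Str Str∈D , λ N → mk⇔
            (λ h → let (a , b) = to (∈-∖ N) h in ⊥-elim (b a)) (λ ((j∈ , _) , _) → ⊥-elim (j∉ j∈))
          ... | yes j∈i with fun-value h𝒜 j∈ | ih j j∈i
          ... | A , hA | W , W∈ , hW = A ∩ (Str ∖ W) , inter∈D A _ A∈ (compl∈D W W∈) , λ N → mk⇔
            (λ h → let (a , c) = to (∈-∩ N) h in (j∈i , A , hA , a) , λ s → proj₂ (to (∈-∖ N) c) (from (hW N) s))
            (λ ((_ , A′ , hA′ , a) , ¬s) → let a′ = subst (N ∈_) (fun-unique h𝒜 hA′ hA) a in
              from (∈-∩ N) (a′ , from (∈-∖ N) (D⊆ A∈ a′ , λ w → ¬s (to (hW N) w))))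
            where
            A∈ : A ∈ D
            A∈ = proj₂ (fun-type h𝒜 hA)
          family : ∃ λ ℬ → (ℬ ∶ (_∈ κ) ⟶ (_∈ D)) × (∀ j B → ⟪ j , B ⟫ ∈ ℬ ⇔ (j ∈ κ × (B ≐ New j)))
          family = mkFun Newᶠ (λ _ _ _ → refl) κ new (λ j B B′ _ → ≐-unique)
          ℬ : Carrier
          ℬ = proj₁ family
          hℬ : ℬ ∶ (_∈ κ) ⟶ (_∈ D)
          hℬ = proj₁ (proj₂ family)
          ∈-ℬ : ∀ j B → ⟪ j , B ⟫ ∈ ℬ ⇔ (j ∈ κ × (B ≐ New j))
          ∈-ℬ = proj₂ (proj₂ family)
          V : Carrier
          V = sep (Segmentᶠ (con i) v0) Str
          hV : V ≐ Segment i
          hV N = mk⇔ (λ h → proj₂ (to (∈-sep _ _ N) h)) λ h → let (j , _ , A , hA , N∈) = h in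
            from (∈-sep _ _ N) (D⊆ (proj₂ (fun-type h𝒜 hA)) N∈ , h)
          disjoint : Disjoint ℬ
          disjoint j j′ B B′ N hB hB′ ne N∈ N∈′ with to (∈-ℬ j B) hB | to (∈-ℬ j′ B′) hB′
          ... | j∈ , e | j′∈ , e′ with to (e N) N∈ | to (e′ N) N∈′
          ... | (_ , A , hA , a) , ¬s | (_ , A′ , hA′ , a′) , ¬s′ with trichotomy j j′ j∈ j′∈
          ... | inj₁ h        = ¬s′ (j , h , A , hA , a)
          ... | inj₂ (inj₁ h) = ne h
          ... | inj₂ (inj₂ h) = ¬s (j′ , h , A′ , hA′ , a′)
          isUnion : IsUnion ℬ V
          isUnion N = mk⇔ fwd bwd
            where
            fwd : N ∈ V → ∃₂ λ j B → ⟪ j , B ⟫ ∈ ℬ × N ∈ B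
            fwd h with to (hV N) h
            -- The least index below `i` whose set contains `N` is the one whose difference keeps
            -- `N`; transitivity of `i` ensures that smaller indices were also candidates.
            ... | j , j∈ , hj with minimal (∃ᶠ (⟪ v1 , v0 ⟫ᵗ ∈ᶠ con 𝒜 ∧ᶠ con N ∈ᶠ v0)) i j j∈ hj
            ... | m , m∈ , (A , hA , a) , min with fun-value hℬ (i⊆κ m m∈)
            ... | B , hB = m , B , hB , from (proj₂ (to (∈-ℬ m B) hB) N) ((m∈ , A , hA , a) ,
                λ (k , k∈ , hk) → min k (tr k m k∈ m∈) hk k∈)
            bwd : (∃₂ λ j B → ⟪ j , B ⟫ ∈ ℬ × N ∈ B) → N ∈ V
            bwd (j , B , hB , N∈) = let ((j∈ , hA) , _) = to (proj₂ (to (∈-ℬ j B) hB) N) N∈ in from (hV N) (j , j∈ , hA)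

        segments : ∀ j → j ∈ κ → SegmentIn j
        segments j j∈ = byContradiction λ bad → case (minimal (¬ᶠ (∃ᶠ (v0 ∈ᶠ con D ∧ᶠ ∀ᶠ (v0 ∈ᶠ v1 ⇔ᶠ Segmentᶠ v2 v0)))) κ j j∈ bad)
          where
          case : (∃ λ m → m ∈ κ × ¬ SegmentIn m × (∀ z → z ∈ κ → ¬ SegmentIn z → ¬ z ∈ m)) → ⊥
          case (m , m∈ , bad , min) = bad (step m (λ k k∈ → proj₁ ord k m k∈ m∈) (proj₂ ord m m∈)
            λ k k∈ → byContradiction λ bad′ → min k (proj₁ ord k m k∈ m∈) bad′ k∈)

        -- The whole union is the segment at `κ` itself, so the inductive step is applied once more,
        -- beyond the elements of `κ`.
        union∈D : ∀ V → IsUnion 𝒜 V → V ∈ D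
        union∈D V hV = let (W , W∈ , hW) = step κ (λ _ h → h) (proj₁ ord) segments in subst (_∈ D) (ext
          (λ N h → let (j , _ , A , hA , a) = to (hW N) h in from (hV N) (j , A , hA , a))
          (λ N h → let (j , A , hA , a) = to (hV N) h in from (hW N) (j , proj₁ (fun-type h𝒜 hA) , A , hA , a))) W∈

    algebra : ∀ {Z} → (∀ p → IsFact Z p → ∃ λ A → A ∈ Π × (A ≐ λ N → IsStructure N × p ∈ N)) → IsAlgebra Z D
    algebra h = record
      { str   = Str∈D
      ; compl = compl∈D
      ; inter = inter∈D
      ; union = λ 𝒜 V h𝒜 → union∈D 𝒜 h𝒜 V
      ; fact  = λ p hp → let (A , A∈ , e) = h p hp in A , Π⊆D A A∈ , e
      }

-- Ordered-field arithmetic in the reals of a model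

module RealLemmas {ℓ} (em : ExcludedMiddle ℓ) (M : ZFCModel ℓ) (𝓡 : Reals M) where
  open ZFCModel M using (Carrier; _∈_)
  open InModel.Reals 𝓡

  commutativeRing : CommutativeRing ℓ ℓ
  commutativeRing = record { isCommutativeRing = isCommutativeRing }

  module R = CommutativeRing commutativeRing
  module RP = Algebra.Properties.Ring R.ring
  open IsTotalOrder isTotalOrder public using (antisym) renaming (total to ≤-total; trans to ≤-trans; refl to ≤-refl)

  ⌜⌝-inj : ∀ {x y} → ⌜ x ⌝ ≡ ⌜ y ⌝ → x ≡ y
  ⌜⌝-inj {x Refinement., p} {_ Refinement., q} refl = refl

  -- The membership proof inside an element of `El` is irrelevant and cannot be projected; excluded
  -- middle recovers one.
  ⌜⌝∈ℝ : ∀ x → ⌜ x ⌝ ∈ ℝ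
  ⌜⌝∈ℝ (x Refinement., [ h ]) with em {x ∈ ℝ}
  ... | yes h′ = h′
  ... | no ¬h  = ⊥-elim-irr (¬h h)

  +-mono-≤ : ∀ {x x′ y y′} → x ≤ x′ → y ≤ y′ → x + y ≤ x′ + y′
  +-mono-≤ {x} {x′} {y} {y′} h h′ = ≤-trans (+-monoˡ-≤ x x′ y h)
    (subst₂ _≤_ (R.+-comm y x′) (R.+-comm y′ x′) (+-monoˡ-≤ y y′ x′ h′))

  0≤x² : ∀ x → 0# ≤ x * x
  0≤x² x with ≤-total 0# x
  ... | inj₁ h = *-nonneg x x h h
  ... | inj₂ h = subst (0# ≤_) -x*-x (*-nonneg (- x) (- x) 0≤-x 0≤-x)
    where
    0≤-x : 0# ≤ - x
    0≤-x = subst₂ _≤_ (R.-‿inverseʳ x) (R.+-identityˡ (- x)) (+-monoˡ-≤ x 0# (- x) h)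
    -x*-x : (- x) * (- x) ≡ x * x
    -x*-x = trans (sym (RP.-‿distribˡ-* x (- x))) (trans (cong (-_) (sym (RP.-‿distribʳ-* x x))) (RP.-‿involutive (x * x)))

  *-monoˡ-≤ : ∀ {c x y} → 0# ≤ c → x ≤ y → c * x ≤ c * y
  *-monoˡ-≤ {c} {x} {y} 0≤c h = subst₂ _≤_ (R.+-identityˡ (c * x)) eq
    (+-monoˡ-≤ 0# (c * (y + - x)) (c * x) (*-nonneg c (y + - x) 0≤c
      (subst (_≤ y + - x) (R.-‿inverseʳ x) (+-monoˡ-≤ x y (- x) h))))
    where
    eq : c * (y + - x) + c * x ≡ c * y
    eq = trans (sym (R.distribˡ c (y + - x) x)) (cong (c *_)
      (trans (R.+-assoc y (- x) x) (trans (cong (y +_) (R.-‿inverseˡ x)) (R.+-identityʳ y))))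

  -- `d` equals `c * (d * d)`, a product of non-negative numbers.
  inverse-nonneg : ∀ {c d} → 0# ≤ c → c * d ≡ 1# → 0# ≤ d
  inverse-nonneg {c} {d} 0≤c e = subst (0# ≤_) (trans (sym (R.*-assoc c d d)) (trans (cong (_* d) e) (R.*-identityˡ d)))
    (*-nonneg c (d * d) 0≤c (0≤x² d))

-- Finite additivity and independence for κ-measures

module Measure {ℓ} (em : ExcludedMiddle ℓ) (M : ZFCModel ℓ) (κ X 𝓛 : ZFCModel.Carrier M)
               (ord : InModel.IsOrdinal M κ) (inf : InModel.IsInfinite M κ)
               (rel : InModel.IsRelationalLanguage M 𝓛) (𝓡 : Reals M) (μ : ZFCModel.Carrier M)
               (prob : InModel.Structures.Measures.IsProbabilityκMeasure M κ X 𝓛 𝓡 μ) where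
  open ZFCModel M
  open InModel M
  open SetTheory em M
  open Structures κ X 𝓛
  open Codes em M κ X 𝓛 rel
  open Dynkin em M κ X 𝓛 ord rel
  open Measures 𝓡
  open InModel.Reals 𝓡
  open RealLemmas em M 𝓡
  open IsProbabilityκMeasure prob

  measure-unique : ∀ {A r s} → ⟪ A , ⌜ r ⌝ ⟫ ∈ μ → ⟪ A , ⌜ s ⌝ ⟫ ∈ μ → r ≡ s
  measure-unique h h′ = ⌜⌝-inj (fun-unique isFunction h h′)

  measurable : ∀ {A r} → ⟪ A , r ⟫ ∈ μ → IsMeasurable A
  measurable h = proj₁ (fun-type isFunction h)

  abstract
    measure : ∀ {A} → IsMeasurable A → ∃ λ r → ⟪ A , ⌜ r ⌝ ⟫ ∈ μ
    measure hA = let (r , h) = fun-value isFunction hA in (r Refinement., [ proj₂ (fun-type isFunction h) ]) , h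

  abstract
    -- A union of two sets is treated as a κ-union by placing them at two distinct indices, with the
    -- empty set at all others; the infinite `κ` has such indices.
    two : ∃₂ λ p q → p ∈ κ × q ∈ κ × p ≢ q
    two = byContradiction λ none → inf (finite none)
      where
      finite : ¬ (∃₂ λ p q → p ∈ κ × q ∈ κ × p ≢ q) → IsFinite κ
      finite none with em {∃ λ p → p ∈ κ}
      ... | no empty = ∅ , ∅ , nat-∅ , ∅-fun , (λ x x′ y h → ⊥-elim (∉∅ _ h)) , (λ y y∈ → ⊥-elim (empty (y , y∈)))
      ... | yes (p , p∈) = S ∅ , ∅ ◂ ⟪ ∅ , p ⟫ , nat-S nat-∅ , ◂-fun ∅-fun p∈ ,
        (λ x x′ y h h′ → trans (first h) (sym (first h′))) ,
        (λ y y∈ → ∅ , subst (λ y → ⟪ ∅ , y ⟫ ∈ ∅ ◂ ⟪ ∅ , p ⟫)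
          (byContradiction λ ne → none (p , y , p∈ , y∈ , ne)) ◂ʳ)
        where
        first : ∀ {x y} → ⟪ x , y ⟫ ∈ ∅ ◂ ⟪ ∅ , p ⟫ → x ≡ ∅
        first h with to (∈-◂ _) h
        ... | inj₁ h′ = ⊥-elim (∉∅ _ h′)
        ... | inj₂ e  = proj₁ (⟪⟫-inj e)

  p q : Carrier
  p = proj₁ two
  q = proj₁ (proj₂ two)
  p∈ : p ∈ κ
  p∈ = proj₁ (proj₂ (proj₂ two))
  q∈ : q ∈ κ
  q∈ = proj₁ (proj₂ (proj₂ (proj₂ two)))
  p≢q : p ≢ q
  p≢q = proj₂ (proj₂ (proj₂ (proj₂ two)))

  complement-measurable : ∀ {A B} → IsMeasurable A → (B ≐ λ N → IsStructure N × ¬ N ∈ A) → IsMeasurable B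
  complement-measurable hA hB 𝓢 alg = IsκAlgebra.complement alg _ _ (hA 𝓢 alg) hB

  -- κ-algebras are closed under unions of sets that embed in `κ`, not of sequences. The range of
  -- `𝒜` embeds by choosing one index for each of its members.
  union-measurable : ∀ {𝒜 V} → (𝒜 ∶ (_∈ κ) ⟶ IsMeasurable) → IsUnion 𝒜 V → IsMeasurable V
  union-measurable {𝒜} {V} h𝒜 hV 𝓢 alg = IsκAlgebra.unions alg ran V
      (λ A A∈ → let (i , h) = proj₂ (to (∈-ran A) A∈) in proj₂ (fun-type h𝒜 h) 𝓢 alg)
      (proj₁ g , proj₁ (proj₂ g) , λ A A′ i h h′ →
        fun-unique h𝒜 (proj₁ (proj₂ (to (proj₂ (proj₂ g) A i) h))) (proj₁ (proj₂ (to (proj₂ (proj₂ g) A′ i) h′))))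
      λ N → mk⇔ (λ h → let (i , A , hA , N∈) = to (hV N) h in A , from (∈-ran A) (fieldʳ hA , i , hA) , N∈)
                (λ (A , A∈ , N∈) → let (i , h) = proj₂ (to (∈-ran A) A∈) in from (hV N) (i , A , h , N∈))
    where
    ran : Carrier
    ran = sep (∃ᶠ (⟪ v0 , v1 ⟫ᵗ ∈ᶠ con 𝒜)) (field′ 𝒜)
    ∈-ran : ∀ A → A ∈ ran ⇔ (A ∈ field′ 𝒜 × ∃ λ i → ⟪ i , A ⟫ ∈ 𝒜)
    ∈-ran = ∈-sep _ _
    c : Carrier
    c = proj₁ (section h𝒜)
    g : ∃ λ g → (g ∶ (_∈ ran) ⟶ (_∈ κ)) × (∀ A i → ⟪ A , i ⟫ ∈ g ⇔ (A ∈ ran × ⟪ i , A ⟫ ∈ 𝒜 × i ∈ c))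
    g = mkFun (⟪ v0 , v1 ⟫ᵗ ∈ᶠ con 𝒜 ∧ᶠ v0 ∈ᶠ con c) (λ _ _ _ → refl) ran
      (λ A A∈ → let (i , (i∈c , h) , _) = proj₂ (section h𝒜) (proj₂ (proj₂ (to (∈-ran A) A∈))) in
        i , proj₁ (fun-type h𝒜 h) , h , i∈c)
      (λ A i i′ A∈ (h , i∈) (h′ , i′∈) → let (_ , _ , u) = proj₂ (section h𝒜) h in trans (u i i∈ h) (sym (u i′ i′∈ h′)))

  module Pair (A B : Carrier) where
    private
      Pairᶠ : Form 3
      Pairᶠ = (v1 ≡ᶠ con p ∧ᶠ v0 ≡ᶠ con A) ∨ᶠ (v1 ≡ᶠ con q ∧ᶠ v0 ≡ᶠ con B) ∨ᶠ
              ((¬ᶠ (v1 ≡ᶠ con p) ∧ᶠ ¬ᶠ (v1 ≡ᶠ con q)) ∧ᶠ v0 ≡ᶠ con ∅)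

    At : (i C : Carrier) → Set ℓ
    At i C = (i ≡ p × C ≡ A) ⊎ (i ≡ q × C ≡ B) ⊎ ((i ≢ p × i ≢ q) × C ≡ ∅)

    at-unique : ∀ i C C′ → i ∈ κ → At i C → At i C′ → C ≡ C′
    at-unique i C C′ _ (inj₁ (_ , e)) (inj₁ (_ , e′)) = trans e (sym e′)
    at-unique i C C′ _ (inj₁ (e , _)) (inj₂ (inj₁ (e′ , _))) = ⊥-elim (p≢q (trans (sym e) e′))
    at-unique i C C′ _ (inj₁ (e , _)) (inj₂ (inj₂ ((ne , _) , _))) = ⊥-elim (ne e)
    at-unique i C C′ _ (inj₂ (inj₁ (e , _))) (inj₁ (e′ , _)) = ⊥-elim (p≢q (trans (sym e′) e))
    at-unique i C C′ _ (inj₂ (inj₁ (_ , e))) (inj₂ (inj₁ (_ , e′))) = trans e (sym e′)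
    at-unique i C C′ _ (inj₂ (inj₁ (e , _))) (inj₂ (inj₂ ((_ , ne) , _))) = ⊥-elim (ne e)
    at-unique i C C′ _ (inj₂ (inj₂ ((ne , _) , _))) (inj₁ (e , _)) = ⊥-elim (ne e)
    at-unique i C C′ _ (inj₂ (inj₂ ((_ , ne) , _))) (inj₂ (inj₁ (e , _))) = ⊥-elim (ne e)
    at-unique i C C′ _ (inj₂ (inj₂ (_ , e))) (inj₂ (inj₂ (_ , e′))) = trans e (sym e′)

    module _ (hA : IsMeasurable A) (hB : IsMeasurable B) where
      private
        val : ∀ i → i ∈ κ → ∃ λ C → IsMeasurable C × At i C
        val i i∈ with em {i ≡ p} | em {i ≡ q}
        ... | yes e | _     = A , hA , inj₁ (e , refl)
        ... | no _  | yes e = B , hB , inj₂ (inj₁ (e , refl))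
        ... | no ne | no ne′ = ∅ , measurable empty , inj₂ (inj₂ ((ne , ne′) , refl))

      abstract
        family : ∃ λ 𝒜 → (𝒜 ∶ (_∈ κ) ⟶ IsMeasurable) × (∀ i C → ⟪ i , C ⟫ ∈ 𝒜 ⇔ (i ∈ κ × At i C))
        family = mkFun Pairᶠ (λ _ _ _ → refl) κ val at-unique

      family-union : ∀ {V} → (V ≐ λ N → N ∈ A ⊎ N ∈ B) → IsUnion (proj₁ family) V
      family-union {V} hV N = mk⇔ fwd bwd
        where
        fwd : N ∈ V → ∃₂ λ i C → ⟪ i , C ⟫ ∈ proj₁ family × N ∈ C
        fwd h with to (hV N) h
        ... | inj₁ a = p , A , from (proj₂ (proj₂ family) p A) (p∈ , inj₁ (refl , refl)) , a
        ... | inj₂ b = q , B , from (proj₂ (proj₂ family) q B) (q∈ , inj₂ (inj₁ (refl , refl))) , b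
        bwd : (∃₂ λ i C → ⟪ i , C ⟫ ∈ proj₁ family × N ∈ C) → N ∈ V
        bwd (i , C , hC , N∈) with proj₂ (to (proj₂ (proj₂ family) i C) hC)
        ... | inj₁ (_ , refl)        = from (hV N) (inj₁ N∈)
        ... | inj₂ (inj₁ (_ , refl)) = from (hV N) (inj₂ N∈)
        ... | inj₂ (inj₂ (_ , refl)) = ⊥-elim (∉∅ N N∈)

      family-disjoint : (∀ N → N ∈ A → ¬ N ∈ B) → Disjoint (proj₁ family)
      family-disjoint dis i j C C′ N hC hC′ ne N∈ N∈′
        with proj₂ (to (proj₂ (proj₂ family) i C) hC) | proj₂ (to (proj₂ (proj₂ family) j C′) hC′)
      ... | inj₁ (e , _)           | inj₁ (e′ , _)          = ne (trans e (sym e′))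
      ... | inj₁ (_ , refl)        | inj₂ (inj₁ (_ , refl)) = dis N N∈ N∈′
      ... | _                      | inj₂ (inj₂ (_ , refl)) = ∉∅ N N∈′
      ... | inj₂ (inj₁ (_ , refl)) | inj₁ (_ , refl)        = dis N N∈′ N∈
      ... | inj₂ (inj₁ (e , _))    | inj₂ (inj₁ (e′ , _))   = ne (trans e (sym e′))
      ... | inj₂ (inj₂ (_ , refl)) | _                      = ∉∅ N N∈

  ∪-measurable : ∀ {A B V} → IsMeasurable A → IsMeasurable B → (V ≐ λ N → N ∈ A ⊎ N ∈ B) → IsMeasurable V
  ∪-measurable {A} {B} hA hB hV = union-measurable (proj₁ (proj₂ (Pair.family A B hA hB))) (Pair.family-union A B hA hB hV)

  -- `𝒫 Str` is itself one of the κ-algebras over which measurability quantifies.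
  measurable⊆Str : ∀ {A} → IsMeasurable A → A ∈ 𝒫 Str
  measurable⊆Str hA = hA (𝒫 Str) (record
    { subsets    = λ A → 𝒫Str
    ; literals   = λ m l a A _ _ _ e → structures λ N N∈ → proj₁ (to (e N) N∈)
    ; complement = λ A B _ e → structures λ N N∈ → proj₁ (to (e N) N∈)
    ; unions     = λ 𝒜 V h _ e → structures λ N N∈ → let (A , A∈ , N∈A) = to (e N) N∈ in 𝒫Str (h A A∈) N N∈A
    })

  ∖-measurable : ∀ {A} → IsMeasurable A → IsMeasurable (Str ∖ A)
  ∖-measurable hA = complement-measurable hA λ N → mk⇔
    (λ h → let (a , b) = to (∈-∖ N) h in to (∈-Str N) a , b) (λ (a , b) → from (∈-∖ N) (from (∈-Str N) a , b))

  ∩-measurable : ∀ {A B} → IsMeasurable A → IsMeasurable B → IsMeasurable (A ∩ B)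
  ∩-measurable {A} {B} hA hB = complement-measurable
    (∪-measurable (∖-measurable hA) (∖-measurable hB) (λ N → ∈-∪ N))
    λ N → mk⇔
      (λ h → let (a , b) = to (∈-∩ N) h in 𝒫Str (measurable⊆Str hA) N a ,
        λ h′ → [ (λ x → proj₂ (to (∈-∖ N) x) a) , (λ x → proj₂ (to (∈-∖ N) x) b) ]′ (to (∈-∪ N) h′))
      (λ (hN , h) → from (∈-∩ N)
        ( byContradiction (λ ¬a → h (from (∈-∪ N) (inj₁ (from (∈-∖ N) (from (∈-Str N) hN , ¬a)))))
        , byContradiction (λ ¬b → h (from (∈-∪ N) (inj₂ (from (∈-∖ N) (from (∈-Str N) hN , ¬b)))))))

  -- Formulas can refer to the arithmetic of `El` only through these graphs.
  plus times : Carrier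
  plus = proj₁ +-internal
  times = proj₁ *-internal

  ∈-plus : ∀ x y {z} → ⟪ ⟪ ⌜ x ⌝ , ⌜ y ⌝ ⟫ , z ⟫ ∈ plus ⇔ z ≡ ⌜ x + y ⌝
  ∈-plus x y {z} = mk⇔ to′ λ { refl → from (proj₂ +-internal _) (x , y , refl) }
    where
    to′ : ⟪ ⟪ ⌜ x ⌝ , ⌜ y ⌝ ⟫ , z ⟫ ∈ plus → z ≡ ⌜ x + y ⌝
    to′ h with to (proj₂ +-internal _) h
    ... | x′ , y′ , e with ⟪⟫-inj e
    ... | e₁ , e₂ with ⟪⟫-inj e₁
    ... | ex , ey = trans e₂ (cong₂ (λ a b → ⌜ a + b ⌝) (sym (⌜⌝-inj ex)) (sym (⌜⌝-inj ey)))

  ∈-times : ∀ x y {z} → ⟪ ⟪ ⌜ x ⌝ , ⌜ y ⌝ ⟫ , z ⟫ ∈ times ⇔ z ≡ ⌜ x * y ⌝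
  ∈-times x y {z} = mk⇔ to′ λ { refl → from (proj₂ *-internal _) (x , y , refl) }
    where
    to′ : ⟪ ⟪ ⌜ x ⌝ , ⌜ y ⌝ ⟫ , z ⟫ ∈ times → z ≡ ⌜ x * y ⌝
    to′ h with to (proj₂ *-internal _) h
    ... | x′ , y′ , e with ⟪⟫-inj e
    ... | e₁ , e₂ with ⟪⟫-inj e₁
    ... | ex , ey = trans e₂ (cong₂ (λ a b → ⌜ a * b ⌝) (sym (⌜⌝-inj ex)) (sym (⌜⌝-inj ey)))

  real : ∀ {x} → x ∈ ℝ → ∃ λ r → ⌜ r ⌝ ≡ x
  real {x} h = (x Refinement., [ h ]) , refl

  -- The sum is a supremum over finite lists of distinct indices. Such a list meets `p` and `q` at
  -- most once each, so no partial sum exceeds `x + y`, and the list consisting of `p` and `q`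
  -- attains it.
  module TwoTerms {f : Carrier} {x y : El} (hf : f ∶ (_∈ κ) ⟶ (_∈ ℝ)) (0≤x : 0# ≤ x) (0≤y : 0# ≤ y)
                  (fp : ⟪ p , ⌜ x ⌝ ⟫ ∈ f) (fq : ⟪ q , ⌜ y ⌝ ⟫ ∈ f)
                  (f0 : ∀ i → i ∈ κ → i ≢ p → i ≢ q → ⟪ i , ⌜ 0# ⌝ ⟫ ∈ f) where

    module _ {n e g : Carrier} {s : El} (hn : IsNat n) (he : e ∶ (_∈ n) ⟶ (_∈ κ)) (e-inj : IsInjective e)
             (hg : g ∶ (_∈ S n) ⟶ (_∈ ℝ)) (g0 : ⟪ ∅ , ⌜ 0# ⌝ ⟫ ∈ g)
             (gS : ∀ k i x y → k ∈ n → ⟪ k , i ⟫ ∈ e → ⟪ i , ⌜ x ⌝ ⟫ ∈ f → ⟪ k , ⌜ y ⌝ ⟫ ∈ g → ⟪ S k , ⌜ y + x ⌝ ⟫ ∈ g)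
             (gn : ⟪ n , ⌜ s ⌝ ⟫ ∈ g) where

      private
        Used : (i k : Carrier) → Set ℓ
        Used i k = ∃ λ j → j ∈ k × ⟪ j , i ⟫ ∈ e

        Lump : (i z k a : Carrier) → Set ℓ
        Lump i z k a = (a ≡ ⌜ 0# ⌝ × ¬ Used i k) ⊎ (a ≡ z × Used i k)

        lump-other : ∀ {i z k a} → ¬ ⟪ k , i ⟫ ∈ e → Lump i z k a → Lump i z (S k) a
        lump-other {i} {z} {k} ne (inj₁ (ea , nu)) = inj₁ (ea , λ (j , j∈ , h) →
          [ (λ j∈k → nu (j , j∈k , h)) , (λ { refl → ne h }) ]′ (to (∈-S k j) j∈))
        lump-other ne (inj₂ (ea , j , j∈ , h)) = inj₂ (ea , j , ∈-Sˡ j∈ , h)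

        -- Injectivity of the list `e` excludes an earlier occurrence of `i`, so the contribution of
        -- `i` was still zero.
        lump-hit : ∀ {i z k a} → ⟪ k , i ⟫ ∈ e → Lump i z k a → a ≡ ⌜ 0# ⌝ × Lump i z (S k) z
        lump-hit {k = k} h (inj₁ (ea , nu)) = ea , inj₂ (refl , k , ∈-Sʳ , h)
        lump-hit {k = k} h (inj₂ (_ , j , j∈ , h′)) = ⊥-elim (∈-irrefl k (subst (_∈ k) (e-inj j k _ h′ h) j∈))

        Usedᶠ : ∀ {n} → Carrier → Term n → Form n
        Usedᶠ i k = ∃ᶠ (v0 ∈ᶠ wk k ∧ᶠ ⟪ v0 , con i ⟫ᵗ ∈ᶠ con e)

        Lumpᶠ : ∀ {n} → Carrier → Carrier → Term n → Term n → Form n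
        Lumpᶠ i z k a = (a ≡ᶠ con ⌜ 0# ⌝ ∧ᶠ ¬ᶠ (Usedᶠ i k)) ∨ᶠ (a ≡ᶠ con z ∧ᶠ Usedᶠ i k)

        -- The k-th partial sum is a + b, where a ∈ {0, x} and b ∈ {0, y} record whether the
        -- indices p and q have occurred among the first k ones.
        State : Carrier → Set ℓ
        State k = k ∈ S n → ∃ λ a → ∃ λ b → ∃ λ w → ⟪ ⟪ a , b ⟫ , w ⟫ ∈ plus × ⟪ k , w ⟫ ∈ g ×
                  Lump p ⌜ x ⌝ k a × Lump q ⌜ y ⌝ k b

        Stateᶠ : Form 1
        Stateᶠ = v0 ∈ᶠ con (S n) ⇒ᶠ ∃ᶠ (∃ᶠ (∃ᶠ (⟪ ⟪ v2 , v1 ⟫ᵗ , v0 ⟫ᵗ ∈ᶠ con plus ∧ᶠ ⟪ v3 , v0 ⟫ᵗ ∈ᶠ con g ∧ᶠ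
          Lumpᶠ p ⌜ x ⌝ v3 v2 ∧ᶠ Lumpᶠ q ⌜ y ⌝ v3 v1)))

        lump-real : ∀ {i k a} z → Lump i ⌜ z ⌝ k a → ∃ λ r → ⌜ r ⌝ ≡ a
        lump-real z (inj₁ (e , _)) = 0# , sym e
        lump-real z (inj₂ (e , _)) = z , sym e

        start : State ∅
        start _ = ⌜ 0# ⌝ , ⌜ 0# ⌝ , ⌜ 0# ⌝ , from (∈-plus 0# 0#) (cong ⌜_⌝ (sym (R.+-identityˡ 0#))) , g0 ,
          inj₁ (refl , λ (j , j∈ , _) → ∉∅ j j∈) , inj₁ (refl , λ (j , j∈ , _) → ∉∅ j j∈)

        next : ∀ k → IsNat k → State k → State (S k)
        next k hk ih Sk∈ with S∈S⇒∈ hn Sk∈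
        ... | k∈ with ih (∈-Sˡ k∈) | fun-value he k∈
        ... | a′ , b′ , w′ , hw , gk , la , lb | i , ei with lump-real x la | lump-real y lb
        ... | a , refl | b , refl with to (∈-plus a b) hw
        ... | refl with em {i ≡ p} | em {i ≡ q}
        ... | yes refl | yes e = ⊥-elim (p≢q e)
        ... | yes refl | no ne = let (a≡0 , la′) = lump-hit ei la in
          ⌜ x ⌝ , ⌜ b ⌝ , _ , from (∈-plus x b) (cong ⌜_⌝ (trans (cong (λ a → a + b + x) (⌜⌝-inj a≡0))
            (trans (cong (_+ x) (R.+-identityˡ b)) (R.+-comm b x)))) , gS k p x (a + b) k∈ ei fp gk ,
          la′ , lump-other (λ h → ne (fun-unique he ei h)) lb
        ... | no ne | yes refl = let (b≡0 , lb′) = lump-hit ei lb in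
          ⌜ a ⌝ , ⌜ y ⌝ , _ , from (∈-plus a y) (cong (λ z → ⌜ z + y ⌝) (trans (cong (a +_) (⌜⌝-inj b≡0)) (R.+-identityʳ a))) ,
          gS k q y (a + b) k∈ ei fq gk , lump-other (λ h → ne (fun-unique he ei h)) la , lb′
        ... | no ne | no ne′ =
          ⌜ a ⌝ , ⌜ b ⌝ , _ , from (∈-plus a b) (cong ⌜_⌝ (R.+-identityʳ (a + b))) ,
          gS k i 0# (a + b) k∈ ei (f0 i (proj₂ (fun-type he ei)) ne ne′) gk ,
          lump-other (λ h → ne (fun-unique he ei h)) la , lump-other (λ h → ne′ (fun-unique he ei h)) lb

        lump-≤ : ∀ {i z k a} → 0# ≤ z → Lump i ⌜ z ⌝ k ⌜ a ⌝ → a ≤ z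
        lump-≤ 0≤z (inj₁ (e , _)) = subst (_≤ _) (sym (⌜⌝-inj e)) 0≤z
        lump-≤ 0≤z (inj₂ (e , _)) = subst (_≤ _) (sym (⌜⌝-inj e)) ≤-refl

      partialSum-≤ : s ≤ x + y
      partialSum-≤ with natInd Stateᶠ start next n hn ∈-Sʳ
      ... | a′ , b′ , w′ , hw , gk , la , lb with lump-real x la | lump-real y lb
      ... | a , refl | b , refl = subst (_≤ x + y)
        (⌜⌝-inj (trans (sym (to (∈-plus a b) hw)) (fun-unique hg gk gn))) (+-mono-≤ (lump-≤ 0≤x la) (lump-≤ 0≤y lb))

    partialSum : IsFinitePartialSum κ f (x + y)
    partialSum = S (S ∅) , e , g , nat-S (nat-S nat-∅) , e-fun , e-inj , g-fun , g₀ , clause ,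
        subst (λ z → ⟪ S (S ∅) , ⌜ z ⌝ ⟫ ∈ g) (cong (_+ y) (R.+-identityˡ x)) g₂
      where
      e g : Carrier
      e = (∅ ◂ ⟪ ∅ , p ⟫) ◂ ⟪ S ∅ , q ⟫
      g = ((∅ ◂ ⟪ ∅ , ⌜ 0# ⌝ ⟫) ◂ ⟪ S ∅ , ⌜ 0# + x ⌝ ⟫) ◂ ⟪ S (S ∅) , ⌜ 0# + x + y ⌝ ⟫
      e-fun : e ∶ (_∈ S (S ∅)) ⟶ (_∈ κ)
      e-fun = ◂-fun (◂-fun ∅-fun p∈) q∈
      g-fun : g ∶ (_∈ S (S (S ∅))) ⟶ (_∈ ℝ)
      g-fun = ◂-fun (◂-fun (◂-fun ∅-fun (⌜⌝∈ℝ 0#)) (⌜⌝∈ℝ (0# + x))) (⌜⌝∈ℝ (0# + x + y))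
      e-spec : ∀ {k i} → ⟪ k , i ⟫ ∈ e → (k ≡ ∅ × i ≡ p) ⊎ (k ≡ S ∅ × i ≡ q)
      e-spec h with to (∈-◂ _) h
      ... | inj₂ h′ = inj₂ (⟪⟫-inj h′)
      ... | inj₁ h′ with to (∈-◂ _) h′
      ... | inj₁ h″ = ⊥-elim (∉∅ _ h″)
      ... | inj₂ h″ = inj₁ (⟪⟫-inj h″)
      e-inj : IsInjective e
      e-inj k k′ i h h′ with e-spec h | e-spec h′
      ... | inj₁ (a , _) | inj₁ (b , _) = trans a (sym b)
      ... | inj₂ (a , _) | inj₂ (b , _) = trans a (sym b)
      ... | inj₁ (_ , a) | inj₂ (_ , b) = ⊥-elim (p≢q (trans (sym a) b))
      ... | inj₂ (_ , a) | inj₁ (_ , b) = ⊥-elim (p≢q (trans (sym b) a))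
      g₀ : ⟪ ∅ , ⌜ 0# ⌝ ⟫ ∈ g
      g₀ = ◂ˡ (◂ˡ ◂ʳ)
      g₁ : ⟪ S ∅ , ⌜ 0# + x ⌝ ⟫ ∈ g
      g₁ = ◂ˡ ◂ʳ
      g₂ : ⟪ S (S ∅) , ⌜ 0# + x + y ⌝ ⟫ ∈ g
      g₂ = ◂ʳ
      clause : ∀ k i x y → k ∈ S (S ∅) → ⟪ k , i ⟫ ∈ e → ⟪ i , ⌜ x ⌝ ⟫ ∈ f → ⟪ k , ⌜ y ⌝ ⟫ ∈ g → ⟪ S k , ⌜ y + x ⌝ ⟫ ∈ g
      clause k i x′ y′ _ ek fi gk = [ case₀ , case₁ ]′ (e-spec ek)
        where
        case₀ : k ≡ ∅ × i ≡ p → ⟪ S k , ⌜ y′ + x′ ⌝ ⟫ ∈ g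
        case₀ (ek , ei) = subst₂ (λ k z → ⟪ S k , ⌜ z ⌝ ⟫ ∈ g) (sym ek) (sym (cong₂ _+_
          (⌜⌝-inj {y′} {0#} (fun-unique g-fun (subst (λ k → ⟪ k , ⌜ y′ ⌝ ⟫ ∈ g) ek gk) g₀))
          (⌜⌝-inj {x′} {x} (fun-unique hf (subst (λ i → ⟪ i , ⌜ x′ ⌝ ⟫ ∈ f) ei fi) fp)))) g₁
        case₁ : k ≡ S ∅ × i ≡ q → ⟪ S k , ⌜ y′ + x′ ⌝ ⟫ ∈ g
        case₁ (ek , ei) = subst₂ (λ k z → ⟪ S k , ⌜ z ⌝ ⟫ ∈ g) (sym ek) (sym (cong₂ _+_
          (⌜⌝-inj {y′} {0# + x} (fun-unique g-fun (subst (λ k → ⟪ k , ⌜ y′ ⌝ ⟫ ∈ g) ek gk) g₁))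
          (⌜⌝-inj {x′} {y} (fun-unique hf (subst (λ i → ⟪ i , ⌜ x′ ⌝ ⟫ ∈ f) ei fi) fq)))) g₂

    sum : ∀ {r} → IsSum κ f r → r ≡ x + y
    sum {r} (ub , least) = antisym (least (x + y) λ s (n , e , g , hn , he , inj , hg , g0 , gS , gn) →
                             partialSum-≤ hn he inj hg g0 gS gn) (ub (x + y) partialSum)

  additive : ∀ {A B V} x y r → (∀ N → N ∈ A → ¬ N ∈ B) → (V ≐ λ N → N ∈ A ⊎ N ∈ B) →
             ⟪ A , ⌜ x ⌝ ⟫ ∈ μ → ⟪ B , ⌜ y ⌝ ⟫ ∈ μ → ⟪ V , ⌜ r ⌝ ⟫ ∈ μ → r ≡ x + y
  additive {A} {B} {V} x y r dis hV hA hB hr =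
    TwoTerms.sum hf (nonneg A x hA) (nonneg B y hB)
      (composite-∈ comp (at p A p∈ (inj₁ (refl , refl))) hA)
      (composite-∈ comp (at q B q∈ (inj₂ (inj₁ (refl , refl)))) hB)
      (λ i i∈ ne ne′ → composite-∈ comp (at i ∅ i∈ (inj₂ (inj₂ ((ne , ne′) , refl)))) empty)
      (κ-additive 𝒜 (μ ⊙ 𝒜) V r h𝒜 (family-disjoint (measurable hA) (measurable hB) dis) comp
        (family-union (measurable hA) (measurable hB) hV) hr)
    where
    open Pair A B
    𝒜 : Carrier
    𝒜 = proj₁ (family (measurable hA) (measurable hB))
    h𝒜 : 𝒜 ∶ (_∈ κ) ⟶ IsMeasurable
    h𝒜 = proj₁ (proj₂ (family (measurable hA) (measurable hB)))
    at : ∀ i C → i ∈ κ → At i C → ⟪ i , C ⟫ ∈ 𝒜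
    at i C i∈ h = from (proj₂ (proj₂ (family (measurable hA) (measurable hB))) i C) (i∈ , h)
    comp : IsComposite (μ ⊙ 𝒜) μ 𝒜
    comp = ⊙-isComposite μ 𝒜
    hf : (μ ⊙ 𝒜) ∶ (_∈ κ) ⟶ (_∈ ℝ)
    hf = composite-fun comp h𝒜 isFunction

  difference-value : ∀ {A B C} x y z → (∀ N → N ∈ A → N ∈ B) → (C ≐ λ N → N ∈ B × ¬ N ∈ A) →
                     ⟪ A , ⌜ x ⌝ ⟫ ∈ μ → ⟪ B , ⌜ y ⌝ ⟫ ∈ μ → ⟪ C , ⌜ z ⌝ ⟫ ∈ μ → y ≡ x + z
  difference-value {A} {B} {C} x y z s hC hA hB hz = additive x z y (λ N a c → proj₂ (to (hC N) c) a)
    (λ N → mk⇔ (split N) [ s N , (λ c → proj₁ (to (hC N) c)) ]′) hA hz hB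
    where
    split : ∀ N → N ∈ B → N ∈ A ⊎ N ∈ C
    split N b with em {N ∈ A}
    ... | yes a = inj₁ a
    ... | no ¬a = inj₂ (from (hC N) (b , ¬a))

  monotone : ∀ {A B} x y → (∀ N → N ∈ A → N ∈ B) → ⟪ A , ⌜ x ⌝ ⟫ ∈ μ → ⟪ B , ⌜ y ⌝ ⟫ ∈ μ → x ≤ y
  monotone {A} {B} x y s hA hB =
    let hC = difference-measurable ; (z , hz) = measure hC in
    subst₂ _≤_ (R.+-identityʳ x) (sym (difference-value x y z s (λ N → mk⇔
        (λ h → let (b , c) = to (∈-∩ N) h in b , proj₂ (to (∈-∖ N) c))
        (λ (b , ¬a) → from (∈-∩ N) (b , from (∈-∖ N) (to (∈-𝒫 B) (measurable⊆Str (measurable hB)) N b , ¬a))))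
      hA hB hz)) (+-mono-≤ ≤-refl (nonneg _ z hz))
    where
    difference-measurable : IsMeasurable (B ∩ (Str ∖ A))
    difference-measurable = ∩-measurable (measurable hB) (∖-measurable (measurable hA))

  abstract
    scaleFun : ∀ c → ∃ λ m → (m ∶ (_∈ ℝ) ⟶ (_∈ ℝ)) × (∀ x y → ⟪ x , y ⟫ ∈ m ⇔ (x ∈ ℝ × ⟪ ⟪ ⌜ c ⌝ , x ⟫ , y ⟫ ∈ times))
    scaleFun c = mkFun (⟪ ⟪ con ⌜ c ⌝ , v1 ⟫ᵗ , v0 ⟫ᵗ ∈ᶠ con times) (λ _ _ _ → refl) ℝ val uniq
      where
      val : ∀ x → x ∈ ℝ → ∃ λ y → y ∈ ℝ × ⟪ ⟪ ⌜ c ⌝ , x ⟫ , y ⟫ ∈ times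
      val x x∈ with real x∈
      ... | r , refl = ⌜ c * r ⌝ , ⌜⌝∈ℝ (c * r) , from (∈-times c r) refl
      uniq : ∀ x y y′ → x ∈ ℝ → ⟪ ⟪ ⌜ c ⌝ , x ⟫ , y ⟫ ∈ times → ⟪ ⟪ ⌜ c ⌝ , x ⟫ , y′ ⟫ ∈ times → y ≡ y′
      uniq x y y′ x∈ h h′ with real x∈
      ... | r , refl = trans (to (∈-times c r) h) (sym (to (∈-times c r) h′))

  partialSum-scale : ∀ {f f′ c s} → (f ∶ (_∈ κ) ⟶ (_∈ ℝ)) → (f′ ∶ (_∈ κ) ⟶ (_∈ ℝ)) →
    (∀ i x → ⟪ i , ⌜ x ⌝ ⟫ ∈ f → ⟪ i , ⌜ c * x ⌝ ⟫ ∈ f′) → IsFinitePartialSum κ f s → IsFinitePartialSum κ f′ (c * s)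
  partialSum-scale {f} {f′} {c} {s} hf hf′ sc (n , e , g , hn , he , inj , hg , g0 , gS , gn) =
    n , e , m ⊙ g , hn , he , inj , composite-fun comp hg hm ,
      subst (λ z → ⟪ ∅ , ⌜ z ⌝ ⟫ ∈ m ⊙ g) (R.zeroʳ c) (scaled 0# g0) , clause , scaled s gn
    where
    m : Carrier
    m = proj₁ (scaleFun c)
    hm : m ∶ (_∈ ℝ) ⟶ (_∈ ℝ)
    hm = proj₁ (proj₂ (scaleFun c))
    comp : IsComposite (m ⊙ g) m g
    comp = ⊙-isComposite m g
    scaled : ∀ {k} y → ⟪ k , ⌜ y ⌝ ⟫ ∈ g → ⟪ k , ⌜ c * y ⌝ ⟫ ∈ m ⊙ g
    scaled y h = composite-∈ comp h (from (proj₂ (proj₂ (scaleFun c)) _ _) (⌜⌝∈ℝ y , from (∈-times c y) refl))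
    clause : ∀ k i x y → k ∈ n → ⟪ k , i ⟫ ∈ e → ⟪ i , ⌜ x ⌝ ⟫ ∈ f′ → ⟪ k , ⌜ y ⌝ ⟫ ∈ m ⊙ g → ⟪ S k , ⌜ y + x ⌝ ⟫ ∈ m ⊙ g
    clause k i x y k∈ ek fi gk with fun-value hf (proj₂ (fun-type he ek)) | fun-value hg (∈-Sˡ k∈)
    ... | x₀ , hx₀ | y₀ , hy₀ with real (proj₂ (fun-type hf hx₀)) | real (proj₂ (fun-type hg hy₀))
    ... | x₁ , refl | y₁ , refl = subst (λ z → ⟪ S k , ⌜ z ⌝ ⟫ ∈ m ⊙ g)
      (trans (R.distribˡ c y₁ x₁) (cong₂ _+_
        (⌜⌝-inj {c * y₁} {y} (fun-unique (composite-fun comp hg hm) (scaled y₁ hy₀) gk))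
        (⌜⌝-inj {c * x₁} {x} (fun-unique hf′ (sc i x₁ hx₀) fi))))
      (scaled (y₁ + x₁) (gS k i x₁ y₁ k∈ ek hx₀ hy₀))

  -- Multiplication by `c` carries partial sums of `f` to partial sums of `f′`, and multiplication
  -- by the inverse `d` carries them back. Both preserve order, so least upper bounds correspond;
  -- the way back is what requires `c` to be nonzero.
  sum-scale : ∀ {f f′ c r r′} → (f ∶ (_∈ κ) ⟶ (_∈ ℝ)) → (f′ ∶ (_∈ κ) ⟶ (_∈ ℝ)) → 0# ≤ c → c ≢ 0# →
    (∀ i x → ⟪ i , ⌜ x ⌝ ⟫ ∈ f → ⟪ i , ⌜ c * x ⌝ ⟫ ∈ f′) → IsSum κ f r → IsSum κ f′ r′ → r′ ≡ c * r
  sum-scale {f} {f′} {c} {r} {r′} hf hf′ 0≤c c≢0 sc (ub , least) (ub′ , least′) with inverse c c≢0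
  ... | d , cd≡1 = antisym (least′ (c * r) upper) (subst (c * r ≤_) cancel (*-monoˡ-≤ 0≤c (least (d * r′) upper′)))
    where
    dc : ∀ x → d * (c * x) ≡ x
    dc x = trans (sym (R.*-assoc d c x)) (trans (cong (_* x) (trans (R.*-comm d c) cd≡1)) (R.*-identityˡ x))
    cancel : c * (d * r′) ≡ r′
    cancel = trans (sym (R.*-assoc c d r′)) (trans (cong (_* r′) cd≡1) (R.*-identityˡ r′))
    sc′ : ∀ i x → ⟪ i , ⌜ x ⌝ ⟫ ∈ f′ → ⟪ i , ⌜ d * x ⌝ ⟫ ∈ f
    sc′ i x h with fun-value hf (proj₁ (fun-type hf′ h))
    ... | x₀ , hx₀ with real (proj₂ (fun-type hf hx₀))
    ... | x₁ , refl = subst (λ z → ⟪ i , ⌜ z ⌝ ⟫ ∈ f)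
      (trans (sym (dc x₁)) (cong (d *_) (⌜⌝-inj {c * x₁} {x} (fun-unique hf′ (sc i x₁ hx₀) h)))) hx₀
    upper′ : IsUpperBound (IsFinitePartialSum κ f) (d * r′)
    upper′ s hs = subst (_≤ d * r′) (dc s)
      (*-monoˡ-≤ (inverse-nonneg 0≤c cd≡1) (ub′ (c * s) (partialSum-scale {c = c} hf hf′ sc hs)))
    upper : IsUpperBound (IsFinitePartialSum κ f′) (c * r)
    upper s hs = subst (_≤ c * r) (trans (sym (R.*-assoc c d s)) (trans (cong (_* s) cd≡1) (R.*-identityˡ s)))
      (*-monoˡ-≤ 0≤c (ub (d * s) (partialSum-scale {c = d} hf′ hf sc′ hs)))

  module _ {A : Carrier} {a : El} (hA : ⟪ A , ⌜ a ⌝ ⟫ ∈ μ) where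

    IndependentOf : Carrier → Set ℓ
    IndependentOf B = ∃ λ s → ⟪ B , ⌜ s ⌝ ⟫ ∈ μ × ⟪ A ∩ B , ⌜ a * s ⌝ ⟫ ∈ μ

    private
      Indepᶠ : Form 1
      Indepᶠ = ∃ᶠ (∃ᶠ (∃ᶠ (⟪ v3 , v2 ⟫ᵗ ∈ᶠ con μ ∧ᶠ ∀ᶠ (v0 ∈ᶠ v2 ⇔ᶠ (v0 ∈ᶠ con A ∧ᶠ v0 ∈ᶠ v4)) ∧ᶠ
        ⟪ ⟪ con ⌜ a ⌝ , v2 ⟫ᵗ , v0 ⟫ᵗ ∈ᶠ con times ∧ᶠ ⟪ v1 , v0 ⟫ᵗ ∈ᶠ con μ)))

    abstract
      indep : Carrier
      indep = sep Indepᶠ (𝒫 Str)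

      private
        indep-spec : ∀ B → B ∈ indep ⇔ (B ∈ 𝒫 Str × ⟦ Indepᶠ ⟧ (B ∷ []))
        indep-spec = ∈-sep Indepᶠ (𝒫 Str)

    private
      fwd : ∀ {B} → ⟦ Indepᶠ ⟧ (B ∷ []) → IndependentOf B
      fwd {B} (s₀ , C , t , hB , hC , ht , hCt) with real (proj₂ (fun-type isFunction hB))
      ... | s , refl with to (∈-times a s) ht | ≐-unique hC ∈-∩
      ... | refl | refl = s , hB , hCt

    ∈-indep : ∀ B → B ∈ indep ⇔ IndependentOf B
    ∈-indep B = mk⇔ (λ h → fwd (proj₂ (to (indep-spec B) h)))
      λ (s , hB , hAB) → from (indep-spec B) (measurable⊆Str (measurable hB) ,
        ⌜ s ⌝ , A ∩ B , ⌜ a * s ⌝ , hB , ∈-∩ , from (∈-times a s) refl , hAB)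

    private
      A⊆Str : ∀ {N} → N ∈ A → N ∈ Str
      A⊆Str = to (∈-𝒫 A) (measurable⊆Str (measurable hA)) _

      str-indep : IndependentOf Str
      str-indep = 1# , total Str ∈-Str , subst₂ (λ V r → ⟪ V , ⌜ r ⌝ ⟫ ∈ μ)
        (ext (λ N h → from (∈-∩ N) (h , A⊆Str h)) (λ N h → proj₁ (to (∈-∩ N) h))) (sym (R.*-identityʳ a)) hA

      -- Additivity gives `s′ = s + t` and `a * s′ = a * s + t′`; cancelling leaves `t′ = a * t`.
      difference-indep : ∀ B B′ C → IndependentOf B → IndependentOf B′ → (∀ N → N ∈ B → N ∈ B′) →
                         (C ≐ λ N → N ∈ B′ × ¬ N ∈ B) → IndependentOf C
      difference-indep B B′ C (s , hB , hAB) (s′ , hB′ , hAB′) sub hC =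
        let (t , ht) = measure hCm ; (t′ , ht′) = measure (∩-measurable (measurable hA) hCm) in
        t , ht , subst (λ z → ⟪ A ∩ C , ⌜ z ⌝ ⟫ ∈ μ)
          (RP.+-cancelˡ (a * s) t′ (a * t) (trans (sym (difference-value (a * s) (a * s′) t′ sub∩ hAC hAB hAB′ ht′))
            (trans (cong (a *_) (difference-value s s′ t sub hC hB hB′ ht)) (R.distribˡ a s t)))) ht′
        where
        hCm : IsMeasurable C
        hCm = subst IsMeasurable (ext
          (λ N h → let (b′ , h′) = to (∈-∩ N) h in from (hC N) (b′ , proj₂ (to (∈-∖ N) h′)))
          (λ N h → let (b′ , ¬b) = to (hC N) h in
            from (∈-∩ N) (b′ , from (∈-∖ N) (to (∈-𝒫 B′) (measurable⊆Str (measurable hB′)) N b′ , ¬b))))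
          (∩-measurable (measurable hB′) (∖-measurable (measurable hB)))
        sub∩ : ∀ N → N ∈ A ∩ B → N ∈ A ∩ B′
        sub∩ N h = let (a , b) = to (∈-∩ N) h in from (∈-∩ N) (a , sub N b)
        hAC : (A ∩ C) ≐ λ N → N ∈ A ∩ B′ × ¬ N ∈ A ∩ B
        hAC N = mk⇔
          (λ h → let (a , c) = to (∈-∩ N) h ; (b′ , ¬b) = to (hC N) c in
            from (∈-∩ N) (a , b′) , λ ab → ¬b (proj₂ (to (∈-∩ N) ab)))
          (λ (h , ¬h) → let (a , b′) = to (∈-∩ N) h in
            from (∈-∩ N) (a , from (hC N) (b′ , λ b → ¬h (from (∈-∩ N) (a , b)))))

      union-indep : ∀ ℬ V → (ℬ ∶ (_∈ κ) ⟶ IndependentOf) → Disjoint ℬ → IsUnion ℬ V → IndependentOf V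
      union-indep ℬ V hℬ dis hV with em {a ≡ 0#}
      -- Scaling by zero cannot be undone, but here monotonicity makes the measure of `A ∩ V`
      -- vanish, and so does the product.
      ... | yes a≡0 = let hVm = union-measurable (fun-weaken hℬ λ y∈ → measurable (proj₁ (proj₂ y∈))) hV
                          (s , hs) = measure hVm ; (t , ht) = measure (∩-measurable (measurable hA) hVm)
                      in s , hs , subst (λ z → ⟪ A ∩ V , ⌜ z ⌝ ⟫ ∈ μ) (trans
                           (antisym (subst (t ≤_) a≡0 (monotone t a (λ N h → proj₁ (to (∈-∩ N) h)) ht hA)) (nonneg _ t ht))
                           (sym (trans (cong (_* s) a≡0) (R.zeroˡ s)))) ht
      ... | no a≢0 = s , hs , subst (λ z → ⟪ A ∩ V , ⌜ z ⌝ ⟫ ∈ μ)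
          (sum-scale (composite-fun (comp ℬ) mℬ isFunction) (composite-fun (comp 𝒞) h𝒞 isFunction) (nonneg A a hA) a≢0 scaled
            (κ-additive ℬ (μ ⊙ ℬ) V s mℬ dis (comp ℬ) hV hs)
            (κ-additive 𝒞 (μ ⊙ 𝒞) (A ∩ V) t h𝒞 (proj₁ (proj₂ (proj₂ (proj₂ trace))) dis) (comp 𝒞)
              (proj₂ (proj₂ (proj₂ (proj₂ trace))) V hV) ht)) ht
        where
        mℬ : ℬ ∶ (_∈ κ) ⟶ IsMeasurable
        mℬ = fun-weaken hℬ λ y∈ → measurable (proj₁ (proj₂ y∈))
        hVm : IsMeasurable V
        hVm = union-measurable mℬ hV
        s t : El
        s = proj₁ (measure hVm)
        t = proj₁ (measure (∩-measurable (measurable hA) hVm))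
        hs : ⟪ V , ⌜ s ⌝ ⟫ ∈ μ
        hs = proj₂ (measure hVm)
        ht : ⟪ A ∩ V , ⌜ t ⌝ ⟫ ∈ μ
        ht = proj₂ (measure (∩-measurable (measurable hA) hVm))
        comp : ∀ ℱ → IsComposite (μ ⊙ ℱ) μ ℱ
        comp ℱ = ⊙-isComposite μ ℱ
        abstract
          trace : ∃ λ 𝒞 → (𝒞 ∶ (_∈ κ) ⟶ IsMeasurable) × (∀ i B → ⟪ i , B ⟫ ∈ ℬ → ⟪ i , A ∩ B ⟫ ∈ 𝒞) ×
                  (Disjoint ℬ → Disjoint 𝒞) × (∀ V → IsUnion ℬ V → IsUnion 𝒞 (A ∩ V))
          trace = traces A mℬ λ B → ∩-measurable (measurable hA)
        𝒞 : Carrier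
        𝒞 = proj₁ trace
        h𝒞 : 𝒞 ∶ (_∈ κ) ⟶ IsMeasurable
        h𝒞 = proj₁ (proj₂ trace)
        scaled : ∀ i x → ⟪ i , ⌜ x ⌝ ⟫ ∈ μ ⊙ ℬ → ⟪ i , ⌜ a * x ⌝ ⟫ ∈ μ ⊙ 𝒞
        scaled i x h =
          let (B , hB , hx) = ∈-composite (comp ℬ) h
              (i∈ , s₀ , hs₀ , hAB) = fun-type hℬ hB
          in composite-∈ (comp 𝒞) (proj₁ (proj₂ (proj₂ trace)) i B hB)
               (subst (λ z → ⟪ A ∩ B , ⌜ a * z ⌝ ⟫ ∈ μ) (measure-unique {s = x} hs₀ hx) hAB)

    indep-λSystem : IsλSystem indep
    indep-λSystem = from (∈-indep Str) str-indep ,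
      (λ B B′ C B∈ B′∈ s hC → from (∈-indep C) (difference-indep B B′ C (to (∈-indep B) B∈) (to (∈-indep B′) B′∈) s hC)) ,
      λ ℬ V hℬ dis hV → from (∈-indep V) (union-indep ℬ V (fun-weaken hℬ λ y∈ → to (∈-indep _) y∈) dis hV)

  -- What Dynkin's argument asks of a generating family. It is left abstract because the two models
  -- use families of different origin.
  record Generates (Z Π : Carrier) : Set ℓ where
    field
      support    : ∀ x → x ∈ Z → x ∈ X
      values     : ∀ A → A ∈ Π → ∃ λ r → ⟪ A , ⌜ r ⌝ ⟫ ∈ μ
      meets      : ∀ A B → A ∈ Π → B ∈ Π → A ∩ B ∈ Π
      singletons : ∀ p → IsFact Z p → ∃ λ A → A ∈ Π × (A ≐ λ N → IsStructure N × p ∈ N)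

  -- The λ-system generated by `Π` is caught between two facts: it contains the interpretations of
  -- codes over `Z`, being an algebra, and it lies within the sets independent of `A`, by
  -- minimality.
  independent-of-codes : ∀ {Z Π} → Generates Z Π → ∀ A a → ⟪ A , ⌜ a ⌝ ⟫ ∈ μ →
    (∀ P r → P ∈ Π → ⟪ P , ⌜ r ⌝ ⟫ ∈ μ → ⟪ A ∩ P , ⌜ a * r ⌝ ⟫ ∈ μ) →
    ∀ γ B b → IsCode Z γ → γ InterpretedAs B → ⟪ B , ⌜ b ⌝ ⟫ ∈ μ → ⟪ A ∩ B , ⌜ a * b ⌝ ⟫ ∈ μ
  independent-of-codes {Z} {Π} G A a hA ind γ B b hγ hB hb =
    conclude (to (∈-indep {A} {a} hA B) (D-least Π ⊆Str meets generators (indep-λSystem {A} {a} hA) B B∈D))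
    where
    open Generates G
    ⊆Str : ∀ A → A ∈ Π → A ∈ 𝒫 Str
    ⊆Str A A∈ = measurable⊆Str (measurable (proj₂ (values A A∈)))
    generators : ∀ P → P ∈ Π → P ∈ indep {A} {a} hA
    generators P P∈ = let (r , hr) = values P P∈ in from (∈-indep {A} {a} hA P) (r , hr , ind P r P∈ hr)
    B∈D : B ∈ D Π ⊆Str meets
    B∈D = code-interpretation∈ Z support (algebra Π ⊆Str meets singletons) hγ hB
    conclude : IndependentOf {A} {a} hA B → ⟪ A ∩ B , ⌜ a * b ⌝ ⟫ ∈ μ
    conclude (s , hs , h) = subst (λ z → ⟪ A ∩ B , ⌜ a * z ⌝ ⟫ ∈ μ) (measure-unique {B} {s} {b} hs hb) h

  -- One side is extended at a time: first from `Π₁` to codes over `X₁` against a fixed generator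
  -- from `Π₀`, then from `Π₀` to codes over `X₀` against the fixed set `A₁`.
  dissociated-over : ∀ {X₀ X₁ Π₀ Π₁} → Generates X₀ Π₀ → Generates X₁ Π₁ →
    (∀ A₀ A₁ r₀ r₁ → A₀ ∈ Π₀ → A₁ ∈ Π₁ → ⟪ A₀ , ⌜ r₀ ⌝ ⟫ ∈ μ → ⟪ A₁ , ⌜ r₁ ⌝ ⟫ ∈ μ → ⟪ A₀ ∩ A₁ , ⌜ r₀ * r₁ ⌝ ⟫ ∈ μ) →
    ∀ γ₀ γ₁ → IsCode X₀ γ₀ → IsCode X₁ γ₁ →
    ∀ A₀ A₁ B r₀ r₁ → γ₀ InterpretedAs A₀ → γ₁ InterpretedAs A₁ → (B ≐ λ N → N ∈ A₀ × N ∈ A₁) →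
    ⟪ A₀ , ⌜ r₀ ⌝ ⟫ ∈ μ → ⟪ A₁ , ⌜ r₁ ⌝ ⟫ ∈ μ → ⟪ B , ⌜ r₀ * r₁ ⌝ ⟫ ∈ μ
  dissociated-over {Π₀ = Π₀} G₀ G₁ ind γ₀ γ₁ c₀ c₁ A₀ A₁ B r₀ r₁ i₀ i₁ hB h₀ h₁ =
    subst (λ V → ⟪ V , ⌜ r₀ * r₁ ⌝ ⟫ ∈ μ) (≐-unique ∈-∩ hB)
      (swap A₁ A₀ r₁ r₀ (independent-of-codes G₀ A₁ r₁ h₁ A₁-generators γ₀ A₀ r₀ c₀ i₀ h₀))
    where
    swap : ∀ P Q r s → ⟪ P ∩ Q , ⌜ r * s ⌝ ⟫ ∈ μ → ⟪ Q ∩ P , ⌜ s * r ⌝ ⟫ ∈ μ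
    swap P Q r s = subst₂ (λ V z → ⟪ V , ⌜ z ⌝ ⟫ ∈ μ) (∩-comm P Q) (R.*-comm r s)
    A₁-generators : ∀ P r → P ∈ Π₀ → ⟪ P , ⌜ r ⌝ ⟫ ∈ μ → ⟪ A₁ ∩ P , ⌜ r₁ * r ⌝ ⟫ ∈ μ
    A₁-generators P r P∈ hr = swap P A₁ r r₁ (independent-of-codes G₁ P r hr
      (λ Q s Q∈ hs → ind P Q r s P∈ Q∈ hr hs) γ₁ A₁ r₁ c₁ i₁ h₁)

  -- The fact is the atomic formula that applies `R` to its variables in their natural order,
  -- evaluated at the tuple `t`; hence the identity function in the literal.
  fact-measurable : ∀ {p A} → IsFact X p → (A ≐ λ N → IsStructure N × p ∈ N) → IsMeasurable A
  fact-measurable {p} {A} (R , n , t , hR , ht , refl) hA 𝓢 alg = IsκAlgebra.literals alg n l t A (arity-nat hR)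
      (∅ , _ , nat-∅ , inj₂ (R , n , i , hR , hi , refl) , refl) ht
      λ N → mk⇔ (λ h → let (hN , x) = to (hA N) h in hN , from (expresses-holds {N = N} expresses) x)
                (λ (hN , x) → from (hA N) (hN , to (expresses-holds {N = N} expresses) x))
    where
    identity : ∃ λ i → (i ∶ (_∈ n) ⟶ (_∈ n)) × (∀ x y → ⟪ x , y ⟫ ∈ i ⇔ (x ∈ n × y ≡ x))
    identity = mkFun (v0 ≡ᶠ v1) (λ _ _ _ → refl) n (λ x x∈ → x , x∈ , refl) (λ x y y′ _ e e′ → trans e (sym e′))
    i l : Carrier
    i = proj₁ identity
    l = ⟪ ∅ , ⟪ S ∅ , ⟪ R , i ⟫ ⟫ ⟫
    hi : i ∶ (_∈ n) ⟶ (_∈ n)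
    hi = proj₁ (proj₂ identity)
    same : t ⊙ i ≡ t
    same = fun-ext (composite-fun (⊙-isComposite t i) hi ht) ht λ {x} {z} h →
      let (y , hxy , hyz) = ∈-composite (⊙-isComposite t i) h in
      subst (λ x → ⟪ x , z ⟫ ∈ t) (proj₂ (to (proj₂ (proj₂ identity) x y) hxy)) hyz
    expresses : Expresses n t ⟪ R , t ⟫ l
    expresses = R , n , i , t , hR , hi , subst (λ u → IsComposite u t i) same (⊙-isComposite t i) , refl , refl

  private
    Measurableᶠ : Form 1
    Measurableᶠ = ∃ᶠ (⟪ v1 , v0 ⟫ᵗ ∈ᶠ con μ)

  abstract
    measurables : Carrier
    measurables = sep Measurableᶠ (𝒫 Str)

    ∈-measurables : ∀ A → A ∈ measurables ⇔ (A ∈ 𝒫 Str × ∃ λ r → ⟪ A , r ⟫ ∈ μ)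
    ∈-measurables = ∈-sep Measurableᶠ (𝒫 Str)

  private
    ∈⇒measurable : ∀ {A} → A ∈ measurables → IsMeasurable A
    ∈⇒measurable h = measurable (proj₂ (proj₂ (to (∈-measurables _) h)))

    measurable⇒∈ : ∀ {A} → IsMeasurable A → A ∈ measurables
    measurable⇒∈ h = from (∈-measurables _) (measurable⊆Str h , _ , proj₂ (measure h))

  -- Through `conjunction∈` this gives every cylinder with a basic code a measure.
  measurables-algebra : IsAlgebra X measurables
  measurables-algebra = record
    { str   = measurable⇒∈ (measurable (total Str ∈-Str))
    ; compl = λ A h → measurable⇒∈ (∖-measurable (∈⇒measurable h))
    ; inter = λ A B h h′ → measurable⇒∈ (∩-measurable (∈⇒measurable h) (∈⇒measurable h′))
    ; union = λ 𝒜 V h𝒜 hV → measurable⇒∈ (union-measurable (fun-weaken h𝒜 ∈⇒measurable) hV)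
    ; fact  = λ p hp → cyl ｛ p , p ｝ , measurable⇒∈ (fact-measurable hp (cyl-singleton p)) , cyl-singleton p
    }

  module _ {Z : Carrier} (Z⊆X : ∀ x → x ∈ Z → x ∈ X) where

    coded-measure : ∀ {P} → Coded Z P → ∃ λ r → ⟪ cyl P , ⌜ r ⌝ ⟫ ∈ μ
    coded-measure C = measure (∈⇒measurable (conjunction∈ measurables-algebra
      (fun-weaken tuple (Z⊆X _)) (n , n-nat , conj) (code-holds Z⊆X C)))
      where open Coded C

    hasMeasure : ∀ {P} (C : Coded Z P) r → ⟪ cyl P , ⌜ r ⌝ ⟫ ∈ μ → HasMeasure μ (Coded.code C) r
    hasMeasure C r h = cyl _ , code-interpretation Z⊆X C , h

    generates : ∀ F → (∀ P → P ∈ F → ∃ λ r → ⟪ cyl P , ⌜ r ⌝ ⟫ ∈ μ) → (∀ P Q → P ∈ F → Q ∈ F → P ∪ Q ∈ F) →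
                (∀ p → IsFact Z p → ｛ p , p ｝ ∈ F) → Generates Z (cylinders F)
    generates F val un sing = record
      { support    = Z⊆X
      ; values     = values
      ; meets      = meets
      ; singletons = λ p hp → cyl ｛ p , p ｝ , from (∈-cylinders _) (｛ p , p ｝ , sing p hp , refl) , cyl-singleton p
      }
      where
      values : ∀ A → A ∈ cylinders F → ∃ λ r → ⟪ A , ⌜ r ⌝ ⟫ ∈ μ
      values A A∈ with to (∈-cylinders A) A∈
      ... | P , P∈ , refl = val P P∈
      meets : ∀ A B → A ∈ cylinders F → B ∈ cylinders F → A ∩ B ∈ cylinders F
      meets A B A∈ B∈ with to (∈-cylinders A) A∈ | to (∈-cylinders B) B∈
      ... | P , P∈ , refl | Q , Q∈ , refl = from (∈-cylinders _) (P ∪ Q , un P Q P∈ Q∈ , cyl-∪ P Q)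

  module _ {Z : Carrier} (Z⊆X : ∀ x → x ∈ Z → x ∈ X) (fin : IsFinite Z) where

    coded-finite : ∀ P → P ∈ 𝓕 Z → Coded Z P
    coded-finite = let (n , f , hn , hf , _ , onto) = fin in coded Z⊆X hn hf onto

    generates-𝓕 : Generates Z (cylinders (𝓕 Z))
    generates-𝓕 = generates Z⊆X (𝓕 Z) (λ P P∈ → coded-measure Z⊆X (coded-finite P P∈)) (∪∈𝓕 Z)
      λ p hp → singleton∈𝓕 Z (from (∈-facts Z⊆X p) hp)

-- All that is used of the inclusion V₀ ⊆ V₁.
record EndExtension {ℓ} (M N : ZFCModel ℓ) : Set ℓ where
  private
    module M = ZFCModel M
    module N = ZFCModel N
  field
    ι         : M.Carrier → N.Carrier
    ι-inj     : ∀ {x y} → ι x ≡ ι y → x ≡ y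
    ∈-up      : ∀ {x y} → x M.∈ y → ι x N.∈ ι y
    ∈-reflect : ∀ {x y} → ι x N.∈ ι y → x M.∈ y
    ∈-down    : ∀ {x} y → x N.∈ ι y → ∃ λ x₀ → x ≡ ι x₀

-- Absoluteness of finite objects

module Absoluteness {ℓ} (em : ExcludedMiddle ℓ) (N₀ N₁ : ZFCModel ℓ) (extension : EndExtension N₀ N₁) where

  module M₀ where
    open ZFCModel N₀ public
    open InModel N₀ public
    open SetTheory em N₀ public
  module M₁ where
    open ZFCModel N₁ public
    open InModel N₁ public
    open SetTheory em N₁ public

  open EndExtension extension public

  ι-ext : ∀ {a b} → (∀ z → z M₀.∈ a → ι z M₁.∈ b) → (∀ z → ι z M₁.∈ b → z M₀.∈ a) →
          (∀ z → z M₁.∈ b → ∃ λ z₀ → z ≡ ι z₀) → ι a ≡ b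
  ι-ext {a} {b} f g down = M₁.ext fwd bwd
    where
    fwd : ∀ z → z M₁.∈ ι a → z M₁.∈ b
    fwd z h with ∈-down a h
    ... | z₀ , refl = f z₀ (∈-reflect h)
    bwd : ∀ z → z M₁.∈ b → z M₁.∈ ι a
    bwd z h with down z h
    ... | z₀ , refl = ∈-up (g z₀ h)

  ι-∅ : ι M₀.∅ ≡ M₁.∅
  ι-∅ = ι-ext (λ z h → ⊥-elim (M₀.∉∅ z h)) (λ z h → ⊥-elim (M₁.∉∅ _ h)) (λ z h → ⊥-elim (M₁.∉∅ z h))

  ι-｛｝ : ∀ x y → ι M₀.｛ x , y ｝ ≡ M₁.｛ ι x , ι y ｝
  ι-｛｝ x y = ι-ext
    (λ z h → [ (λ { refl → M₁.∈-pairˡ }) , (λ { refl → M₁.∈-pairʳ }) ]′ (to (M₀.∈-pair z) h))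
    (λ z h → from (M₀.∈-pair z) ([ (λ e → inj₁ (ι-inj e)) , (λ e → inj₂ (ι-inj e)) ]′ (to (M₁.∈-pair (ι z)) h)))
    (λ z h → [ (λ e → x , e) , (λ e → y , e) ]′ (to (M₁.∈-pair z) h))

  ι-⟪⟫ : ∀ x y → ι M₀.⟪ x , y ⟫ ≡ M₁.⟪ ι x , ι y ⟫
  ι-⟪⟫ x y = trans (ι-｛｝ _ _) (cong₂ M₁.｛_,_｝ (ι-｛｝ x x) (ι-｛｝ x y))

  ι-∪ : ∀ x y → ι (x M₀.∪ y) ≡ ι x M₁.∪ ι y
  ι-∪ x y = ι-ext
    (λ z h → from (M₁.∈-∪ (ι z)) ([ (λ a → inj₁ (∈-up a)) , (λ a → inj₂ (∈-up a)) ]′ (to (M₀.∈-∪ z) h)))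
    (λ z h → from (M₀.∈-∪ z) ([ (λ a → inj₁ (∈-reflect a)) , (λ a → inj₂ (∈-reflect a)) ]′ (to (M₁.∈-∪ (ι z)) h)))
    (λ z h → [ ∈-down x , ∈-down y ]′ (to (M₁.∈-∪ z) h))

  ι-S : ∀ x → ι (M₀.S x) ≡ M₁.S (ι x)
  ι-S x = ι-ext
    (λ z h → [ (λ a → M₁.∈-Sˡ (∈-up a)) , (λ { refl → M₁.∈-Sʳ }) ]′ (to (M₀.∈-S x z) h))
    (λ z h → [ (λ a → M₀.∈-Sˡ (∈-reflect a)) , (λ e → from (M₀.∈-S x z) (inj₂ (ι-inj e))) ]′ (to (M₁.∈-S (ι x) (ι z)) h))
    (λ z h → [ ∈-down x , (λ e → x , e) ]′ (to (M₁.∈-S (ι x) z) h))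

  ι-◂ : ∀ f p → ι (f M₀.◂ p) ≡ ι f M₁.◂ ι p
  ι-◂ f p = ι-ext
    (λ z h → [ (λ a → M₁.◂ˡ (∈-up a)) , (λ { refl → M₁.◂ʳ }) ]′ (to (M₀.∈-◂ z) h))
    (λ z h → [ (λ a → M₀.◂ˡ (∈-reflect a)) , (λ e → from (M₀.∈-◂ z) (inj₂ (ι-inj e))) ]′ (to (M₁.∈-◂ (ι z)) h))
    (λ z h → [ ∈-down f , (λ e → p , e) ]′ (to (M₁.∈-◂ z) h))

  pair-up : ∀ {x y f} → M₀.⟪ x , y ⟫ M₀.∈ f → M₁.⟪ ι x , ι y ⟫ M₁.∈ ι f
  pair-up {x} {y} {f} h = subst (M₁._∈ ι f) (ι-⟪⟫ x y) (∈-up h)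

  pair-reflect : ∀ {x y f} → M₁.⟪ ι x , ι y ⟫ M₁.∈ ι f → M₀.⟪ x , y ⟫ M₀.∈ f
  pair-reflect {x} {y} {f} h = ∈-reflect (subst (M₁._∈ ι f) (sym (ι-⟪⟫ x y)) h)

  pair-down : ∀ {x y} f → M₁.⟪ x , y ⟫ M₁.∈ ι f → ∃₂ λ x₀ y₀ → x ≡ ι x₀ × y ≡ ι y₀ × M₀.⟪ x₀ , y₀ ⟫ M₀.∈ f
  pair-down {x} {y} f h with component M₁.∈-pairˡ | component M₁.∈-pairʳ
    where
    component : ∀ {z} → z M₁.∈ M₁.｛ x , y ｝ → ∃ λ z₀ → z ≡ ι z₀
    component {z} hz =
      let (p , e) = ∈-down f h ; (q , e′) = ∈-down p (subst (M₁.｛ x , y ｝ M₁.∈_) e M₁.∈-pairʳ) in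
      ∈-down q (subst (z M₁.∈_) e′ hz)
  ... | x₀ , refl | y₀ , refl = x₀ , y₀ , refl , refl , pair-reflect h

  -- The image of `M₀.ω` contains zero and is closed under successor, and a natural number of the
  -- larger model belongs to every such set there.
  nat-down : ∀ n → M₁.IsNat n → ∃ λ n₀ → n ≡ ι n₀ × M₀.IsNat n₀
  nat-down n hn = conclude (∈-down M₀.ω n∈ω)
    where
    step : ∀ x → x M₁.∈ ι M₀.ω → M₁.S x M₁.∈ ι M₀.ω
    step x h with ∈-down M₀.ω h
    ... | x₀ , refl = subst (M₁._∈ ι M₀.ω) (ι-S x₀) (∈-up (from (M₀.∈-ω (M₀.S x₀)) (M₀.nat-S (to (M₀.∈-ω x₀) (∈-reflect h)))))
    n∈ω : n M₁.∈ ι M₀.ω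
    n∈ω = hn (ι M₀.ω) (subst (M₁._∈ ι M₀.ω) ι-∅ (∈-up (from (M₀.∈-ω M₀.∅) M₀.nat-∅))) step
    conclude : (∃ λ n₀ → n ≡ ι n₀) → ∃ λ n₀ → n ≡ ι n₀ × M₀.IsNat n₀
    conclude (n₀ , e) = n₀ , e , to (M₀.∈-ω n₀) (∈-reflect (subst (M₁._∈ ι M₀.ω) e n∈ω))

  -- The natural numbers of the smaller model form a set of the larger one; its least element
  -- that is not a natural number there would be ∅ or a successor.
  nat-up : ∀ n → M₀.IsNat n → M₁.IsNat (ι n)
  nat-up n hn = M₁.byContradiction λ bad →
    least (M₁.minimal (M₁.¬ᶠ (M₁.natᶠ M₁.v0)) (ι M₀.ω) (ι n) (∈-up (from (M₀.∈-ω n) hn)) bad)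
    where
    least : (∃ λ m → m M₁.∈ ι M₀.ω × (¬ M₁.IsNat m) × (∀ z → z M₁.∈ ι M₀.ω → ¬ M₁.IsNat z → ¬ z M₁.∈ m)) → ⊥
    least (m , m∈ , bad , min) with ∈-down M₀.ω m∈
    ... | m₀ , refl with M₀.nat-cases m₀ (to (M₀.∈-ω m₀) (∈-reflect m∈))
    ... | inj₁ refl = bad (subst M₁.IsNat (sym ι-∅) M₁.nat-∅)
    ... | inj₂ (k , hk , refl) = bad (subst M₁.IsNat (sym (ι-S k)) (M₁.nat-S (M₁.byContradiction λ bad′ →
      min (ι k) (∈-up (from (M₀.∈-ω k) hk)) bad′ (∈-up M₀.∈-Sʳ))))

  fun-up : ∀ {f n} {Q₀ : Pred M₀.Carrier ℓ} {Q₁ : Pred M₁.Carrier ℓ} → (∀ y → Q₀ y → Q₁ (ι y)) →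
           f M₀.∶ (M₀._∈ n) ⟶ Q₀ → ι f M₁.∶ (M₁._∈ ι n) ⟶ Q₁
  fun-up {f} {n} {Q₀} {Q₁} up hf = pairs , total
    where
    pairs : ∀ p → p M₁.∈ ι f → ∃₂ λ x y → (x M₁.∈ ι n × Q₁ y) × p ≡ M₁.⟪ x , y ⟫
    pairs p h with ∈-down f h
    ... | p₀ , refl with proj₁ hf p₀ (∈-reflect h)
    ... | x , y , (hx , hy) , refl = ι x , ι y , (∈-up hx , up y hy) , ι-⟪⟫ x y
    total : ∀ x → x M₁.∈ ι n → ∃ λ y → M₁.⟪ x , y ⟫ M₁.∈ ι f × (∀ y′ → M₁.⟪ x , y′ ⟫ M₁.∈ ι f → y′ ≡ y)
    total x hx with ∈-down n hx
    ... | x₀ , refl with M₀.fun-value hf (∈-reflect hx)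
    ... | y , h = ι y , pair-up h , unique
      where
      unique : ∀ y′ → M₁.⟪ ι x₀ , y′ ⟫ M₁.∈ ι f → y′ ≡ ι y
      unique y′ h′ with pair-down f h′
      ... | x₁ , y₁ , e , refl , h″ = cong ι (M₀.fun-unique hf (subst (λ x → M₀.⟪ x , y₁ ⟫ M₀.∈ f) (sym (ι-inj e)) h″) h)

  fun-down : ∀ {f n Q} → ι f M₁.∶ (M₁._∈ ι n) ⟶ (M₁._∈ ι Q) → f M₀.∶ (M₀._∈ n) ⟶ (M₀._∈ Q)
  fun-down {f} {n} {Q} hf = pairs , total
    where
    pairs : ∀ p → p M₀.∈ f → ∃₂ λ x y → (x M₀.∈ n × y M₀.∈ Q) × p ≡ M₀.⟪ x , y ⟫
    pairs p h with proj₁ hf (ι p) (∈-up h)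
    ... | x , y , (hx , hy) , e with ∈-down n hx | ∈-down Q hy
    ... | x₀ , refl | y₀ , refl = x₀ , y₀ , (∈-reflect hx , ∈-reflect hy) , ι-inj (trans e (sym (ι-⟪⟫ x₀ y₀)))
    total : ∀ x → x M₀.∈ n → ∃ λ y → M₀.⟪ x , y ⟫ M₀.∈ f × (∀ y′ → M₀.⟪ x , y′ ⟫ M₀.∈ f → y′ ≡ y)
    total x hx with M₁.fun-value hf (∈-up hx)
    ... | y , h with pair-down f h
    ... | x₀ , y₀ , e , refl , h₀ = y₀ , subst (λ x → M₀.⟪ x , y₀ ⟫ M₀.∈ f) (sym (ι-inj e)) h₀ ,
      λ y′ h′ → ι-inj (M₁.fun-unique hf (pair-up h′) h)

  -- The set G of the finite functions n → Q of the smaller model is closed under adding a value.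
  finite-fun-down : ∀ Q n f → M₁.IsNat n → f M₁.∶ (M₁._∈ n) ⟶ (M₁._∈ ι Q) → ∃ λ f₀ → f ≡ ι f₀
  finite-fun-down Q n f hn hf = ∈-down G (M₁.natInd Allᶠ start next n hn f hf)
    where
    Gᶠ : M₀.Form 1
    Gᶠ = M₀.∃ᶠ (M₀.natᶠ M₀.v0 M₀.∧ᶠ M₀.funᶠ M₀.v1 M₀.v0 (M₀.con Q))
    G : M₀.Carrier
    G = M₀.sep Gᶠ (M₀.𝒫 (M₀.ω M₀.⊗ Q))
    G-intro : ∀ {n f} → M₀.IsNat n → f M₀.∶ (M₀._∈ n) ⟶ (M₀._∈ Q) → f M₀.∈ G
    G-intro {n} {f} hn hf = from (M₀.∈-sep Gᶠ _ f) (from (M₀.∈-𝒫 f) bound , n , hn , hf)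
      where
      bound : ∀ p → p M₀.∈ f → p M₀.∈ M₀.ω M₀.⊗ Q
      bound p h with proj₁ hf p h
      ... | x , y , (hx , hy) , refl = from M₀.⟪⟫∈⊗ (from (M₀.∈-ω x) (M₀.nat-elem n hn x hx) , hy)
    Allᶠ : M₁.Form 1
    Allᶠ = M₁.∀ᶠ (M₁.funᶠ M₁.v0 M₁.v1 (M₁.con (ι Q)) M₁.⇒ᶠ M₁.v0 M₁.∈ᶠ M₁.con (ι G))
    All : M₁.Carrier → Set ℓ
    All n = ∀ f → f M₁.∶ (M₁._∈ n) ⟶ (M₁._∈ ι Q) → f M₁.∈ ι G
    start : All M₁.∅
    start f hf = subst (M₁._∈ ι G) (trans ι-∅ (M₁.ext (λ z h → ⊥-elim (M₁.∉∅ z h)) empty)) (∈-up (G-intro M₀.nat-∅ M₀.∅-fun))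
      where
      empty : ∀ z → z M₁.∈ f → z M₁.∈ M₁.∅
      empty z h with proj₁ hf z h
      ... | x , _ , (hx , _) , _ = ⊥-elim (M₁.∉∅ x hx)
    extend : ∀ k₀ y₀ f f′ → M₀.IsNat k₀ → y₀ M₀.∈ Q → f M₁.∶ (M₁._∈ M₁.S (ι k₀)) ⟶ (M₁._∈ ι Q) →
             M₁.⟪ ι k₀ , ι y₀ ⟫ M₁.∈ f → (∀ z → z M₁.∈ f′ ⇔ (z M₁.∈ f × ¬ z ≡ M₁.⟪ ι k₀ , ι y₀ ⟫)) →
             f′ M₁.∶ (M₁._∈ ι k₀) ⟶ (M₁._∈ ι Q) → f′ M₁.∈ ι G → f M₁.∈ ι G
    extend k₀ y₀ f f′ hk₀ hy₀ hf hy spec hf′ h with ∈-down G h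
    ... | f₀ , refl = subst (M₁._∈ ι G) same (∈-up (G-intro (M₀.nat-S hk₀) (M₀.◂-fun (fun-down hf′) hy₀)))
      where
      fwd : ∀ z → z M₁.∈ ι f₀ M₁.◂ M₁.⟪ ι k₀ , ι y₀ ⟫ → z M₁.∈ f
      fwd z hz with to (M₁.∈-◂ z) hz
      ... | inj₁ a    = proj₁ (to (spec z) a)
      ... | inj₂ refl = hy
      bwd : ∀ z → z M₁.∈ f → z M₁.∈ ι f₀ M₁.◂ M₁.⟪ ι k₀ , ι y₀ ⟫
      bwd z hz with em {z ≡ M₁.⟪ ι k₀ , ι y₀ ⟫}
      ... | yes refl = M₁.◂ʳ
      ... | no ne    = M₁.◂ˡ (from (spec z) (hz , ne))
      same : ι (f₀ M₀.◂ M₀.⟪ k₀ , y₀ ⟫) ≡ f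
      same = trans (ι-◂ f₀ _) (trans (cong (ι f₀ M₁.◂_) (ι-⟪⟫ k₀ y₀)) (M₁.ext fwd bwd))
    restrict : ∀ k y f f′ → f M₁.∶ (M₁._∈ M₁.S k) ⟶ (M₁._∈ ι Q) → M₁.⟪ k , y ⟫ M₁.∈ f →
               (∀ z → z M₁.∈ f′ ⇔ (z M₁.∈ f × ¬ z ≡ M₁.⟪ k , y ⟫)) → f′ M₁.∶ (M₁._∈ k) ⟶ (M₁._∈ ι Q)
    restrict k y f f′ hf hy spec = pairs , total
      where
      pairs : ∀ p → p M₁.∈ f′ → ∃₂ λ x z → (x M₁.∈ k × z M₁.∈ ι Q) × p ≡ M₁.⟪ x , z ⟫
      pairs p hp with to (spec p) hp
      ... | hpf , ne with proj₁ hf p hpf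
      ... | x , z , (hx , hz) , refl with to (M₁.∈-S k x) hx
      ... | inj₁ hxk  = x , z , (hxk , hz) , refl
      ... | inj₂ refl = ⊥-elim (ne (cong M₁.⟪ x ,_⟫ (M₁.fun-unique hf hpf hy)))
      total : ∀ x → x M₁.∈ k → ∃ λ z → M₁.⟪ x , z ⟫ M₁.∈ f′ × (∀ z′ → M₁.⟪ x , z′ ⟫ M₁.∈ f′ → z′ ≡ z)
      total x hx with M₁.fun-value hf (M₁.∈-Sˡ hx)
      ... | z , hz = z , from (spec _) (hz , λ e → M₁.∈-irrefl k (subst (M₁._∈ k) (proj₁ (M₁.⟪⟫-inj e)) hx)) ,
        λ z′ hz′ → M₁.fun-unique hf (proj₁ (to (spec _) hz′)) hz
    next : ∀ k → M₁.IsNat k → All k → All (M₁.S k)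
    next k hk ih f hf with nat-down k hk | M₁.fun-value hf M₁.∈-Sʳ
    ... | k₀ , refl , hk₀ | y , hy with ∈-down Q (proj₂ (M₁.fun-type hf hy))
    ... | y₀ , refl = extend k₀ y₀ f f′ hk₀ (∈-reflect (proj₂ (M₁.fun-type hf hy))) hf hy spec
                        (restrict (ι k₀) (ι y₀) f f′ hf hy spec) (ih f′ (restrict (ι k₀) (ι y₀) f f′ hf hy spec))
      where
      -- Without its last pair, `f` is a function on `k`, which the induction hypothesis places in
      -- the smaller model; restoring the pair can be done there too.
      f′ : M₁.Carrier
      f′ = f M₁.∖ M₁.｛ M₁.⟪ ι k₀ , ι y₀ ⟫ , M₁.⟪ ι k₀ , ι y₀ ⟫ ｝
      spec : ∀ z → z M₁.∈ f′ ⇔ (z M₁.∈ f × ¬ z ≡ M₁.⟪ ι k₀ , ι y₀ ⟫)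
      spec z = mk⇔ (λ h → proj₁ (to (M₁.∈-∖ z) h) , λ e → proj₂ (to (M₁.∈-∖ z) h) (from (M₁.∈-pair z) (inj₁ e)))
                   (λ (h , ne) → from (M₁.∈-∖ z) (h , λ h′ → ne (M₁.∈-singleton h′)))

  composite-up : ∀ {h g f} → M₀.IsComposite h g f → M₁.IsComposite (ι h) (ι g) (ι f)
  composite-up {h} {g} {f} c p = mk⇔ fwd bwd
    where
    fwd : p M₁.∈ ι h → ∃ λ x → ∃₂ λ y z → M₁.⟪ x , y ⟫ M₁.∈ ι f × M₁.⟪ y , z ⟫ M₁.∈ ι g × p ≡ M₁.⟪ x , z ⟫
    fwd hp with ∈-down h hp
    ... | p₀ , refl with to (c p₀) (∈-reflect hp)
    ... | x , y , z , hf , hg , refl = ι x , ι y , ι z , pair-up hf , pair-up hg , ι-⟪⟫ x z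
    bwd : (∃ λ x → ∃₂ λ y z → M₁.⟪ x , y ⟫ M₁.∈ ι f × M₁.⟪ y , z ⟫ M₁.∈ ι g × p ≡ M₁.⟪ x , z ⟫) → p M₁.∈ ι h
    bwd (x , y , z , hf , hg , refl) with pair-down f hf | pair-down g hg
    ... | x₀ , y₀ , refl , refl , hf₀ | y₁ , z₀ , e , refl , hg₀ =
      pair-up (M₀.composite-∈ c hf₀ (subst (λ y → M₀.⟪ y , z₀ ⟫ M₀.∈ g) (sym (ι-inj e)) hg₀))

  finite-up : ∀ {Y} → M₀.IsFinite Y → M₁.IsFinite (ι Y)
  finite-up {Y} (n , f , hn , hf , inj , onto) = ι n , ι f , nat-up n hn , fun-up (λ _ → ∈-up) hf , inj′ , onto′
    where
    inj′ : M₁.IsInjective (ι f)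
    inj′ x x′ y h h′ with pair-down f h | pair-down f h′
    ... | x₀ , y₀ , refl , refl , h₀ | x₁ , y₁ , refl , e , h₁ =
      cong ι (inj x₀ x₁ y₀ h₀ (subst (λ y → M₀.⟪ x₁ , y ⟫ M₀.∈ f) (sym (ι-inj e)) h₁))
    onto′ : ∀ y → y M₁.∈ ι Y → ∃ λ x → M₁.⟪ x , y ⟫ M₁.∈ ι f
    onto′ y hy with ∈-down Y hy
    ... | y₀ , refl = let (x , h) = onto y₀ (∈-reflect hy) in ι x , pair-up h

  -- An enumeration of `Y` is a finite function into `ι W`, so it comes from the smaller model, and
  -- `Y` comes from its range there.
  finite-down : ∀ {Y W} → M₁.IsFinite Y → (∀ y → y M₁.∈ Y → y M₁.∈ ι W) →
                ∃ λ Y₀ → Y ≡ ι Y₀ × M₀.IsFinite Y₀ × (∀ y → y M₀.∈ Y₀ → y M₀.∈ W)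
  finite-down {Y} {W} (n , f , hn , hf , inj , onto) Y⊆W
    with nat-down n hn | finite-fun-down W n f hn (M₁.fun-weaken hf (Y⊆W _))
  ... | n₀ , refl , hn₀ | f₀ , refl =
      Y₀ , sym ιY₀ , (n₀ , f₀ , hn₀ , M₀.fun-map f₀-fun (λ h → from (∈-Y₀ _) (proj₂ (M₀.fun-type f₀-fun h) , _ , h)) , inj₀ ,
      λ y hy → proj₂ (to (∈-Y₀ y) hy)) , λ y hy → proj₁ (to (∈-Y₀ y) hy)
    where
    f₀-fun : f₀ M₀.∶ (M₀._∈ n₀) ⟶ (M₀._∈ W)
    f₀-fun = fun-down (M₁.fun-weaken hf (Y⊆W _))
    rangeᶠ : M₀.Form 1
    rangeᶠ = M₀.∃ᶠ (M₀.⟪ M₀.v0 , M₀.v1 ⟫ᵗ M₀.∈ᶠ M₀.con f₀)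
    Y₀ : M₀.Carrier
    Y₀ = M₀.sep rangeᶠ W
    ∈-Y₀ : ∀ y → y M₀.∈ Y₀ ⇔ (y M₀.∈ W × ∃ λ x → M₀.⟪ x , y ⟫ M₀.∈ f₀)
    ∈-Y₀ = M₀.∈-sep rangeᶠ W
    ιY₀ : ι Y₀ ≡ Y
    ιY₀ = ι-ext
      (λ y h → let (_ , x , hx) = to (∈-Y₀ y) h in proj₂ (M₁.fun-type hf (pair-up hx)))
      (λ y h → from (∈-Y₀ y) (∈-reflect (Y⊆W _ h) , preimage y h))
      (λ y h → ∈-down W (Y⊆W y h))
      where
      preimage : ∀ y → ι y M₁.∈ Y → ∃ λ x → M₀.⟪ x , y ⟫ M₀.∈ f₀
      preimage y h with onto (ι y) h
      ... | x , hx with pair-down f₀ hx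
      ... | x₀ , y₀ , _ , e , hx₀ = x₀ , subst (λ y → M₀.⟪ x₀ , y ⟫ M₀.∈ f₀) (sym (ι-inj e)) hx₀
    inj₀ : M₀.IsInjective f₀
    inj₀ x x′ y h h′ = ι-inj (inj (ι x) (ι x′) (ι y) (pair-up h) (pair-up h′))

  ordinal-up : ∀ {a} → M₀.IsOrdinal a → M₁.IsOrdinal (ι a)
  ordinal-up {a} (tr , trs) = transitive tr , elements
    where
    transitive : ∀ {b} → M₀.IsTransitive b → M₁.IsTransitive (ι b)
    transitive {b} tr x y x∈y y∈b with ∈-down b y∈b
    ... | y₀ , refl with ∈-down y₀ x∈y
    ... | x₀ , refl = ∈-up (tr x₀ y₀ (∈-reflect x∈y) (∈-reflect y∈b))
    elements : ∀ x → x M₁.∈ ι a → M₁.IsTransitive x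
    elements x h with ∈-down a h
    ... | x₀ , refl = transitive (trs x₀ (∈-reflect h))

  -- A finite enumeration of `ι a` in the larger model would already exist in the smaller one.
  infinite-up : ∀ {a} → M₀.IsInfinite a → M₁.IsInfinite (ι a)
  infinite-up {a} inf fin = let (a₀ , e , fin₀ , _) = finite-down {ι a} {a} fin (λ _ h → h) in
    inf (subst M₀.IsFinite (sym (ι-inj e)) fin₀)

  language-up : ∀ {𝓛} → M₀.IsRelationalLanguage 𝓛 → M₁.IsRelationalLanguage (ι 𝓛)
  language-up (D , h) = ι D , fun-up nat-up h

-- Facts and cylinder codes in both models

module CodedUp {ℓ} (em : ExcludedMiddle ℓ) (N₀ N₁ : ZFCModel ℓ) (extension : EndExtension N₀ N₁)
               (κ X 𝓛 : ZFCModel.Carrier N₀) (rel₀ : InModel.IsRelationalLanguage N₀ 𝓛) where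
  open Absoluteness em N₀ N₁ extension public

  module F₀ where
    open InModel.Structures N₀ κ X 𝓛 public
    open Codes em N₀ κ X 𝓛 rel₀ public
  module F₁ where
    open InModel.Structures N₁ (ι κ) (ι X) (ι 𝓛) public
    open Codes em N₁ (ι κ) (ι X) (ι 𝓛) (language-up rel₀) public

  -- Arities are natural numbers, so the tuple is a finite function into `ι Z` and comes from the
  -- smaller model, whether or not `Z` is finite.
  fact-down : ∀ {Z p} → F₁.IsFact (ι Z) p → ∃ λ p₀ → p ≡ ι p₀ × F₀.IsFact Z p₀
  fact-down {Z} (R , n , t , hR , ht , refl) with pair-down 𝓛 hR
  ... | R₀ , n₀ , refl , refl , hR₀ with finite-fun-down Z (ι n₀) t (nat-up n₀ (F₀.arity-nat hR₀)) ht
  ... | t₀ , refl = M₀.⟪ R₀ , t₀ ⟫ , sym (ι-⟪⟫ R₀ t₀) , R₀ , n₀ , t₀ , hR₀ , fun-down ht , refl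

  private
    ι-literal : ∀ R s → ι M₀.⟪ M₀.∅ , M₀.⟪ M₀.S M₀.∅ , M₀.⟪ R , s ⟫ ⟫ ⟫ ≡ M₁.⟪ M₁.∅ , M₁.⟪ M₁.S M₁.∅ , M₁.⟪ ι R , ι s ⟫ ⟫ ⟫
    ι-literal R s = trans (ι-⟪⟫ _ _) (cong₂ M₁.⟪_,_⟫ ι-∅ (trans (ι-⟪⟫ _ _)
      (cong₂ M₁.⟪_,_⟫ (trans (ι-S M₀.∅) (cong M₁.S ι-∅)) (ι-⟪⟫ R s))))

  expresses-up : ∀ {m a p l} → F₀.Expresses m a p l → F₁.Expresses (ι m) (ι a) (ι p) (ι l)
  expresses-up (R , n , s , t , hR , hs , ct , ep , el) =
    ι R , ι n , ι s , ι t , pair-up hR , fun-up (λ _ → ∈-up) hs , composite-up ct ,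
    trans (cong ι ep) (ι-⟪⟫ R t) , trans (cong ι el) (ι-literal R s)

  coded-up : ∀ {Z P} → F₀.Coded Z P → F₁.Coded (ι Z) (ι P)
  coded-up {Z} {P} C = record
    { m = ι m ; φ = ι φ ; a = ι a ; n = ι n ; m-nat = nat-up m m-nat ; n-nat = nat-up n n-nat
    ; tuple = fun-up (λ _ → ∈-up) tuple
    -- The property of being a literal is not carried upward; it is read off from `represents`, so a
    -- trivial codomain is enough here.
    ; conj = M₁.fun-map (fun-up {Q₁ = λ l → l ≡ l} (λ _ _ → refl) conj) literal
    ; represents = r₁ , r₂ }
    where
    open F₀.Coded C
    r₁ : ∀ i l → M₁.⟪ i , l ⟫ M₁.∈ ι φ → ∃ λ p → p M₁.∈ ι P × F₁.Expresses (ι m) (ι a) p l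
    r₁ i l h with pair-down φ h
    ... | i₀ , l₀ , refl , refl , h₀ = let (p , p∈ , x) = proj₁ represents i₀ l₀ h₀ in ι p , ∈-up p∈ , expresses-up x
    r₂ : ∀ p → p M₁.∈ ι P → ∃₂ λ i l → M₁.⟪ i , l ⟫ M₁.∈ ι φ × F₁.Expresses (ι m) (ι a) p l
    r₂ p h with ∈-down P h
    ... | p₀ , refl = let (i , l , hl , x) = proj₂ represents p₀ (∈-reflect h) in ι i , ι l , pair-up hl , expresses-up x
    literal : ∀ {i l} → M₁.⟪ i , l ⟫ M₁.∈ ι φ → F₁.IsLiteral (ι m) l
    literal {i} {l} h = F₁.expresses-literal (proj₂ (proj₂ (r₁ i l h)))

  ι-code : ∀ {Z P} (C : F₀.Coded Z P) → ι (F₀.Coded.code C) ≡ F₁.Coded.code (coded-up C)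
  ι-code C = trans (ι-⟪⟫ _ _) (cong₂ M₁.⟪_,_⟫ ι-∅ (ι-⟪⟫ _ _))

  subset-up : ∀ {Y Z} → (∀ x → x M₀.∈ Y → x M₀.∈ Z) → ∀ x → x M₁.∈ ι Y → x M₁.∈ ι Z
  subset-up {Y} s x h with ∈-down Y h
  ... | x₀ , refl = ∈-up (s x₀ (∈-reflect h))

  module _ {X₀ X₁ : M₀.Carrier} (s₀ : ∀ x → x M₀.∈ X₀ → x M₀.∈ X) (s₁ : ∀ x → x M₀.∈ X₁ → x M₀.∈ X)
           (fin₀ : M₀.IsFinite X₀) (fin₁ : M₀.IsFinite X₁) where

    union⊆X : ∀ x → x M₀.∈ X₀ M₀.∪ X₁ → x M₀.∈ X
    union⊆X x h = [ s₀ x , s₁ x ]′ (to (M₀.∈-∪ x) h)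

    -- The cylinders of `P` and `Q` intersect in the cylinder of their union. A basic code for it
    -- over `X₀ ∪ X₁` allows the agreement of the measures to be applied to the intersection.
    joint-code : ∀ P Q → P M₀.∈ F₀.𝓕 X₀ → Q M₀.∈ F₀.𝓕 X₁ → F₀.Coded (X₀ M₀.∪ X₁) (P M₀.∪ Q)
    joint-code P Q hP hQ = build fin₀ fin₁
      where
      facts-mono : ∀ {Y} → (∀ x → x M₀.∈ Y → x M₀.∈ X) → (∀ x → x M₀.∈ Y → x M₀.∈ X₀ M₀.∪ X₁) →
                   ∀ p → p M₀.∈ F₀.facts Y → p M₀.∈ F₀.facts (X₀ M₀.∪ X₁)
      facts-mono s s′ p h = from (F₀.∈-facts union⊆X p) (F₀.IsFact-mono s′ (to (F₀.∈-facts s p) h))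
      P∪Q∈ : P M₀.∪ Q M₀.∈ F₀.𝓕 (X₀ M₀.∪ X₁)
      P∪Q∈ = F₀.∪∈𝓕 _ P Q
        (F₀.𝓕-mono X₀ _ (facts-mono s₀ λ x h → from (M₀.∈-∪ x) (inj₁ h)) P hP)
        (F₀.𝓕-mono X₁ _ (facts-mono s₁ λ x h → from (M₀.∈-∪ x) (inj₂ h)) Q hQ)
      build : M₀.IsFinite X₀ → M₀.IsFinite X₁ → F₀.Coded (X₀ M₀.∪ X₁) (P M₀.∪ Q)
      build (n₀ , f₀ , hn₀ , hf₀ , _ , onto₀) (n₁ , f₁ , hn₁ , hf₁ , _ , onto₁) =
        let (m , a , hm , ha , onto) = F₀.concatenate hn₀ hn₁ hf₀ hf₁ onto₀ onto₁ in
        F₀.coded union⊆X hm ha onto (P M₀.∪ Q) P∪Q∈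

-- Transfer of dissociation between the models

module Transfer {ℓ} (em : ExcludedMiddle ℓ) (N₀ N₁ : ZFCModel ℓ) (extension : EndExtension N₀ N₁)
    (κ X 𝓛 : ZFCModel.Carrier N₀) (ord₀ : InModel.IsOrdinal N₀ κ) (inf₀ : InModel.IsInfinite N₀ κ)
    (rel₀ : InModel.IsRelationalLanguage N₀ 𝓛) (𝓡₀ : Reals N₀) (𝓡₁ : Reals N₁)
    (embed : InModel.Reals.El 𝓡₀ → InModel.Reals.El 𝓡₁)
    (embed-mono : IsRingMonomorphism (InModel.Reals.rawRing 𝓡₀) (InModel.Reals.rawRing 𝓡₁) embed)
    (μ : ZFCModel.Carrier N₀) (prob₀ : InModel.Structures.Measures.IsProbabilityκMeasure N₀ κ X 𝓛 𝓡₀ μ)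
    (ν : ZFCModel.Carrier N₁)
    (prob₁ : InModel.Structures.Measures.IsProbabilityκMeasure N₁ (EndExtension.ι extension κ)
               (EndExtension.ι extension X) (EndExtension.ι extension 𝓛) 𝓡₁ ν)
    (agrees : ∀ γ r → InModel.Structures.IsBasicCode N₀ κ X 𝓛 X γ →
       InModel.Structures.Measures.HasMeasure N₀ κ X 𝓛 𝓡₀ μ γ r →
       InModel.Structures.Measures.HasMeasure N₁ (EndExtension.ι extension κ) (EndExtension.ι extension X)
         (EndExtension.ι extension 𝓛) 𝓡₁ ν (EndExtension.ι extension γ) (embed r)) where
  open CodedUp em N₀ N₁ extension κ X 𝓛 rel₀

  module μ₀ where
    open InModel.Reals 𝓡₀ public
    open InModel.Structures.Measures N₀ κ X 𝓛 𝓡₀ public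
    open Measure em N₀ κ X 𝓛 ord₀ inf₀ rel₀ 𝓡₀ μ prob₀ public
  module μ₁ where
    open InModel.Reals 𝓡₁ public
    open InModel.Structures.Measures N₁ (ι κ) (ι X) (ι 𝓛) 𝓡₁ public
    open Measure em N₁ (ι κ) (ι X) (ι 𝓛) (ordinal-up ord₀) (infinite-up inf₀) (language-up rel₀) 𝓡₁ ν prob₁ public

  open IsRingMonomorphism embed-mono using (*-homo; injective)

  -- `agrees` yields some interpretation of the code in the larger model; a basic code has only one,
  -- namely the cylinder.
  cylinder-agrees : ∀ {Z P} → (∀ x → x M₀.∈ Z → x M₀.∈ X) → F₀.Coded Z P → ∀ r →
    M₀.⟪ F₀.cyl P , μ₀.⌜ r ⌝ ⟫ M₀.∈ μ → M₁.⟪ F₁.cyl (ι P) , μ₁.⌜ embed r ⌝ ⟫ M₁.∈ ν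
  cylinder-agrees {Z} {P} Z⊆X C r h =
    conclude (agrees (F₀.Coded.code C) r (F₀.code-isBasicX Z⊆X C) (μ₀.hasMeasure Z⊆X C r h))
    where
    conclude : μ₁.HasMeasure ν (ι (F₀.Coded.code C)) (embed r) → M₁.⟪ F₁.cyl (ι P) , μ₁.⌜ embed r ⌝ ⟫ M₁.∈ ν
    conclude (A , hA , hr) = subst (λ A → M₁.⟪ A , μ₁.⌜ embed r ⌝ ⟫ M₁.∈ ν)
      (F₁.code-unique (subset-up Z⊆X) (coded-up C) (subst (F₁._InterpretedAs A) (ι-code C) hA)) hr

  module _ {X₀ X₁ : M₀.Carrier} (s₀ : ∀ x → x M₀.∈ X₀ → x M₀.∈ X) (s₁ : ∀ x → x M₀.∈ X₁ → x M₀.∈ X)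
           (fin₀ : M₀.IsFinite X₀) (fin₁ : M₀.IsFinite X₁) where
    private
      code₀ : ∀ {P} → P M₀.∈ F₀.𝓕 X₀ → F₀.Coded X₀ P
      code₀ {P} = μ₀.coded-finite s₀ fin₀ P
      code₁ : ∀ {Q} → Q M₀.∈ F₀.𝓕 X₁ → F₀.Coded X₁ Q
      code₁ {Q} = μ₀.coded-finite s₁ fin₁ Q

      ι-joint : ∀ P Q → F₁.cyl (ι (P M₀.∪ Q)) ≡ F₁.cyl (ι P) M₁.∩ F₁.cyl (ι Q)
      ι-joint P Q = trans (cong F₁.cyl (ι-∪ P Q)) (sym (F₁.cyl-∪ (ι P) (ι Q)))

    -- The intersection has some measure `u` in the smaller model. In the larger one its measure is
    -- `embed u` by agreement, and the image of `r * s` by dissociation, so injectivity of `embed`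
    -- gives `u`.
    independent-down : μ₁.IsDissociated ν → (∀ x → x M₀.∈ X₀ → ¬ x M₀.∈ X₁) →
      ∀ P Q r s → P M₀.∈ F₀.𝓕 X₀ → Q M₀.∈ F₀.𝓕 X₁ →
      M₀.⟪ F₀.cyl P , μ₀.⌜ r ⌝ ⟫ M₀.∈ μ → M₀.⟪ F₀.cyl Q , μ₀.⌜ s ⌝ ⟫ M₀.∈ μ →
      M₀.⟪ F₀.cyl P M₀.∩ F₀.cyl Q , μ₀.⌜ r μ₀.* s ⌝ ⟫ M₀.∈ μ
    independent-down dis disj P Q r s hP hQ hr hs = conclude (μ₀.coded-measure (union⊆X s₀ s₁ fin₀ fin₁) C)
      where
      C : F₀.Coded (X₀ M₀.∪ X₁) (P M₀.∪ Q)
      C = joint-code s₀ s₁ fin₀ fin₁ P Q hP hQ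
      disj′ : ∀ x → x M₁.∈ ι X₀ → ¬ x M₁.∈ ι X₁
      disj′ x h h′ with ∈-down X₀ h
      ... | x₀ , refl = disj x₀ (∈-reflect h) (∈-reflect h′)
      product : M₁.⟪ F₁.cyl (ι P) M₁.∩ F₁.cyl (ι Q) , μ₁.⌜ embed r μ₁.* embed s ⌝ ⟫ M₁.∈ ν
      product = dis (ι X₀) (ι X₁) (finite-up fin₀) (finite-up fin₁) (subset-up s₀) (subset-up s₁) disj′
        _ _ (F₁.code-isCode (subset-up s₀) (coded-up (code₀ hP))) (F₁.code-isCode (subset-up s₁) (coded-up (code₁ hQ)))
        (F₁.cyl (ι P)) (F₁.cyl (ι Q)) _ (embed r) (embed s)
        (F₁.code-interpretation (subset-up s₀) (coded-up (code₀ hP)))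
        (F₁.code-interpretation (subset-up s₁) (coded-up (code₁ hQ))) M₁.∈-∩
        (cylinder-agrees s₀ (code₀ hP) r hr) (cylinder-agrees s₁ (code₁ hQ) s hs)
      conclude : (∃ λ u → M₀.⟪ F₀.cyl (P M₀.∪ Q) , μ₀.⌜ u ⌝ ⟫ M₀.∈ μ) →
                 M₀.⟪ F₀.cyl P M₀.∩ F₀.cyl Q , μ₀.⌜ r μ₀.* s ⌝ ⟫ M₀.∈ μ
      conclude (u , hu) = subst₂ (λ A z → M₀.⟪ A , μ₀.⌜ z ⌝ ⟫ M₀.∈ μ) (sym (F₀.cyl-∪ P Q))
        (injective (trans (μ₁.measure-unique {F₁.cyl (ι P) M₁.∩ F₁.cyl (ι Q)} {embed u} {embed r μ₁.* embed s}
          (subst (λ A → M₁.⟪ A , μ₁.⌜ embed u ⌝ ⟫ M₁.∈ ν) (ι-joint P Q)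
            (cylinder-agrees (union⊆X s₀ s₁ fin₀ fin₁) C u hu)) product) (sym (*-homo r s)))) hu

    -- The numbers `r` and `s` are arbitrary reals of the larger model, but as measures of cylinders
    -- from the smaller one they are images under `embed`, and the product can be computed before
    -- embedding.
    independent-up : μ₀.IsDissociated μ → (∀ x → x M₀.∈ X₀ → ¬ x M₀.∈ X₁) →
      ∀ P Q r s → P M₀.∈ F₀.𝓕 X₀ → Q M₀.∈ F₀.𝓕 X₁ →
      M₁.⟪ F₁.cyl (ι P) , μ₁.⌜ r ⌝ ⟫ M₁.∈ ν → M₁.⟪ F₁.cyl (ι Q) , μ₁.⌜ s ⌝ ⟫ M₁.∈ ν →
      M₁.⟪ F₁.cyl (ι P) M₁.∩ F₁.cyl (ι Q) , μ₁.⌜ r μ₁.* s ⌝ ⟫ M₁.∈ ν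
    independent-up dis disj P Q r s hP hQ hr hs =
      conclude (μ₀.coded-measure s₀ (code₀ hP)) (μ₀.coded-measure s₁ (code₁ hQ))
      where
      conclude : (∃ λ a → M₀.⟪ F₀.cyl P , μ₀.⌜ a ⌝ ⟫ M₀.∈ μ) → (∃ λ b → M₀.⟪ F₀.cyl Q , μ₀.⌜ b ⌝ ⟫ M₀.∈ μ) →
                 M₁.⟪ F₁.cyl (ι P) M₁.∩ F₁.cyl (ι Q) , μ₁.⌜ r μ₁.* s ⌝ ⟫ M₁.∈ ν
      conclude (a , ha) (b , hb) = subst₂ (λ A z → M₁.⟪ A , μ₁.⌜ z ⌝ ⟫ M₁.∈ ν) (ι-joint P Q)
        (trans (*-homo a b) (cong₂ μ₁._*_
          (μ₁.measure-unique {F₁.cyl (ι P)} {embed a} {r} (cylinder-agrees s₀ (code₀ hP) a ha) hr)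
          (μ₁.measure-unique {F₁.cyl (ι Q)} {embed b} {s} (cylinder-agrees s₁ (code₁ hQ) b hb) hs)))
        (cylinder-agrees (union⊆X s₀ s₁ fin₀ fin₁) (joint-code s₀ s₁ fin₀ fin₁ P Q hP hQ) (a μ₀.* b)
          (subst (λ A → M₀.⟪ A , μ₀.⌜ a μ₀.* b ⌝ ⟫ M₀.∈ μ) (F₀.cyl-∪ P Q)
            (dis X₀ X₁ fin₀ fin₁ s₀ s₁ disj _ _ (F₀.code-isCode s₀ (code₀ hP)) (F₀.code-isCode s₁ (code₁ hQ))
              (F₀.cyl P) (F₀.cyl Q) _ a b (F₀.code-interpretation s₀ (code₀ hP)) (F₀.code-interpretation s₁ (code₁ hQ))
              M₀.∈-∩ ha hb)))

  -- The image of `F₀.𝓕 Z` is used in place of the larger model's own family. Its members visibly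
  -- come from the smaller model, where agreement applies, and it still has the unions and the
  -- singletons that generation requires.
  generates-ι𝓕 : ∀ {Z} → (∀ x → x M₀.∈ Z → x M₀.∈ X) → M₀.IsFinite Z → μ₁.Generates (ι Z) (F₁.cylinders (ι (F₀.𝓕 Z)))
  generates-ι𝓕 {Z} Z⊆X fin = μ₁.generates (subset-up Z⊆X) (ι (F₀.𝓕 Z)) values unions singletons
    where
    values : ∀ P → P M₁.∈ ι (F₀.𝓕 Z) → ∃ λ r → M₁.⟪ F₁.cyl P , μ₁.⌜ r ⌝ ⟫ M₁.∈ ν
    values P h with ∈-down (F₀.𝓕 Z) h
    ... | P₀ , refl = let C = μ₀.coded-finite Z⊆X fin P₀ (∈-reflect h) ; (r , hr) = μ₀.coded-measure Z⊆X C in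
      embed r , cylinder-agrees Z⊆X C r hr
    unions : ∀ P Q → P M₁.∈ ι (F₀.𝓕 Z) → Q M₁.∈ ι (F₀.𝓕 Z) → P M₁.∪ Q M₁.∈ ι (F₀.𝓕 Z)
    unions P Q h h′ with ∈-down (F₀.𝓕 Z) h | ∈-down (F₀.𝓕 Z) h′
    ... | P₀ , refl | Q₀ , refl = subst (M₁._∈ ι (F₀.𝓕 Z)) (ι-∪ P₀ Q₀) (∈-up (F₀.∪∈𝓕 Z P₀ Q₀ (∈-reflect h) (∈-reflect h′)))
    singletons : ∀ p → F₁.IsFact (ι Z) p → M₁.｛ p , p ｝ M₁.∈ ι (F₀.𝓕 Z)
    singletons p h with fact-down h
    ... | p₀ , refl , h₀ = subst (M₁._∈ ι (F₀.𝓕 Z)) (ι-｛｝ p₀ p₀)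
      (∈-up (F₀.singleton∈𝓕 Z (from (F₀.∈-facts Z⊆X p₀) h₀)))

  dissociated-down : μ₁.IsDissociated ν → μ₀.IsDissociated μ
  dissociated-down dis X₀ X₁ fin₀ fin₁ s₀ s₁ disj =
    μ₀.dissociated-over (μ₀.generates-𝓕 s₀ fin₀) (μ₀.generates-𝓕 s₁ fin₁) independent
    where
    independent : ∀ A B r s → A M₀.∈ F₀.cylinders (F₀.𝓕 X₀) → B M₀.∈ F₀.cylinders (F₀.𝓕 X₁) →
      M₀.⟪ A , μ₀.⌜ r ⌝ ⟫ M₀.∈ μ → M₀.⟪ B , μ₀.⌜ s ⌝ ⟫ M₀.∈ μ → M₀.⟪ A M₀.∩ B , μ₀.⌜ r μ₀.* s ⌝ ⟫ M₀.∈ μ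
    independent A B r s hA hB with to (F₀.∈-cylinders A) hA | to (F₀.∈-cylinders B) hB
    ... | P , hP , refl | Q , hQ , refl = independent-down s₀ s₁ fin₀ fin₁ dis disj P Q r s hP hQ

  -- The finite sets tested in the larger model are subsets of `ι X`, so they belong to the smaller
  -- model, although the codes over them need not.
  dissociated-up : μ₀.IsDissociated μ → μ₁.IsDissociated ν
  dissociated-up dis X₀ X₁ fin₀ fin₁ s₀ s₁ disj with finite-down fin₀ s₀ | finite-down fin₁ s₁
  ... | Y₀ , refl , f₀ , t₀ | Y₁ , refl , f₁ , t₁ =
    μ₁.dissociated-over (generates-ι𝓕 t₀ f₀) (generates-ι𝓕 t₁ f₁) independent
    where
    independent : ∀ A B r s → A M₁.∈ F₁.cylinders (ι (F₀.𝓕 Y₀)) → B M₁.∈ F₁.cylinders (ι (F₀.𝓕 Y₁)) →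
      M₁.⟪ A , μ₁.⌜ r ⌝ ⟫ M₁.∈ ν → M₁.⟪ B , μ₁.⌜ s ⌝ ⟫ M₁.∈ ν → M₁.⟪ A M₁.∩ B , μ₁.⌜ r μ₁.* s ⌝ ⟫ M₁.∈ ν
    independent A B r s hA hB with to (F₁.∈-cylinders A) hA | to (F₁.∈-cylinders B) hB
    ... | P , hP , refl | Q , hQ , refl with ∈-down (F₀.𝓕 Y₀) hP | ∈-down (F₀.𝓕 Y₁) hQ
    ... | P₀ , refl | Q₀ , refl = independent-up t₀ t₁ f₀ f₁ dis (λ x h h′ → disj (ι x) (∈-up h) (∈-up h′))
      P₀ Q₀ r s (∈-reflect hP) (∈-reflect hQ)

-- The inclusion of transitive models, and the theorem

module _ {ℓ} {𝒱 : ZFCModel ℓ} {V₀ V₁ : TransitiveModel 𝒱} (V₀⊑V₁ : V₀ ⊑ V₁) where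
  private
    value-inj : ∀ {x y : ∣ V₀ ∣} → value x ≡ value y → x ≡ y
    value-inj {x Refinement., p} {_ Refinement., q} refl = refl

  -- Both models take membership from the background model, so `∈-up` and `∈-reflect` are
  -- identities; `∈-down` is the transitivity of `V₀`.
  inclusion-extension : EndExtension ⌊ V₀ ⌋ ⌊ V₁ ⌋
  inclusion-extension = record
    { ι         = incl V₀⊑V₁
    ; ι-inj     = λ e → value-inj (cong value e)
    ; ∈-up      = λ h → h
    ; ∈-reflect = λ h → h
    ; ∈-down    = λ { {v Refinement., _} (w Refinement., [ hw ]) h →
        (v Refinement., [ TransitiveModel.transitive V₀ hw h ]) , refl }
    }

proposition5p18 : ∀ {ℓ : Level} → ExcludedMiddle ℓ →
    (𝒱 : ZFCModel ℓ) (V₀ V₁ : TransitiveModel 𝒱) (V₀⊑V₁ : V₀ ⊑ V₁) →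
    (κ X 𝓛 : ∣ V₀ ∣) →
    IsOrdinal ⌊ V₀ ⌋ κ → IsInfinite ⌊ V₀ ⌋ κ →
    IsInfinite ⌊ V₀ ⌋ X → IsRelationalLanguage ⌊ V₀ ⌋ 𝓛 →
    (ℝ₀ : Reals ⌊ V₀ ⌋) (ℝ₁ : Reals ⌊ V₁ ⌋) (j : RealEmbedding V₀⊑V₁ ℝ₀ ℝ₁) →
    (μ : ∣ V₀ ∣) → IsInvariantMeasure ⌊ V₀ ⌋ κ X 𝓛 ℝ₀ μ →
    (μ^V₁ : ∣ V₁ ∣) → IsRelativization V₀⊑V₁ κ X 𝓛 j μ μ^V₁ →
    IsDissociated ⌊ V₀ ⌋ κ X 𝓛 ℝ₀ μ ⇔
    IsDissociated ⌊ V₁ ⌋ (incl V₀⊑V₁ κ) (incl V₀⊑V₁ X) (incl V₀⊑V₁ 𝓛) ℝ₁ μ^V₁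
proposition5p18 em 𝒱 V₀ V₁ V₀⊑V₁ κ X 𝓛 ord inf _ rel ℝ₀ ℝ₁ j μ (prob , _) μ^V₁ relativization =
  mk⇔ dissociated-up dissociated-down
  where
  open RealEmbedding j
  open IsRelativization relativization
  open Transfer em ⌊ V₀ ⌋ ⌊ V₁ ⌋ (inclusion-extension V₀⊑V₁) κ X 𝓛 ord inf rel ℝ₀ ℝ₁ embed isMonomorphism
    μ prob μ^V₁ isProbabilityκMeasure agrees
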